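{- Let $k\ge1$ be a fixed integer. For $\omega\in\mathfrak{B}_n$ chosen uniformly at random, with $\beta=\beta(\omega)$, as $n\to\infty$, $$\mathbb{E}\left[\left(\frac{\beta}{n^3}\right)^k\right]=\frac{6}{2^k}\int_{0\le x<y<z\le1}(y-x)^k(z-x)^k(z-y)^k\,dV+O\left(\frac{k}{2^kn}\right).$$
   Context: $\mathfrak{S}_n$ is the set of permutations of $[n]=\{1,\dots,n\}$, in one-line notation. A reduction of $\omega\in\mathfrak{S}_n$ interchanges $\omega(i)$ and $\omega(j)$ for some $i<j$ with $\omega(i)>\omega(j)$. Bruhat order: $\pi\le\sigma$ if $\pi$ is obtained from $\sigma$ by a (possibly empty) sequence of reductions. $\mathfrak{B}_n\subseteq\mathfrak{S}_n$ is the set of bigrassmannian permutations, i.e. those $\omega$ such that both $\omega$ and $\omega^{ -1}$ have exactly one descent; equivalently $\omega=1\cdots a\,(b+1)\cdots c\,(a+1)\cdots b\,(c+1)\cdots n$ for some $0\le a<b<c\le n$. For $\omega\in\mathfrak{B}_n$, $\beta(\omega)$ is the number of $\pi\in\mathfrak{B}_n$ with $\pi\le\omega$. The integral is over the region $\{(x,y,z)\in\mathbb{R}^3:0\le x<y<z\le 1\}$ with respect to Lebesgue measure. The $O$-notation is for $n\to\infty$ with $k$ fixed. -}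

module Defs where

open import Data.Bool.Base using (if_then_else_)
open import Data.Fin.Base as Fin using (Fin; zero; suc; toℕ; inject₁; punchIn)
import Data.Fin.Induction as Fin
import Data.Fin.Properties as Fin
open import Data.Fin.Permutation as Perm
  using (Permutation′; _⟨$⟩ʳ_; _≈_; _∘ₚ_; transpose; flip; insert; remove)
import Data.Fin.Permutation.Components as PC
open import Data.Integer.Base using (+_)
open import Data.List.Base
  using (List; []; _∷_; [_]; map; foldr; length; filter; allFin; cartesianProductWith)
import Data.List.Membership.Setoid as Membership
import Data.List.Membership.Setoid.Properties as Membership
open import Data.List.Membership.Propositional.Properties using (∈-allFin)
open import Data.List.Relation.Unary.All using ([])
open import Data.List.Relation.Unary.AllPairs using ([]; _∷_)
open import Data.List.Relation.Unary.Any using (here)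
import Data.List.Relation.Unary.Unique.Setoid as Unique
import Data.List.Relation.Unary.Unique.Setoid.Properties as Unique
import Data.List.Relation.Unary.Unique.Propositional.Properties as Uniqueₚ
open import Data.Nat.Base as ℕ using (ℕ; zero; suc; NonZero; z≤n; s≤s)
import Data.Nat.Properties as ℕ
open import Data.Product.Base using (_×_; _,_; ∃; ∃₂; proj₁; proj₂)
open import Data.Rational.Base as ℚ using (ℚ; 0ℚ; _/_; _+_; _-_; _*_; ∣_∣; _≤_; _<_)
import Data.Rational.Properties as ℚ
open import Data.Vec.Base using (tabulate)
import Data.Vec.Relation.Binary.Lex.Strict as Lex
open import Data.Vec.Relation.Binary.Lex.Core using (this; next)
open import Function.Base using (_∘_)
open import Induction.WellFounded using (Acc; acc)
open import Level using (0ℓ)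
open import Relation.Binary.Bundles using (Setoid)
open import Relation.Binary.Definitions using (Decidable)
open import Relation.Binary.PropositionalEquality
  using (_≡_; _≢_; refl; sym; trans; cong; subst; setoid)
open import Relation.Nullary using (Dec; yes; no; does; contradiction)
open import Relation.Nullary.Decidable using (_×-dec_; dec-true; dec-false)
import Relation.Nullary.Decidable as Dec

open import Algebra.Definitions.RawSemiring ℚ.+-*-rawSemiring public using (_^_; sum)

private
  variable
    n : ℕ

------------------------------------------------------------------------
-- Permutations, as a setoid under pointwise equality

≈-setoid : ℕ → Setoid 0ℓ 0ℓ
≈-setoid n = record
  { Carrier       = Permutation′ n
  ; _≈_           = _≈_
  ; isEquivalence = record
    { refl  = λ _ → refl
    ; sym   = λ p i → sym (p i)
    ; trans = λ p q i → trans (p i) (q i)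
    }
  }

-- Every permutation, exactly once up to ≈ (see permutations-complete and
-- permutations-unique).
permutations : ∀ n → List (Permutation′ n)
permutations zero    = [ Perm.id ]
permutations (suc n) = cartesianProductWith (insert zero) (allFin (suc n)) (permutations n)

private
  insert-cong : ∀ {i j : Fin (suc n)} {π ρ : Permutation′ n} → i ≡ j → π ≈ ρ →
                insert zero i π ≈ insert zero j ρ
  insert-cong         refl p zero    = refl
  insert-cong {i = i} refl p (suc k) = cong (punchIn i) (p k)

  insert-injective : ∀ {i j : Fin (suc n)} {π ρ : Permutation′ n} →
                     insert zero i π ≈ insert zero j ρ → i ≡ j × π ≈ ρ
  insert-injective {i = i} e with e zero
  ... | refl = refl , λ k → Fin.punchIn-injective i _ _ (e (suc k))

permutations-complete : (ω : Permutation′ n) → Membership._∈_ (≈-setoid n) ω (permutations n)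
permutations-complete {zero}  ω = here (λ ())
permutations-complete {suc n} ω = Membership.∈-resp-≈ (≈-setoid (suc n))
  {x = insert zero (ω ⟨$⟩ʳ zero) (remove zero ω)} {y = ω} (Perm.insert-remove zero ω)
  (Membership.∈-cartesianProductWith⁺ (setoid _) (≈-setoid n) (≈-setoid (suc n))
    (λ {_} {_} {π} {ρ} → insert-cong {π = π} {ρ}) (∈-allFin (ω ⟨$⟩ʳ zero)) (permutations-complete (remove zero ω)))

permutations-unique : ∀ n → Unique.Unique (≈-setoid n) (permutations n)
permutations-unique zero    = [] ∷ []
permutations-unique (suc n) =
  Unique.cartesianProductWith⁺ (setoid _) (≈-setoid n) (≈-setoid (suc n))
    (insert zero) (λ {_} {_} {π} {ρ} → insert-injective {π = π} {ρ}) (Uniqueₚ.allFin⁺ (suc n)) (permutations-unique n)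

------------------------------------------------------------------------
-- Bruhat order

-- One-line notation of transpose i j ∘ₚ σ is that of σ with the entries in
-- positions i and j interchanged.
infix 4 _≤ᴮ_

data _≤ᴮ_ {n} (π : Permutation′ n) (σ : Permutation′ n) : Set where
  done   : π ≈ σ → π ≤ᴮ σ
  reduce : ∀ i j → i Fin.< j → σ ⟨$⟩ʳ j Fin.< σ ⟨$⟩ʳ i →
           π ≤ᴮ transpose i j ∘ₚ σ → π ≤ᴮ σ

-- The order is decidable because a reduction lowers the one-line notation
-- lexicographically.
private
  infix 4 _<ˡ_

  _<ˡ_ : Permutation′ n → Permutation′ n → Set
  π <ˡ σ = Lex.Lex-< _≡_ Fin._<_ (tabulate (π ⟨$⟩ʳ_)) (tabulate (σ ⟨$⟩ʳ_))

  tabulate-< : ∀ {m} (f g : Fin m → Fin n) i → (∀ k → k Fin.< i → f k ≡ g k) → f i Fin.< g i →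
               Lex.Lex-< _≡_ Fin._<_ (tabulate f) (tabulate g)
  tabulate-< f g zero    eq lt = this lt refl
  tabulate-< f g (suc i) eq lt = next (eq zero (s≤s z≤n))
    (tabulate-< (f ∘ suc) (g ∘ suc) i (λ k k<i → eq (suc k) (s≤s k<i)) lt)

  transpose-else : ∀ {i j k : Fin n} → k ≢ i → k ≢ j → PC.transpose i j k ≡ k
  transpose-else {i = i} {j} {k} k≢i k≢j
    rewrite dec-false (k Fin.≟ i) k≢i | dec-false (k Fin.≟ j) k≢j = refl

  transpose-left : ∀ (i j : Fin n) → PC.transpose i j i ≡ j
  transpose-left i j rewrite dec-true (i Fin.≟ i) refl = refl

  reduce-< : ∀ (σ : Permutation′ n) i j → i Fin.< j → σ ⟨$⟩ʳ j Fin.< σ ⟨$⟩ʳ i →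
             transpose i j ∘ₚ σ <ˡ σ
  reduce-< σ i j i<j σj<σi = tabulate-< _ _ i
    (λ k k<i → cong (σ ⟨$⟩ʳ_)
      (transpose-else (Fin.<⇒≢ k<i) (Fin.<⇒≢ (Fin.<-trans k<i i<j))))
    (subst (λ k → σ ⟨$⟩ʳ k Fin.< σ ⟨$⟩ʳ i) (sym (transpose-left i j)) σj<σi)

  decide : ∀ (π σ : Permutation′ n) → Acc (Lex.Lex-< _≡_ Fin._<_) (tabulate (σ ⟨$⟩ʳ_)) → Dec (π ≤ᴮ σ)
  decide π σ (acc rec) with Fin.all? (λ i → π ⟨$⟩ʳ i Fin.≟ σ ⟨$⟩ʳ i)
  ... | yes π≈σ = yes (done π≈σ)
  ... | no  π≉σ = Dec.map′
      (λ (i , j , i<j , σj<σi , rest) → reduce i j i<j σj<σi rest)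
      (λ { (done π≈σ)                  → contradiction π≈σ π≉σ
         ; (reduce i j i<j σj<σi rest) → i , j , i<j , σj<σi , rest })
      (Fin.any? λ i → Fin.any? λ j → step? i j)
    where
    step? : ∀ i j → Dec (i Fin.< j × σ ⟨$⟩ʳ j Fin.< σ ⟨$⟩ʳ i × π ≤ᴮ transpose i j ∘ₚ σ)
    step? i j with i Fin.<? j | (σ ⟨$⟩ʳ j) Fin.<? (σ ⟨$⟩ʳ i)
    ... | no i≮j  | _         = no (i≮j ∘ proj₁)
    ... | yes _   | no σj≮σi  = no (σj≮σi ∘ proj₁ ∘ proj₂)
    ... | yes i<j | yes σj<σi = Dec.map′ (λ p → i<j , σj<σi , p) (proj₂ ∘ proj₂)
      (decide π (transpose i j ∘ₚ σ) (rec (reduce-< σ i j i<j σj<σi)))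

infix 4 _≤ᴮ?_

_≤ᴮ?_ : Decidable (_≤ᴮ_ {n})
π ≤ᴮ? σ = decide π σ
  (Lex.<-wellFounded trans (subst (_ Fin.<_)) Fin.<-wellFounded _)

------------------------------------------------------------------------
-- Bigrassmannian permutations

descents : Permutation′ n → ℕ
descents {zero}  ω = 0
descents {suc m} ω =
  length (filter (λ i → (ω ⟨$⟩ʳ suc i) Fin.<? (ω ⟨$⟩ʳ inject₁ i)) (allFin m))

Bigrassmannian : Permutation′ n → Set
Bigrassmannian ω = descents ω ≡ 1 × descents (flip ω) ≡ 1

bigrassmannian? : (ω : Permutation′ n) → Dec (Bigrassmannian ω)
bigrassmannian? ω = (descents ω ℕ.≟ 1) ×-dec (descents (flip ω) ℕ.≟ 1)

𝔅 : ∀ n → List (Permutation′ n)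
𝔅 n = filter bigrassmannian? (permutations n)

β : Permutation′ n → ℕ
β {n} ω = length (filter (_≤ᴮ? ω) (𝔅 n))

------------------------------------------------------------------------
-- Expectation, asymptotics, integration

-- Expectation of f under the uniform distribution on the entries of a list;
-- the value on the empty list is junk.
mean : ∀ {A : Set} → List A → (A → ℚ) → ℚ
mean []       f = 0ℚ
mean (a ∷ as) f = foldr _+_ 0ℚ (map f (a ∷ as)) * (+ 1 / length (a ∷ as))

infix 4 _=O_

_=O_ : (f g : ∀ n → .{{NonZero n}} → ℚ) → Set
f =O g = ∃₂ λ (C : ℚ) (N : ℕ) → ∀ n .{{_ : NonZero n}} → n ℕ.≥ N → ∣ f n ∣ ≤ C * ∣ g n ∣

_∈Cell_ : ∀ {N} .{{_ : NonZero N}} → ℚ → Fin N → Set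
_∈Cell_ {N} q i = + toℕ i / N ≤ q × q ≤ + suc (toℕ i) / N

-- The Riemann integral over the unit cube: sums over the subdivision into N³
-- equal closed subcubes, with arbitrary rational tags, converge to I.  For the
-- restriction to rational points of a continuous real function, this says
-- that I is its Lebesgue integral over [0,1]³.
IsIntegral : (ℚ → ℚ → ℚ → ℚ) → ℚ → Set
IsIntegral f I = ∀ ε → 0ℚ < ε → ∃ λ (N₀ : ℕ) → ∀ N .{{_ : NonZero N}} → N ℕ.≥ N₀ →
  (x y z : Fin N → Fin N → Fin N → ℚ) →
  (∀ a b c → x a b c ∈Cell a × y a b c ∈Cell b × z a b c ∈Cell c) →
  ∣ sum (λ a → sum (λ b → sum (λ c →
      f (x a b c) (y a b c) (z a b c) * (+ 1 / N) ^ 3))) - I ∣ ≤ ε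

Region : ℚ → ℚ → ℚ → Set
Region x y z = 0ℚ ≤ x × x < y × y < z × z ≤ ℚ.1ℚ

region? : ∀ x y z → Dec (Region x y z)
region? x y z = (0ℚ ℚ.≤? x) ×-dec (x ℚ.<? y) ×-dec (y ℚ.<? z) ×-dec (z ℚ.≤? ℚ.1ℚ)

-- An integral over Region ⊆ [0,1]³ is that of the integrand extended by 0.  If
-- f is continuous and vanishes where x = y or y = z, so is the extension
-- continuous on [0,1]³.  A rational I loses nothing when f is a polynomial with
-- rational coefficients.
IsIntegralOverRegion : (ℚ → ℚ → ℚ → ℚ) → ℚ → Set
IsIntegralOverRegion f = IsIntegral λ x y z → if does (region? x y z) then f x y z else 0ℚ

-- The bigrassmannian permutation 1⋯a (b+1)⋯c (a+1)⋯b (c+1)⋯n dominates the one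
-- with parameters a′, b′, c′ in Bruhat order exactly when a ≤ a′, c′ ≤ c,
-- b′ − a′ ≤ b − a and c′ − b′ ≤ c − b: reductions preserve every bound of the
-- entries by a monotone function of the position, and conversely π ≤ σ whenever
-- σ lies above π before some position and below π from there on.  Counting such
-- triples gives β = (b − a)(c − b)(c − a) / 2, so the k-th moment is a sum of
-- ((b − a)(c − b)(c − a))ᵏ over 0 ≤ a < b < c ≤ n.  Up to lower order terms that
-- sum is I n³ᵏ⁺³ with I rational, since it is a double prefix sum of
-- lᵏ Σ_{s<l} sᵏ(l − s)ᵏ, and powers and their convolutions have rational leading
-- coefficients.  The integrand is Lipschitz on the cube, so its Riemann sums
-- over the grid of mesh 1/N differ by O(1/N) from the same sum divided by
-- N³ᵏ⁺³; hence I is the integral.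

module Submission where

-- One sum serves every purpose. With truncated subtraction, (b ∸ a)(c ∸ a)(c ∸ b) vanishes unless a
-- < b < c, so sums over increasing triples become sums over a full cube; positive parts do the same
-- for the integrand. `tripleSum` therefore yields the moments, the grid sums and, with an indicator
-- in place of the power, the size of `𝔅 n`. No antiderivative occurs: the integral is identified as
-- the limit B(k+1, k+1) / ((3k+2)(3k+3)) of scaled sums, B being the Beta function. Two obstacles
-- shape the combinatorics. Permutations are compared pointwise and not by propositional equality,
-- so lists of them are matched with lists of parameters along a relation. And descents are awkward
-- at the ends of a finite range, so each permutation is extended to ℕ by the identity; it and its
-- inverse become mutually inverse functions with one descent each, and whatever is shown for one
-- holds for the other with s = b - a and t = c - b exchanged. The converse Bruhat criterion
-- requires a reduction that preserves its own hypothesis; the two positions to interchange are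
-- found by following cycles of σ⁻¹π.

module Asymptotics where

  open import Defs using (_^_; sum; _∈Cell_; IsIntegralOverRegion; region?; mean)
  open import Algebra.Bundles using (CommutativeRing)
  open import Data.Bool.Base using (if_then_else_)
  open import Data.Fin.Base using (Fin; zero; suc; toℕ)
  import Data.Fin.Properties as Fin
  import Data.Integer.Base as ℤ
  import Data.Integer.Properties as ℤ
  open import Data.List.Base using (List; []; _∷_; foldr; map; length)
  open import Data.Maybe.Base using (Maybe; just; nothing)
  open import Data.Nat.Base as ℕ using (ℕ; zero; suc)
  import Data.Nat.Properties as ℕ
  open import Data.Nat.Properties using (m^n≢0; m*n≢0)
  open import Data.Product.Base using (∃; _×_; _,_; proj₁; proj₂)
  open import Data.Rational.Base hiding (NonZero)
  import Data.Rational.Properties as ℚ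
  import Data.Rational.Unnormalised.Base as ℚᵘ
  import Data.Rational.Unnormalised.Properties as ℚᵘ
  open import Data.Sum.Base using (inj₁; inj₂)
  open import Function.Base using (_∘_)
  open import Relation.Binary.PropositionalEquality
  open import Relation.Nullary using (¬_; yes; no; does)
  open import Relation.Nullary.Decidable using (dec-true; dec-false)
  open import Tactic.RingSolver using (solve-∀)
  open import Tactic.RingSolver.Core.AlmostCommutativeRing using (AlmostCommutativeRing; fromCommutativeRing)
  open import Algebra.Properties.CommutativeSemiring.Exp
    (CommutativeRing.commutativeSemiring ℚ.+-*-commutativeRing) using (^-distrib-*; ^-homo-*)

  -- Rational arithmetic and finite sums

  ℚ-ring : AlmostCommutativeRing _ _
  ℚ-ring = fromCommutativeRing ℚ.+-*-commutativeRing isZero?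
    where
    isZero? : ∀ x → Maybe (0ℚ ≡ x)
    isZero? x with 0ℚ ℚ.≟ x
    ... | yes p = just p
    ... | no _  = nothing

  abstract
    -- Opaque, so that numerals such as `ι 6` stay atoms instead of unfolding to normalised
    -- fractions; `ι-0` and `ι-1` give the two values that have to be known.
    ι : ℕ → ℚ
    ι n = ℤ.+ n / 1

    toℚᵘ-ι : ∀ n → toℚᵘ (ι n) ℚᵘ.≃ (ℤ.+ n ℚᵘ./ 1)
    toℚᵘ-ι n = ℚ.toℚᵘ-fromℚᵘ (ℤ.+ n ℚᵘ./ 1)

    ι-+ : ∀ m n → ι (m ℕ.+ n) ≡ ι m + ι n
    ι-+ m n = ℚ.toℚᵘ-injective (begin
      toℚᵘ (ι (m ℕ.+ n))        ≈⟨ toℚᵘ-ι (m ℕ.+ n) ⟩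
      ℤ.+ (m ℕ.+ n) ℚᵘ./ 1      ≈⟨ ℚᵘ.*≡* (cong₂ (λ x y → (x ℤ.+ y) ℤ.* ℤ.+ 1) (sym (ℤ.*-identityʳ (ℤ.+ m))) (sym (ℤ.*-identityʳ (ℤ.+ n)))) ⟩
      (ℤ.+ m ℚᵘ./ 1) ℚᵘ.+ (ℤ.+ n ℚᵘ./ 1) ≈⟨ ℚᵘ.+-cong (toℚᵘ-ι m) (toℚᵘ-ι n) ⟨
      toℚᵘ (ι m) ℚᵘ.+ toℚᵘ (ι n) ≈⟨ ℚ.toℚᵘ-homo-+ (ι m) (ι n) ⟨
      toℚᵘ (ι m + ι n) ∎)
      where open ℚᵘ.≃-Reasoning

    ι-* : ∀ m n → ι (m ℕ.* n) ≡ ι m * ι n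
    ι-* m n = ℚ.toℚᵘ-injective (begin
      toℚᵘ (ι (m ℕ.* n))        ≈⟨ toℚᵘ-ι (m ℕ.* n) ⟩
      ℤ.+ (m ℕ.* n) ℚᵘ./ 1      ≈⟨ ℚᵘ.*≡* (cong (ℤ._* ℤ.+ 1) (ℤ.pos-* m n)) ⟩
      (ℤ.+ m ℚᵘ./ 1) ℚᵘ.* (ℤ.+ n ℚᵘ./ 1) ≈⟨ ℚᵘ.*-cong (toℚᵘ-ι m) (toℚᵘ-ι n) ⟨
      toℚᵘ (ι m) ℚᵘ.* toℚᵘ (ι n) ≈⟨ ℚ.toℚᵘ-homo-* (ι m) (ι n) ⟨
      toℚᵘ (ι m * ι n) ∎)
      where open ℚᵘ.≃-Reasoning

    -- The fractions of the theorem are cleared by this cancellation law; the estimates are proved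
    -- after multiplying out.
    /-*-ι : ∀ m n .{{_ : ℕ.NonZero n}} → (ℤ.+ m / n) * ι n ≡ ι m
    /-*-ι m n@(suc n-1) = ℚ.toℚᵘ-injective (begin
      toℚᵘ ((ℤ.+ m / n) * ι n)        ≈⟨ ℚ.toℚᵘ-homo-* (ℤ.+ m / n) (ι n) ⟩
      toℚᵘ (ℤ.+ m / n) ℚᵘ.* toℚᵘ (ι n) ≈⟨ ℚᵘ.*-cong (ℚ.toℚᵘ-fromℚᵘ (ℤ.+ m ℚᵘ./ n)) (toℚᵘ-ι n) ⟩
      (ℤ.+ m ℚᵘ./ n) ℚᵘ.* (ℤ.+ n ℚᵘ./ 1) ≈⟨ ℚᵘ.*≡* (trans (ℤ.*-identityʳ _) (cong (λ k → ℤ.+ m ℤ.* ℤ.+ k) (sym (ℕ.*-identityʳ n)))) ⟩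
      ℤ.+ m ℚᵘ./ 1                    ≈⟨ toℚᵘ-ι m ⟨
      toℚᵘ (ι m) ∎)
      where open ℚᵘ.≃-Reasoning

    ι-mono-≤ : ∀ {m n} → m ℕ.≤ n → ι m ≤ ι n
    ι-mono-≤ {m} {n} m≤n = ℚ.toℚᵘ-cancel-≤ (begin
      toℚᵘ (ι m)  ≃⟨ toℚᵘ-ι m ⟩
      ℤ.+ m ℚᵘ./ 1  ≤⟨ ℚᵘ.*≤* (subst₂ ℤ._≤_ (sym (ℤ.*-identityʳ (ℤ.+ m))) (sym (ℤ.*-identityʳ (ℤ.+ n))) (ℤ.+≤+ m≤n)) ⟩
      ℤ.+ n ℚᵘ./ 1  ≃⟨ toℚᵘ-ι n ⟨
      toℚᵘ (ι n)  ∎)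
      where open ℚᵘ.≤-Reasoning

    ι-injective : ∀ {m n} → ι m ≡ ι n → m ≡ n
    ι-injective {m} {n} ιm≡ιn = ℤ.+-injective (subst₂ _≡_ (ℤ.*-identityʳ (ℤ.+ m)) (ℤ.*-identityʳ (ℤ.+ n))
      (ℚᵘ.drop-*≡* (ℚᵘ.≃-trans (ℚᵘ.≃-sym (toℚᵘ-ι m)) (ℚᵘ.≃-trans (ℚ.toℚᵘ-cong ιm≡ιn) (toℚᵘ-ι n)))))

    ι-0 : ι 0 ≡ 0ℚ
    ι-0 = refl

    ι-1 : ι 1 ≡ 1ℚ
    ι-1 = refl

  ι-nonneg : ∀ n → 0ℚ ≤ ι n
  ι-nonneg n = subst (_≤ ι n) ι-0 (ι-mono-≤ {0} {n} ℕ.z≤n)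

  ι-suc : ∀ n → ι (suc n) ≡ ι n + 1ℚ
  ι-suc n = trans (cong ι (ℕ.+-comm 1 n)) (trans (ι-+ n 1) (cong (ι n +_) ι-1))

  ι-^ : ∀ m n → ι (m ℕ.^ n) ≡ ι m ^ n
  ι-^ m zero    = ι-1
  ι-^ m (suc n) = trans (ι-* m (m ℕ.^ n)) (cong (ι m *_) (ι-^ m n))

  ι-∸ : ∀ {m n} → n ℕ.≤ m → ι (m ℕ.∸ n) ≡ ι m - ι n
  ι-∸ {m} {n} n≤m = begin
    ι (m ℕ.∸ n)                 ≡⟨ lemma (ι (m ℕ.∸ n)) (ι n) ⟩
    ι (m ℕ.∸ n) + ι n - ι n     ≡⟨ cong (_- ι n) (ι-+ (m ℕ.∸ n) n) ⟨
    ι (m ℕ.∸ n ℕ.+ n) - ι n     ≡⟨ cong (λ k → ι k - ι n) (ℕ.m∸n+n≡m n≤m) ⟩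
    ι m - ι n                   ∎
    where
    open ≡-Reasoning
    lemma : ∀ x y → x ≡ x + y - y
    lemma = solve-∀ ℚ-ring

  *-monoˡ-≤ : ∀ {r p q} → 0ℚ ≤ r → p ≤ q → r * p ≤ r * q
  *-monoˡ-≤ {r} 0≤r = ℚ.*-monoˡ-≤-nonNeg r {{nonNegative 0≤r}}

  *-monoʳ-≤ : ∀ {r p q} → 0ℚ ≤ r → p ≤ q → p * r ≤ q * r
  *-monoʳ-≤ {r} 0≤r = ℚ.*-monoʳ-≤-nonNeg r {{nonNegative 0≤r}}

  *-mono-≤ : ∀ {p q r s} → 0ℚ ≤ p → 0ℚ ≤ s → p ≤ q → r ≤ s → p * r ≤ q * s
  *-mono-≤ 0≤p 0≤s p≤q r≤s = ℚ.≤-trans (*-monoˡ-≤ 0≤p r≤s) (*-monoʳ-≤ 0≤s p≤q)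

  *-nonneg : ∀ {p q} → 0ℚ ≤ p → 0ℚ ≤ q → 0ℚ ≤ p * q
  *-nonneg {p} {q} 0≤p 0≤q = subst (_≤ p * q) (ℚ.*-zeroʳ p) (*-monoˡ-≤ 0≤p 0≤q)

  +-nonneg : ∀ {p q} → 0ℚ ≤ p → 0ℚ ≤ q → 0ℚ ≤ p + q
  +-nonneg 0≤p 0≤q = ℚ.+-mono-≤ 0≤p 0≤q

  0≤1 : 0ℚ ≤ 1ℚ
  0≤1 = ℚ.nonNegative⁻¹ 1ℚ

  ^-nonneg : ∀ {p} n → 0ℚ ≤ p → 0ℚ ≤ p ^ n
  ^-nonneg zero    0≤p = 0≤1
  ^-nonneg (suc n) 0≤p = *-nonneg 0≤p (^-nonneg n 0≤p)

  ^-mono-≤ : ∀ {p q} n → 0ℚ ≤ p → p ≤ q → p ^ n ≤ q ^ n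
  ^-mono-≤ zero    0≤p p≤q = ℚ.≤-refl
  ^-mono-≤ (suc n) 0≤p p≤q = *-mono-≤ 0≤p (^-nonneg n (ℚ.≤-trans 0≤p p≤q)) p≤q (^-mono-≤ n 0≤p p≤q)

  ∣p∣≤q : ∀ {p q} → p ≤ q → - p ≤ q → ∣ p ∣ ≤ q
  ∣p∣≤q {p} {q} p≤q -p≤q with ℚ.∣p∣≡p∨∣p∣≡-p p
  ... | inj₁ e = subst (_≤ q) (sym e) p≤q
  ... | inj₂ e = subst (_≤ q) (sym e) -p≤q

  ∣-∣-triangle : ∀ p q r → ∣ p - r ∣ ≤ ∣ p - q ∣ + ∣ q - r ∣
  ∣-∣-triangle p q r = subst (λ x → ∣ x ∣ ≤ ∣ p - q ∣ + ∣ q - r ∣) (lemma p q r) (ℚ.∣p+q∣≤∣p∣+∣q∣ (p - q) (q - r))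
    where
    lemma : ∀ p q r → (p - q) + (q - r) ≡ p - r
    lemma = solve-∀ ℚ-ring

  -- Peels off the first term, as `sum` over `Fin` and `applyUpTo` do, so that either converts to it
  -- by plain recursion.
  Σ< : ℕ → (ℕ → ℚ) → ℚ
  Σ< zero    f = 0ℚ
  Σ< (suc n) f = f 0 + Σ< n (f ∘ suc)

  Σ<-cong : ∀ n {f g : ℕ → ℚ} → (∀ i → i ℕ.< n → f i ≡ g i) → Σ< n f ≡ Σ< n g
  Σ<-cong zero    eq = refl
  Σ<-cong (suc n) eq = cong₂ _+_ (eq 0 ℕ.z<s) (Σ<-cong n (λ i i<n → eq (suc i) (ℕ.s<s i<n)))

  Σ<-∣-∣ : ∀ n {f g h : ℕ → ℚ} → (∀ i → i ℕ.< n → ∣ f i - g i ∣ ≤ h i) → ∣ Σ< n f - Σ< n g ∣ ≤ Σ< n h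
  Σ<-∣-∣ zero    le = ℚ.≤-refl
  Σ<-∣-∣ (suc n) {f} {g} {h} le = begin
    ∣ (f 0 + Σ< n (f ∘ suc)) - (g 0 + Σ< n (g ∘ suc)) ∣    ≡⟨ cong ∣_∣ (lemma (f 0) _ (g 0) _) ⟩
    ∣ (f 0 - g 0) + (Σ< n (f ∘ suc) - Σ< n (g ∘ suc)) ∣    ≤⟨ ℚ.∣p+q∣≤∣p∣+∣q∣ (f 0 - g 0) _ ⟩
    ∣ f 0 - g 0 ∣ + ∣ Σ< n (f ∘ suc) - Σ< n (g ∘ suc) ∣    ≤⟨ ℚ.+-mono-≤ (le 0 ℕ.z<s) (Σ<-∣-∣ n (λ i i<n → le (suc i) (ℕ.s<s i<n))) ⟩
    h 0 + Σ< n (h ∘ suc)                                  ∎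
    where
    open ℚ.≤-Reasoning
    lemma : ∀ a b c d → (a + b) - (c + d) ≡ (a - c) + (b - d)
    lemma = solve-∀ ℚ-ring

  Σ<-+ : ∀ n (f g : ℕ → ℚ) → Σ< n (λ i → f i + g i) ≡ Σ< n f + Σ< n g
  Σ<-+ zero    f g = refl
  Σ<-+ (suc n) f g = trans (cong (f 0 + g 0 +_) (Σ<-+ n (f ∘ suc) (g ∘ suc))) (lemma (f 0) (g 0) _ _)
    where
    lemma : ∀ a b c d → a + b + (c + d) ≡ a + c + (b + d)
    lemma = solve-∀ ℚ-ring

  Σ<-*ˡ : ∀ n c (f : ℕ → ℚ) → Σ< n (λ i → c * f i) ≡ c * Σ< n f
  Σ<-*ˡ zero    c f = sym (ℚ.*-zeroʳ c)
  Σ<-*ˡ (suc n) c f = trans (cong (c * f 0 +_) (Σ<-*ˡ n c (f ∘ suc))) (sym (ℚ.*-distribˡ-+ c (f 0) _))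

  Σ<-*ʳ : ∀ n c (f : ℕ → ℚ) → Σ< n (λ i → f i * c) ≡ Σ< n f * c
  Σ<-*ʳ n c f = trans (Σ<-cong n (λ i _ → ℚ.*-comm (f i) c)) (trans (Σ<-*ˡ n c f) (ℚ.*-comm c _))

  Σ<-suc : ∀ n (f : ℕ → ℚ) → Σ< (suc n) f ≡ Σ< n f + f n
  Σ<-suc zero    f = ℚ.+-comm (f 0) 0ℚ
  Σ<-suc (suc n) f = trans (cong (f 0 +_) (Σ<-suc n (f ∘ suc))) (sym (ℚ.+-assoc (f 0) _ _))

  Σ<-const : ∀ n c → Σ< n (λ _ → c) ≡ ι n * c
  Σ<-const zero    c = sym (trans (cong (_* c) ι-0) (ℚ.*-zeroˡ c))
  Σ<-const (suc n) c = begin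
    c + Σ< n (λ _ → c)   ≡⟨ cong (c +_) (Σ<-const n c) ⟩
    c + ι n * c          ≡⟨ lemma c (ι n) ⟩
    (ι n + 1ℚ) * c       ≡⟨ cong (_* c) (ι-suc n) ⟨
    ι (suc n) * c        ∎
    where
    open ≡-Reasoning
    lemma : ∀ c x → c + x * c ≡ (x + 1ℚ) * c
    lemma = solve-∀ ℚ-ring

  Σ<-0 : ∀ n {f : ℕ → ℚ} → (∀ i → f i ≡ 0ℚ) → Σ< n f ≡ 0ℚ
  Σ<-0 zero    eq = refl
  Σ<-0 (suc n) eq = cong₂ _+_ (eq 0) (Σ<-0 n (eq ∘ suc))

  Σ<-swap : ∀ m n (f : ℕ → ℕ → ℚ) → Σ< m (λ i → Σ< n (f i)) ≡ Σ< n (λ j → Σ< m (λ i → f i j))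
  Σ<-swap zero    n f = sym (Σ<-0 n (λ _ → refl))
  Σ<-swap (suc m) n f = trans (cong (Σ< n (f 0) +_) (Σ<-swap m n (f ∘ suc))) (sym (Σ<-+ n (f 0) _))

  Σ<-truncate : ∀ {m n} (f : ℕ → ℚ) → m ℕ.≤ n → (∀ i → m ℕ.≤ i → f i ≡ 0ℚ) → Σ< n f ≡ Σ< m f
  Σ<-truncate {n = n} f ℕ.z≤n vanish = Σ<-0 n (λ i → vanish i ℕ.z≤n)
  Σ<-truncate f (ℕ.s≤s m≤n) vanish = cong (f 0 +_) (Σ<-truncate (f ∘ suc) m≤n (λ i m≤i → vanish (suc i) (ℕ.s≤s m≤i)))

  -- Leading terms

  1/suc : ℕ → ℚ
  1/suc d = ℤ.+ 1 / suc d

  1/suc-inverse : ∀ d → 1/suc d * ι (suc d) ≡ 1ℚ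
  1/suc-inverse d = trans (/-*-ι 1 (suc d)) ι-1

  1/suc-nonneg : ∀ d → 0ℚ ≤ 1/suc d
  1/suc-nonneg d = ℚ.nonNegative⁻¹ (1/suc d) {{ℚ.normalize-nonNeg 1 (suc d)}}

  -- A discrete mean value theorem: the increment of a power over [x, x + 1] lies between the values
  -- of the derivative at the two ends. This is the right end; `suc-^-lower` is the left one.
  -- Telescoping the two brackets the power sums.
  suc-^-upper : ∀ {x} d → 0ℚ ≤ x → (x + 1ℚ) ^ suc d ≤ x ^ suc d + ι (suc d) * (x + 1ℚ) ^ d
  suc-^-upper {x} zero    0≤x = ℚ.≤-reflexive (trans (lemma x) (cong (λ c → x * 1ℚ + c * 1ℚ) (sym ι-1)))
    where
    lemma : ∀ x → (x + 1ℚ) * 1ℚ ≡ x * 1ℚ + 1ℚ * 1ℚ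
    lemma = solve-∀ ℚ-ring
  suc-^-upper {x} (suc d) 0≤x = begin
    y * y ^ suc d                                            ≡⟨ lemma₁ x (y ^ suc d) ⟩
    x * y ^ suc d + y ^ suc d                                ≤⟨ ℚ.+-monoˡ-≤ (y ^ suc d) (*-monoˡ-≤ 0≤x (suc-^-upper d 0≤x)) ⟩
    x * (x ^ suc d + c * y ^ d) + y ^ suc d                  ≡⟨ lemma₂ x (x ^ suc d) c (y ^ d) (y ^ suc d) ⟩
    x * x ^ suc d + c * (x * y ^ d) + y ^ suc d              ≤⟨ ℚ.+-monoˡ-≤ (y ^ suc d) (ℚ.+-monoʳ-≤ (x * x ^ suc d)
                                                                  (*-monoˡ-≤ (ι-nonneg (suc d)) (*-monoʳ-≤ (^-nonneg d 0≤y) x≤y))) ⟩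
    x * x ^ suc d + c * y ^ suc d + y ^ suc d                ≡⟨ lemma₃ (x * x ^ suc d) c (y ^ suc d) ⟩
    x * x ^ suc d + (c + 1ℚ) * y ^ suc d                     ≡⟨ cong (λ c → x * x ^ suc d + c * y ^ suc d) (ι-suc (suc d)) ⟨
    x ^ suc (suc d) + ι (suc (suc d)) * y ^ suc d            ∎
    where
    open ℚ.≤-Reasoning
    y = x + 1ℚ
    c = ι (suc d)
    x≤y : x ≤ y
    x≤y = subst (_≤ y) (ℚ.+-identityʳ x) (ℚ.+-monoʳ-≤ x 0≤1)
    0≤y : 0ℚ ≤ y
    0≤y = ℚ.≤-trans 0≤x x≤y
    lemma₁ : ∀ x z → (x + 1ℚ) * z ≡ x * z + z
    lemma₁ = solve-∀ ℚ-ring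
    lemma₂ : ∀ x p c q r → x * (p + c * q) + r ≡ x * p + c * (x * q) + r
    lemma₂ = solve-∀ ℚ-ring
    lemma₃ : ∀ p c q → p + c * q + q ≡ p + (c + 1ℚ) * q
    lemma₃ = solve-∀ ℚ-ring

  suc-^-lower : ∀ {x} d → 0ℚ ≤ x → x ^ suc d + ι (suc d) * x ^ d ≤ (x + 1ℚ) ^ suc d
  suc-^-lower {x} zero    0≤x = ℚ.≤-reflexive (trans (cong (λ c → x * 1ℚ + c * 1ℚ) ι-1) (lemma x))
    where
    lemma : ∀ x → x * 1ℚ + 1ℚ * 1ℚ ≡ (x + 1ℚ) * 1ℚ
    lemma = solve-∀ ℚ-ring
  suc-^-lower {x} (suc d) 0≤x = begin
    x * x ^ suc d + ι (suc (suc d)) * x ^ suc d              ≡⟨ cong (λ c → x * x ^ suc d + c * x ^ suc d) (ι-suc (suc d)) ⟩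
    x * x ^ suc d + (c + 1ℚ) * x ^ suc d                     ≡⟨ ℚ.+-identityʳ _ ⟨
    x * x ^ suc d + (c + 1ℚ) * x ^ suc d + 0ℚ                ≤⟨ ℚ.+-monoʳ-≤ (x * x ^ suc d + (c + 1ℚ) * x ^ suc d) (*-nonneg (ι-nonneg (suc d)) (^-nonneg d 0≤x)) ⟩
    x * x ^ suc d + (c + 1ℚ) * x ^ suc d + c * x ^ d         ≡⟨ lemma x (x ^ d) c ⟩
    (x + 1ℚ) * (x ^ suc d + c * x ^ d)                       ≤⟨ *-monoˡ-≤ (+-nonneg 0≤x 0≤1) (suc-^-lower d 0≤x) ⟩
    (x + 1ℚ) * (x + 1ℚ) ^ suc d                              ∎
    where
    open ℚ.≤-Reasoning
    c = ι (suc d)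
    lemma : ∀ x p c → x * (x * p) + (c + 1ℚ) * (x * p) + c * p ≡ (x + 1ℚ) * (x * p + c * p)
    lemma = solve-∀ ℚ-ring

  Σ<-^-upper : ∀ d n → ι (suc d) * Σ< n (λ i → ι i ^ d) ≤ ι n ^ suc d
  Σ<-^-upper d zero    = ℚ.≤-reflexive (trans (ℚ.*-zeroʳ (ι (suc d))) (sym (trans (cong (_* ι 0 ^ d) ι-0) (ℚ.*-zeroˡ (ι 0 ^ d)))))
  Σ<-^-upper d (suc n) = begin
    c * Σ< (suc n) f                 ≡⟨ cong (c *_) (Σ<-suc n f) ⟩
    c * (Σ< n f + ι n ^ d)           ≡⟨ ℚ.*-distribˡ-+ c _ _ ⟩
    c * Σ< n f + c * ι n ^ d         ≤⟨ ℚ.+-monoˡ-≤ _ (Σ<-^-upper d n) ⟩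
    ι n ^ suc d + c * ι n ^ d        ≤⟨ suc-^-lower d (ι-nonneg n) ⟩
    (ι n + 1ℚ) ^ suc d               ≡⟨ cong (_^ suc d) (ι-suc n) ⟨
    ι (suc n) ^ suc d                ∎
    where
    open ℚ.≤-Reasoning
    c = ι (suc d)
    f : ℕ → ℚ
    f i = ι i ^ d

  -- Telescoping `suc-^-upper` bounds the power by the sum over right end points 1, ..., n, and the
  -- added `ι n ^ d` supplies the last of them.
  Σ<-^-lower : ∀ d n → ι n ^ suc d ≤ ι (suc d) * (Σ< n (λ i → ι i ^ d) + ι n ^ d)
  Σ<-^-lower d zero    = ℚ.≤-trans (ℚ.≤-reflexive (trans (cong (_* ι 0 ^ d) ι-0) (ℚ.*-zeroˡ (ι 0 ^ d))))
    (*-nonneg (ι-nonneg (suc d)) (+-nonneg (ℚ.≤-refl {0ℚ}) (^-nonneg d (ι-nonneg 0))))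
  Σ<-^-lower d (suc n) = begin
    ι (suc n) ^ suc d                              ≡⟨ cong (_^ suc d) (ι-suc n) ⟩
    (ι n + 1ℚ) ^ suc d                             ≤⟨ suc-^-upper d (ι-nonneg n) ⟩
    ι n ^ suc d + c * (ι n + 1ℚ) ^ d               ≤⟨ ℚ.+-monoˡ-≤ _ (Σ<-^-lower d n) ⟩
    c * (Σ< n f + ι n ^ d) + c * (ι n + 1ℚ) ^ d    ≡⟨ ℚ.*-distribˡ-+ c _ _ ⟨
    c * (Σ< n f + ι n ^ d + (ι n + 1ℚ) ^ d)        ≡⟨ cong₂ (λ p q → c * (p + q ^ d)) (Σ<-suc n f) (ι-suc n) ⟨
    c * (Σ< (suc n) f + ι (suc n) ^ d)             ∎
    where
    open ℚ.≤-Reasoning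
    c = ι (suc d)
    f : ℕ → ℚ
    f i = ι i ^ d

  infix 4 _∼[_]_

  -- f(n) = c n^(d+1) + O(n^d), indexed by the exponent of the error so that no predecessor occurs.
  -- The bound holds at every n, zero included, which lets `∼-Σ<` add it up over all i < n.
  record _∼[_]_ (f : ℕ → ℚ) (d : ℕ) (c : ℚ) : Set where
    constructor asymptotic
    field
      C   : ℚ
      0≤C : 0ℚ ≤ C
      est : ∀ n → ∣ f n - c * ι n ^ suc d ∣ ≤ C * ι n ^ d

  ∼-resp-≗ : ∀ {f g d c} → (∀ n → f n ≡ g n) → f ∼[ d ] c → g ∼[ d ] c
  ∼-resp-≗ {d = d} {c} eq (asymptotic C 0≤C le) = asymptotic C 0≤C λ n → subst (λ x → ∣ x - c * ι n ^ suc d ∣ ≤ C * ι n ^ d) (eq n) (le n)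

  Σ<-^-∼ : ∀ d → (λ n → Σ< n (λ i → ι i ^ d)) ∼[ d ] 1/suc d
  Σ<-^-∼ d = asymptotic 1ℚ 0≤1 λ n → let P = Σ< n (λ i → ι i ^ d) in ∣p∣≤q
    (begin
      P - r * ι n ^ suc d                ≤⟨ ℚ.+-monoʳ-≤ P (ℚ.neg-antimono-≤ (*-monoˡ-≤ 0≤r (Σ<-^-upper d n))) ⟩
      P - r * (c * P)                    ≡⟨ lemma₁ r c P ⟩
      P - (r * c) * P                    ≡⟨ cong (λ x → P - x * P) rc≡1 ⟩
      P - 1ℚ * P                         ≡⟨ lemma₂ P ⟩
      0ℚ                                 ≤⟨ *-nonneg 0≤1 (^-nonneg d (ι-nonneg n)) ⟩
      1ℚ * ι n ^ d                       ∎)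
    (begin
      - (P - r * ι n ^ suc d)            ≡⟨ lemma₃ P (r * ι n ^ suc d) ⟩
      r * ι n ^ suc d - P                ≤⟨ ℚ.+-monoˡ-≤ (- P) (*-monoˡ-≤ 0≤r (Σ<-^-lower d n)) ⟩
      r * (c * (P + ι n ^ d)) - P        ≡⟨ lemma₄ r c P (ι n ^ d) ⟩
      (r * c) * (P + ι n ^ d) - P        ≡⟨ cong (λ x → x * (P + ι n ^ d) - P) rc≡1 ⟩
      1ℚ * (P + ι n ^ d) - P             ≡⟨ lemma₅ P (ι n ^ d) ⟩
      1ℚ * ι n ^ d                       ∎)
    where
    open ℚ.≤-Reasoning
    r = 1/suc d
    c = ι (suc d)
    0≤r = 1/suc-nonneg d
    rc≡1 = 1/suc-inverse d
    lemma₁ : ∀ r c P → P - r * (c * P) ≡ P - (r * c) * P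
    lemma₁ = solve-∀ ℚ-ring
    lemma₂ : ∀ P → P - 1ℚ * P ≡ 0ℚ
    lemma₂ = solve-∀ ℚ-ring
    lemma₃ : ∀ P x → - (P - x) ≡ x - P
    lemma₃ = solve-∀ ℚ-ring
    lemma₄ : ∀ r c P x → r * (c * (P + x)) - P ≡ (r * c) * (P + x) - P
    lemma₄ = solve-∀ ℚ-ring
    lemma₅ : ∀ P x → 1ℚ * (P + x) - P ≡ 1ℚ * x
    lemma₅ = solve-∀ ℚ-ring

  ∼-- : ∀ {f g d c c′} → f ∼[ d ] c → g ∼[ d ] c′ → (λ n → f n - g n) ∼[ d ] (c - c′)
  ∼-- {f} {g} {d} {c} {c′} (asymptotic C 0≤C le) (asymptotic C′ 0≤C′ le′) = asymptotic (C + C′) (+-nonneg 0≤C 0≤C′) λ n → begin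
    ∣ (f n - g n) - (c - c′) * ι n ^ suc d ∣                       ≡⟨ cong ∣_∣ (lemma (f n) (g n) c c′ (ι n ^ suc d)) ⟩
    ∣ (f n - c * ι n ^ suc d) - (g n - c′ * ι n ^ suc d) ∣         ≤⟨ ℚ.∣p-q∣≤∣p∣+∣q∣ (f n - c * ι n ^ suc d) _ ⟩
    ∣ f n - c * ι n ^ suc d ∣ + ∣ g n - c′ * ι n ^ suc d ∣         ≤⟨ ℚ.+-mono-≤ (le n) (le′ n) ⟩
    C * ι n ^ d + C′ * ι n ^ d                                     ≡⟨ ℚ.*-distribʳ-+ (ι n ^ d) C C′ ⟨
    (C + C′) * ι n ^ d                                             ∎
    where
    open ℚ.≤-Reasoning
    lemma : ∀ f g c c′ x → (f - g) - (c - c′) * x ≡ (f - c * x) - (g - c′ * x)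
    lemma = solve-∀ ℚ-ring

  ∼-ι* : ∀ {f d c} → f ∼[ d ] c → (λ n → ι n * f n) ∼[ suc d ] c
  ∼-ι* {f} {d} {c} (asymptotic C 0≤C le) = asymptotic C 0≤C λ n → begin
    ∣ ι n * f n - c * (ι n * ι n ^ suc d) ∣     ≡⟨ cong ∣_∣ (lemma (ι n) (f n) c (ι n ^ suc d)) ⟩
    ∣ ι n * (f n - c * ι n ^ suc d) ∣           ≡⟨ ℚ.∣p*q∣≡∣p∣*∣q∣ (ι n) _ ⟩
    ∣ ι n ∣ * ∣ f n - c * ι n ^ suc d ∣         ≡⟨ cong (_* ∣ f n - c * ι n ^ suc d ∣) (ℚ.0≤p⇒∣p∣≡p (ι-nonneg n)) ⟩
    ι n * ∣ f n - c * ι n ^ suc d ∣             ≤⟨ *-monoˡ-≤ (ι-nonneg n) (le n) ⟩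
    ι n * (C * ι n ^ d)                         ≡⟨ lemma₂ (ι n) C (ι n ^ d) ⟩
    C * (ι n * ι n ^ d)                         ∎
    where
    open ℚ.≤-Reasoning
    lemma : ∀ x f c y → x * f - c * (x * y) ≡ x * (f - c * y)
    lemma = solve-∀ ℚ-ring
    lemma₂ : ∀ x c y → x * (c * y) ≡ c * (x * y)
    lemma₂ = solve-∀ ℚ-ring

  ∼-ι^* : ∀ {f d c} k → f ∼[ d ] c → (λ n → ι n ^ k * f n) ∼[ k ℕ.+ d ] c
  ∼-ι^* {f}         zero    f∼ = ∼-resp-≗ (λ n → sym (ℚ.*-identityˡ (f n))) f∼
  ∼-ι^* {f} {d} {c} (suc k) f∼ =
    ∼-resp-≗ (λ n → sym (ℚ.*-assoc (ι n) (ι n ^ k) (f n))) (∼-ι* (∼-ι^* k f∼))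

  -- Each of the n errors is at most C n^d, so together they have order n^(d+1). The leading terms
  -- form c times a power sum, whose own error constant 1 contributes `∣ c ∣`.
  ∼-Σ< : ∀ {f d c} → f ∼[ d ] c → (λ n → Σ< n f) ∼[ suc d ] (c * 1/suc (suc d))
  ∼-Σ< {f} {d} {c} (asymptotic C 0≤C le) = asymptotic (C + ∣ c ∣) (+-nonneg 0≤C (ℚ.0≤∣p∣ c)) λ n →
    let P = Σ< n (λ i → ι i ^ suc d); r = 1/suc (suc d) in begin
    ∣ Σ< n f - c * r * ι n ^ suc (suc d) ∣                            ≤⟨ ∣-∣-triangle (Σ< n f) (c * P) _ ⟩
    ∣ Σ< n f - c * P ∣ + ∣ c * P - c * r * ι n ^ suc (suc d) ∣        ≤⟨ ℚ.+-mono-≤ (first n) (second n) ⟩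
    C * ι n ^ suc d + ∣ c ∣ * ι n ^ suc d                             ≡⟨ ℚ.*-distribʳ-+ (ι n ^ suc d) C ∣ c ∣ ⟨
    (C + ∣ c ∣) * ι n ^ suc d                                         ∎
    where
    open ℚ.≤-Reasoning
    lemma₁ : ∀ x c y → x * (c * y) ≡ c * (x * y)
    lemma₁ = solve-∀ ℚ-ring
    lemma₂ : ∀ c p r x → c * p - c * r * x ≡ c * (p - r * x)
    lemma₂ = solve-∀ ℚ-ring
    first : ∀ n → ∣ Σ< n f - c * Σ< n (λ i → ι i ^ suc d) ∣ ≤ C * ι n ^ suc d
    first n = begin
      ∣ Σ< n f - c * Σ< n (λ i → ι i ^ suc d) ∣       ≡⟨ cong (λ x → ∣ Σ< n f - x ∣) (Σ<-*ˡ n c (λ i → ι i ^ suc d)) ⟨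
      ∣ Σ< n f - Σ< n (λ i → c * ι i ^ suc d) ∣       ≤⟨ Σ<-∣-∣ n (λ i i<n → ℚ.≤-trans (le i)
                                                           (*-monoˡ-≤ 0≤C (^-mono-≤ d (ι-nonneg i) (ι-mono-≤ (ℕ.<⇒≤ i<n))))) ⟩
      Σ< n (λ _ → C * ι n ^ d)                        ≡⟨ Σ<-const n (C * ι n ^ d) ⟩
      ι n * (C * ι n ^ d)                             ≡⟨ lemma₁ (ι n) C (ι n ^ d) ⟩
      C * (ι n * ι n ^ d)                             ∎
    second : ∀ n → ∣ c * Σ< n (λ i → ι i ^ suc d) - c * 1/suc (suc d) * ι n ^ suc (suc d) ∣ ≤ ∣ c ∣ * ι n ^ suc d
    second n = let P = Σ< n (λ i → ι i ^ suc d); r = 1/suc (suc d) in begin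
      ∣ c * P - c * r * ι n ^ suc (suc d) ∣     ≡⟨ cong ∣_∣ (lemma₂ c P r (ι n ^ suc (suc d))) ⟩
      ∣ c * (P - r * ι n ^ suc (suc d)) ∣       ≡⟨ ℚ.∣p*q∣≡∣p∣*∣q∣ c _ ⟩
      ∣ c ∣ * ∣ P - r * ι n ^ suc (suc d) ∣     ≤⟨ *-monoˡ-≤ (ℚ.0≤∣p∣ c) (_∼[_]_.est (Σ<-^-∼ (suc d)) n) ⟩
      ∣ c ∣ * (1ℚ * ι n ^ suc d)                ≡⟨ cong (∣ c ∣ *_) (ℚ.*-identityˡ _) ⟩
      ∣ c ∣ * ι n ^ suc d                       ∎

  -- Positivity of d matters at n = 0, where d = 0 would give 0^0 = 1 on the left.
  ι^-mono-suc : ∀ {d} n → 1 ℕ.≤ d → ι n ^ d ≤ ι n ^ suc d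
  ι^-mono-suc {suc d} zero    _ = ℚ.≤-reflexive (trans 0^ (sym (trans (cong (_* (ι 0 * ι 0 ^ d)) ι-0) (ℚ.*-zeroˡ (ι 0 * ι 0 ^ d)))))
    where
    0^ : ι 0 * ι 0 ^ d ≡ 0ℚ
    0^ = trans (cong (_* ι 0 ^ d) ι-0) (ℚ.*-zeroˡ (ι 0 ^ d))
  ι^-mono-suc {d} (suc n) _ = subst (_≤ ι (suc n) ^ suc d) (ℚ.*-identityˡ _)
    (*-monoʳ-≤ (^-nonneg d (ι-nonneg (suc n))) (subst (_≤ ι (suc n)) ι-1 (ι-mono-≤ (ℕ.s≤s ℕ.z≤n))))

  -- The leading term of g already has the order of the permitted error, which is where `∣ c′ ∣`
  -- comes from.
  ∼-absorb : ∀ {f g d c c′} → 1 ℕ.≤ d → f ∼[ suc d ] c → g ∼[ d ] c′ → (λ n → f n + g n) ∼[ suc d ] c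
  ∼-absorb {f} {g} {d} {c} {c′} 1≤d (asymptotic C 0≤C le) (asymptotic C′ 0≤C′ le′) =
    asymptotic (C + (C′ + ∣ c′ ∣)) (+-nonneg 0≤C (+-nonneg 0≤C′ (ℚ.0≤∣p∣ c′))) λ n → begin
    ∣ f n + g n - c * ι n ^ suc (suc d) ∣                       ≡⟨ cong ∣_∣ (lemma (f n) (g n) (c * ι n ^ suc (suc d)) (c′ * ι n ^ suc d)) ⟩
    ∣ (f n - c * ι n ^ suc (suc d)) + ((g n - c′ * ι n ^ suc d) + c′ * ι n ^ suc d) ∣
      ≤⟨ ℚ.∣p+q∣≤∣p∣+∣q∣ (f n - c * ι n ^ suc (suc d)) _ ⟩
    ∣ f n - c * ι n ^ suc (suc d) ∣ + ∣ (g n - c′ * ι n ^ suc d) + c′ * ι n ^ suc d ∣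
      ≤⟨ ℚ.+-mono-≤ (le n) (ℚ.∣p+q∣≤∣p∣+∣q∣ (g n - c′ * ι n ^ suc d) _) ⟩
    C * ι n ^ suc d + (∣ g n - c′ * ι n ^ suc d ∣ + ∣ c′ * ι n ^ suc d ∣)
      ≤⟨ ℚ.+-monoʳ-≤ (C * ι n ^ suc d) (ℚ.+-mono-≤ (ℚ.≤-trans (le′ n) (*-monoˡ-≤ 0≤C′ (ι^-mono-suc n 1≤d)))
           (ℚ.≤-reflexive (trans (ℚ.∣p*q∣≡∣p∣*∣q∣ c′ _) (cong (∣ c′ ∣ *_) (ℚ.0≤p⇒∣p∣≡p (^-nonneg (suc d) (ι-nonneg n))))))) ⟩
    C * ι n ^ suc d + (C′ * ι n ^ suc d + ∣ c′ ∣ * ι n ^ suc d) ≡⟨ lemma₂ C C′ ∣ c′ ∣ (ι n ^ suc d) ⟩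
    (C + (C′ + ∣ c′ ∣)) * ι n ^ suc d                           ∎
    where
    open ℚ.≤-Reasoning
    lemma : ∀ f g x y → f + g - x ≡ (f - x) + ((g - y) + y)
    lemma = solve-∀ ℚ-ring
    lemma₂ : ∀ a b c x → a * x + (b * x + c * x) ≡ (a + (b + c)) * x
    lemma₂ = solve-∀ ℚ-ring

  -- Convolutions of powers and the sum over triples

  convolution : ℕ → ℕ → ℕ → ℚ
  convolution i j n = Σ< n (λ s → ι s ^ i * ι (n ℕ.∸ s) ^ j)

  -- The Beta value B(i+1, j+1), that is, the integral of x^i (1-x)^j over [0,1]. The recursion
  -- splits off one factor 1 - x and keeps every value visibly rational.
  betaConst : ℕ → ℕ → ℚ
  betaConst i zero    = 1/suc i
  betaConst i (suc j) = betaConst i j - betaConst (suc i) j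

  -- The discrete form of the recursion for `betaConst`: one factor n - s is split, truncated
  -- subtraction being exact for s < n.
  convolution-suc : ∀ i j n → ι n * convolution i j n - convolution (suc i) j n ≡ convolution i (suc j) n
  convolution-suc i j n = sym (begin
    Σ< n (λ s → ι s ^ i * (ι (n ℕ.∸ s) * ι (n ℕ.∸ s) ^ j))
      ≡⟨ Σ<-cong n (λ s s<n → trans (cong (λ x → ι s ^ i * (x * ι (n ℕ.∸ s) ^ j)) (ι-∸ (ℕ.<⇒≤ s<n)))
                                    (lemma (ι s ^ i) (ι n) (ι s) (ι (n ℕ.∸ s) ^ j))) ⟩
    Σ< n (λ s → ι n * (ι s ^ i * ι (n ℕ.∸ s) ^ j) + (- 1ℚ) * (ι s ^ suc i * ι (n ℕ.∸ s) ^ j))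
      ≡⟨ Σ<-+ n _ _ ⟩
    Σ< n (λ s → ι n * (ι s ^ i * ι (n ℕ.∸ s) ^ j)) + Σ< n (λ s → (- 1ℚ) * (ι s ^ suc i * ι (n ℕ.∸ s) ^ j))
      ≡⟨ cong₂ _+_ (Σ<-*ˡ n (ι n) _) (Σ<-*ˡ n (- 1ℚ) _) ⟩
    ι n * convolution i j n + (- 1ℚ) * convolution (suc i) j n
      ≡⟨ lemma₂ (ι n * convolution i j n) (convolution (suc i) j n) ⟩
    ι n * convolution i j n - convolution (suc i) j n ∎)
    where
    open ≡-Reasoning
    lemma : ∀ p n s q → p * ((n - s) * q) ≡ n * (p * q) + (- 1ℚ) * ((s * p) * q)
    lemma = solve-∀ ℚ-ring
    lemma₂ : ∀ x y → x + (- 1ℚ) * y ≡ x - y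
    lemma₂ = solve-∀ ℚ-ring

  -- Induction on j for all i at once, since `convolution-suc` leads from (i, j + 1) to both (i, j)
  -- and (i + 1, j). The two terms have the same order n^(i+j+2), so their leading coefficients
  -- subtract.
  convolution-∼ : ∀ j i → convolution i j ∼[ i ℕ.+ j ] betaConst i j
  convolution-∼ zero    i = subst (λ d → convolution i 0 ∼[ d ] 1/suc i) (sym (ℕ.+-identityʳ i))
    (∼-resp-≗ (λ n → Σ<-cong n (λ s _ → sym (ℚ.*-identityʳ (ι s ^ i)))) (Σ<-^-∼ i))
  convolution-∼ (suc j) i = subst (λ d → convolution i (suc j) ∼[ d ] betaConst i (suc j)) (sym (ℕ.+-suc i j))
    (∼-resp-≗ (convolution-suc i j)
      (∼-- (∼-ι* (convolution-∼ j i)) (convolution-∼ j (suc i))))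

  0^ : ∀ k → 1 ℕ.≤ k → ι 0 ^ k ≡ 0ℚ
  0^ (suc k) _ = trans (cong (_* ι 0 ^ k) ι-0) (ℚ.*-zeroˡ (ι 0 ^ k))

  spread : ℕ → ℕ → ℕ → ℕ
  spread a b c = (b ℕ.∸ a) ℕ.* (c ℕ.∸ a) ℕ.* (c ℕ.∸ b)

  -- The function is a parameter: a power gives moments and grid sums, `indicator` gives the number
  -- of triples. Each of these vanishes at 0, so only a < b < c contributes.
  tripleSum : (ℕ → ℚ) → ℕ → ℚ
  tripleSum φ n = Σ< n λ a → Σ< n λ b → Σ< n λ c → φ (spread a b c)

  -- Separate a = 0. Since `spread` is invariant under translation, lowering all coordinates of the
  -- triples with a ≥ 1 by one gives the smaller sum back; there b = 0 and c = 0 contribute nothing.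
  -- The triples (0, b, c) with b < c form the new layer.
  tripleSum-suc : ∀ φ → φ 0 ≡ 0ℚ → ∀ n →
    tripleSum φ (suc n) ≡ tripleSum φ n + Σ< (suc n) (λ c → Σ< c (λ b → φ (b ℕ.* c ℕ.* (c ℕ.∸ b))))
  tripleSum-suc φ φ0≡0 n = begin
    Σ< (suc n) (λ b → Σ< (suc n) (λ c → φ (spread 0 b c)))
      + Σ< n (λ a → Σ< (suc n) λ b → Σ< (suc n) λ c → φ (spread (suc a) b c))
      ≡⟨ cong₂ _+_ base shift ⟩
    Σ< (suc n) (λ c → Σ< c (λ b → φ (b ℕ.* c ℕ.* (c ℕ.∸ b)))) + tripleSum φ n
      ≡⟨ ℚ.+-comm (Σ< (suc n) (λ c → Σ< c (λ b → φ (b ℕ.* c ℕ.* (c ℕ.∸ b))))) (tripleSum φ n) ⟩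
    tripleSum φ n + Σ< (suc n) (λ c → Σ< c (λ b → φ (b ℕ.* c ℕ.* (c ℕ.∸ b)))) ∎
    where
    open ≡-Reasoning
    vanish : ∀ {m} → m ≡ 0 → φ m ≡ 0ℚ
    vanish refl = φ0≡0
    base : Σ< (suc n) (λ b → Σ< (suc n) (λ c → φ (spread 0 b c))) ≡ Σ< (suc n) (λ c → Σ< c (λ b → φ (b ℕ.* c ℕ.* (c ℕ.∸ b))))
    base = trans (Σ<-swap (suc n) (suc n) (λ b c → φ (spread 0 b c)))
      (Σ<-cong (suc n) (λ c c<1+n → Σ<-truncate (λ b → φ (spread 0 b c)) (ℕ.<⇒≤ c<1+n)
        (λ b c≤b → vanish (trans (cong (b ℕ.* c ℕ.*_) (ℕ.m≤n⇒m∸n≡0 c≤b)) (ℕ.*-zeroʳ (b ℕ.* c))))))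
    shift : Σ< n (λ a → Σ< (suc n) λ b → Σ< (suc n) λ c → φ (spread (suc a) b c)) ≡ tripleSum φ n
    shift = Σ<-cong n λ a _ → trans
      (cong₂ _+_ (Σ<-0 (suc n) (λ c → φ0≡0))
        (Σ<-cong n λ b _ → trans (cong₂ _+_ (vanish (ℕ.*-zeroʳ ((b ℕ.∸ a) ℕ.* 0))) refl) (ℚ.+-identityˡ _)))
      (ℚ.+-identityˡ _)

  tripleSum-^ : ∀ k → 1 ℕ.≤ k → ∀ n →
    tripleSum (λ m → ι m ^ k) n ≡ Σ< n (λ m → Σ< (suc m) (λ c → ι c ^ k * convolution k k c))
  tripleSum-^ k 1≤k zero    = refl
  tripleSum-^ k 1≤k (suc n) = begin
    tripleSum φ (suc n)                          ≡⟨ tripleSum-suc φ (0^ k 1≤k) n ⟩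
    tripleSum φ n + Σ< (suc n) (λ c → Σ< c (λ b → φ (b ℕ.* c ℕ.* (c ℕ.∸ b))))
      ≡⟨ cong₂ _+_ (tripleSum-^ k 1≤k n) (Σ<-cong (suc n) λ c _ → trans (Σ<-cong c (λ b _ → term b c))
           (Σ<-*ˡ c (ι c ^ k) (λ b → ι b ^ k * ι (c ℕ.∸ b) ^ k))) ⟩
    Σ< n (λ m → Σ< (suc m) h) + Σ< (suc n) h     ≡⟨ Σ<-suc n (λ m → Σ< (suc m) h) ⟨
    Σ< (suc n) (λ m → Σ< (suc m) h)              ∎
    where
    open ≡-Reasoning
    φ h : ℕ → ℚ
    φ m = ι m ^ k
    h c = ι c ^ k * convolution k k c
    lemma : ∀ x y z → x * y * z ≡ y * (x * z)
    lemma = solve-∀ ℚ-ring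
    term : ∀ b c → φ (b ℕ.* c ℕ.* (c ℕ.∸ b)) ≡ ι c ^ k * (ι b ^ k * ι (c ℕ.∸ b) ^ k)
    term b c = begin
      ι (b ℕ.* c ℕ.* (c ℕ.∸ b)) ^ k            ≡⟨ cong (_^ k) (trans (ι-* (b ℕ.* c) (c ℕ.∸ b)) (cong (_* ι (c ℕ.∸ b)) (ι-* b c))) ⟩
      (ι b * ι c * ι (c ℕ.∸ b)) ^ k            ≡⟨ ^-distrib-* (ι b * ι c) (ι (c ℕ.∸ b)) k ⟩
      (ι b * ι c) ^ k * ι (c ℕ.∸ b) ^ k        ≡⟨ cong (_* ι (c ℕ.∸ b) ^ k) (^-distrib-* (ι b) (ι c) k) ⟩
      ι b ^ k * ι c ^ k * ι (c ℕ.∸ b) ^ k      ≡⟨ lemma (ι b ^ k) (ι c ^ k) (ι (c ℕ.∸ b) ^ k) ⟩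
      ι c ^ k * (ι b ^ k * ι (c ℕ.∸ b) ^ k)    ∎

  -- B(k+1, k+1) / ((3k+2)(3k+3)), a sixth of a Selberg integral. The summand ι c ^ k *
  -- `convolution` k k c has order c^(3k+1), and the two prefix sums divide its coefficient by 3k +
  -- 2 and then by 3k + 3.
  integralConst : ℕ → ℚ
  integralConst k = betaConst k k * 1/suc (suc (k ℕ.+ (k ℕ.+ k))) * 1/suc (suc (suc (k ℕ.+ (k ℕ.+ k))))

  module _ (k : ℕ) (1≤k : 1 ℕ.≤ k) where

    private
      e : ℕ
      e = k ℕ.+ (k ℕ.+ k)
      1≤e : 1 ℕ.≤ e
      1≤e = ℕ.≤-trans 1≤k (ℕ.m≤m+n k (k ℕ.+ k))
      h : ℕ → ℚ
      h c = ι c ^ k * convolution k k c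
      h∼ : h ∼[ e ] betaConst k k
      h∼ = ∼-ι^* k (convolution-∼ k k)

      -- The inner sum includes c = m, and that last term is one order lower than the rest.
      layer∼ : (λ m → Σ< (suc m) h) ∼[ suc e ] (betaConst k k * 1/suc (suc e))
      layer∼ = ∼-resp-≗ (λ m → sym (Σ<-suc m h)) (∼-absorb 1≤e (∼-Σ< h∼) h∼)

    tripleSum-∼ : tripleSum (λ m → ι m ^ k) ∼[ suc (suc e) ] integralConst k
    tripleSum-∼ = ∼-resp-≗ (λ n → sym (tripleSum-^ k 1≤k n)) (∼-Σ< layer∼)

    -- Block ends range over the n + 1 values 0, ..., n, whereas a Riemann grid of mesh 1/n has n
    -- cells per side. The extra layer is of lower order, so the constant is the same.
    tripleSum-suc-∼ : (λ n → tripleSum (λ m → ι m ^ k) (suc n)) ∼[ suc (suc e) ] integralConst k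
    tripleSum-suc-∼ = ∼-resp-≗ (λ n → trans (sym (Σ<-suc n _)) (sym (tripleSum-^ k 1≤k (suc n))))
      (∼-absorb (ℕ.s≤s ℕ.z≤n) (∼-Σ< layer∼) layer∼)

  -- Counting the triples a < b < c

  indicator : ℕ → ℚ
  indicator zero    = 0ℚ
  indicator (suc _) = 1ℚ

  indicator-suc : ∀ {m} → 0 ℕ.< m → indicator m ≡ 1ℚ
  indicator-suc {suc m} _ = refl

  Σ<-indicator : ∀ c → Σ< c (λ b → indicator (b ℕ.* c ℕ.* (c ℕ.∸ b))) ≡ ι (c ℕ.∸ 1)
  Σ<-indicator zero    = sym ι-0
  Σ<-indicator (suc c) = trans (ℚ.+-identityˡ _) (trans
    (Σ<-cong c λ b b<c → indicator-suc (ℕ.*-mono-≤ {1} {suc b ℕ.* suc c} {1} (ℕ.s≤s ℕ.z≤n) (ℕ.m<n⇒0<n∸m b<c)))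
    (trans (Σ<-const c 1ℚ) (ℚ.*-identityʳ (ι c))))

  2*Σ<-pred : ∀ n → ι 2 * Σ< (suc n) (λ c → ι (c ℕ.∸ 1)) + ι n ≡ ι n * ι n
  2*Σ<-pred zero    = trans (cong₂ (λ x y → ι 2 * x + y) (trans (ℚ.+-identityʳ (ι 0)) ι-0) ι-0)
    (trans (cong (_+ 0ℚ) (ℚ.*-zeroʳ (ι 2))) (sym (trans (cong (_* ι 0) ι-0) (ℚ.*-zeroˡ (ι 0)))))
  2*Σ<-pred (suc n) = begin
    ι 2 * Σ< (suc (suc n)) f + ι (suc n)                 ≡⟨ cong₂ (λ x y → ι 2 * x + y) (Σ<-suc (suc n) f) (ι-suc n) ⟩
    ι 2 * (Σ< (suc n) f + ι n) + (ι n + 1ℚ)              ≡⟨ lemma (ι 2) (Σ< (suc n) f) (ι n) ⟩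
    (ι 2 * Σ< (suc n) f + ι n) + (ι 2 * ι n + 1ℚ)        ≡⟨ cong₂ (λ x y → x + (y * ι n + 1ℚ)) (2*Σ<-pred n) (trans (ι-suc 1) (cong (_+ 1ℚ) ι-1)) ⟩
    ι n * ι n + ((1ℚ + 1ℚ) * ι n + 1ℚ)                   ≡⟨ lemma₂ (ι n) ⟩
    (ι n + 1ℚ) * (ι n + 1ℚ)                              ≡⟨ cong (λ x → x * x) (ι-suc n) ⟨
    ι (suc n) * ι (suc n)                                ∎
    where
    open ≡-Reasoning
    f : ℕ → ℚ
    f c = ι (c ℕ.∸ 1)
    lemma : ∀ t s n → t * (s + n) + (n + 1ℚ) ≡ (t * s + n) + (t * n + 1ℚ)
    lemma = solve-∀ ℚ-ring
    lemma₂ : ∀ n → n * n + ((1ℚ + 1ℚ) * n + 1ℚ) ≡ (n + 1ℚ) * (n + 1ℚ)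
    lemma₂ = solve-∀ ℚ-ring

  -- There are C(n+1, 3) = (n³ - n)/6 triples; the layer `Q` gained from n to n + 1 has C(n+1, 2) of
  -- them.
  6*tripleSum-indicator : ∀ n → ι 6 * tripleSum indicator (suc n) + ι n ≡ ι n ^ 3
  6*tripleSum-indicator zero    = trans (cong (ι 6 * 0ℚ +_) ι-0)
    (trans (cong (_+ 0ℚ) (ℚ.*-zeroʳ (ι 6))) (sym (0^ 3 (ℕ.s≤s ℕ.z≤n))))
  6*tripleSum-indicator (suc n) = begin
    ι 6 * tripleSum indicator (suc (suc n)) + ι (suc n)
      ≡⟨ cong₂ (λ x y → ι 6 * x + y) (trans (tripleSum-suc indicator refl (suc n))
           (cong (S +_) (Σ<-cong (suc (suc n)) (λ c _ → Σ<-indicator c)))) (ι-suc n) ⟩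
    ι 6 * (S + Q) + (ι n + 1ℚ)                       ≡⟨ lemma (ι 6) S Q (ι n) ⟩
    (ι 6 * S + ι n) + (ι 6 * Q + 1ℚ)                 ≡⟨ cong₂ (λ x y → x + (y * Q + 1ℚ)) (6*tripleSum-indicator n) (ι-* 3 2) ⟩
    ι n ^ 3 + (ι 3 * ι 2 * Q + 1ℚ)                   ≡⟨ lemma₂ (ι 2) (ι 3) (ι n) Q ⟩
    -- Adding and subtracting n + 1 produces the left side of `2*Σ<-pred`.
    ι n ^ 3 + (ι 3 * ((ι 2 * Q + (ι n + 1ℚ)) - (ι n + 1ℚ)) + 1ℚ)
      ≡⟨ cong (λ x → ι n ^ 3 + (ι 3 * (x - (ι n + 1ℚ)) + 1ℚ))
           (trans (cong (ι 2 * Q +_) (sym (ι-suc n))) (trans (2*Σ<-pred (suc n)) (cong (λ x → x * x) (ι-suc n)))) ⟩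
    ι n ^ 3 + (ι 3 * ((ι n + 1ℚ) * (ι n + 1ℚ) - (ι n + 1ℚ)) + 1ℚ)
      ≡⟨ cong (λ x → ι n ^ 3 + (x * ((ι n + 1ℚ) * (ι n + 1ℚ) - (ι n + 1ℚ)) + 1ℚ)) ι-3 ⟩
    ι n ^ 3 + ((1ℚ + 1ℚ + 1ℚ) * ((ι n + 1ℚ) * (ι n + 1ℚ) - (ι n + 1ℚ)) + 1ℚ)
      ≡⟨ lemma₃ (ι n) ⟩
    (ι n + 1ℚ) ^ 3                                   ≡⟨ cong (_^ 3) (ι-suc n) ⟨
    ι (suc n) ^ 3                                    ∎
    where
    open ≡-Reasoning
    S = tripleSum indicator (suc n)
    Q = Σ< (suc (suc n)) (λ c → ι (c ℕ.∸ 1))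
    ι-3 : ι 3 ≡ 1ℚ + 1ℚ + 1ℚ
    ι-3 = trans (ι-suc 2) (cong (_+ 1ℚ) (trans (ι-suc 1) (cong (_+ 1ℚ) ι-1)))
    lemma : ∀ s a q n → s * (a + q) + (n + 1ℚ) ≡ (s * a + n) + (s * q + 1ℚ)
    lemma = solve-∀ ℚ-ring
    lemma₂ : ∀ t u n q → n * (n * (n * 1ℚ)) + (u * t * q + 1ℚ) ≡ n * (n * (n * 1ℚ)) + (u * ((t * q + (n + 1ℚ)) - (n + 1ℚ)) + 1ℚ)
    lemma₂ = solve-∀ ℚ-ring
    lemma₃ : ∀ n → n * (n * (n * 1ℚ)) + ((1ℚ + 1ℚ + 1ℚ) * ((n + 1ℚ) * (n + 1ℚ) - (n + 1ℚ)) + 1ℚ) ≡ (n + 1ℚ) * ((n + 1ℚ) * ((n + 1ℚ) * 1ℚ))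
    lemma₃ = solve-∀ ℚ-ring

  -- Riemann sums

  -- With both numbers in [0,1], errors simply add under multiplication. This yields the Lipschitz
  -- constant of the integrand without derivatives.
  record Close (δ p q : ℚ) : Set where
    constructor close
    field
      0≤p : 0ℚ ≤ p
      p≤1 : p ≤ 1ℚ
      0≤q : 0ℚ ≤ q
      q≤1 : q ≤ 1ℚ
      p≈q : ∣ p - q ∣ ≤ δ

  Close-* : ∀ {δ ε p q r s} → Close δ p q → Close ε r s → Close (δ + ε) (p * r) (q * s)
  Close-* {δ} {ε} {p} {q} {r} {s} (close 0≤p p≤1 0≤q q≤1 p≈q) (close 0≤r r≤1 0≤s s≤1 r≈s) = close
    (*-nonneg 0≤p 0≤r) (*-mono-≤ 0≤p 0≤1 p≤1 r≤1) (*-nonneg 0≤q 0≤s) (*-mono-≤ 0≤q 0≤1 q≤1 s≤1) (begin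
      ∣ p * r - q * s ∣                            ≡⟨ cong ∣_∣ (lemma p q r s) ⟩
      ∣ (p - q) * r + q * (r - s) ∣                ≤⟨ ℚ.∣p+q∣≤∣p∣+∣q∣ ((p - q) * r) (q * (r - s)) ⟩
      ∣ (p - q) * r ∣ + ∣ q * (r - s) ∣            ≡⟨ cong₂ _+_ (ℚ.∣p*q∣≡∣p∣*∣q∣ (p - q) r) (ℚ.∣p*q∣≡∣p∣*∣q∣ q (r - s)) ⟩
      ∣ p - q ∣ * ∣ r ∣ + ∣ q ∣ * ∣ r - s ∣        ≤⟨ ℚ.+-mono-≤
        (*-mono-≤ (ℚ.0≤∣p∣ (p - q)) 0≤1 p≈q (subst (_≤ 1ℚ) (sym (ℚ.0≤p⇒∣p∣≡p 0≤r)) r≤1))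
        (*-mono-≤ (ℚ.0≤∣p∣ q) (ℚ.≤-trans (ℚ.0≤∣p∣ (r - s)) r≈s) (subst (_≤ 1ℚ) (sym (ℚ.0≤p⇒∣p∣≡p 0≤q)) q≤1) r≈s) ⟩
      δ * 1ℚ + 1ℚ * ε                              ≡⟨ cong₂ _+_ (ℚ.*-identityʳ δ) (ℚ.*-identityˡ ε) ⟩
      δ + ε                                        ∎)
    where
    open ℚ.≤-Reasoning
    lemma : ∀ p q r s → p * r - q * s ≡ (p - q) * r + q * (r - s)
    lemma = solve-∀ ℚ-ring

  Close-^ : ∀ {δ p q} k → Close δ p q → Close (ι k * δ) (p ^ k) (q ^ k)
  Close-^ {δ} zero    c = close 0≤1 ℚ.≤-refl 0≤1 ℚ.≤-refl (ℚ.≤-reflexive (sym (trans (cong (_* δ) ι-0) (ℚ.*-zeroˡ δ))))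
  Close-^ {δ} {p} {q} (suc k) c = subst (λ x → Close x (p ^ suc k) (q ^ suc k)) eq (Close-* c (Close-^ k c))
    where
    lemma : ∀ d x → d + x * d ≡ (x + 1ℚ) * d
    lemma = solve-∀ ℚ-ring
    eq : δ + ι k * δ ≡ ι (suc k) * δ
    eq = trans (lemma δ (ι k)) (cong (_* δ) (sym (ι-suc k)))

  p<q⇒0⊔[q-p]≡q-p : ∀ {p q} → p < q → 0ℚ ⊔ (q - p) ≡ q - p
  p<q⇒0⊔[q-p]≡q-p {p} {q} p<q = ℚ.p≤q⇒p⊔q≡q (subst (_≤ q - p) (ℚ.+-inverseʳ p) (ℚ.+-monoˡ-≤ (- p) (ℚ.<⇒≤ p<q)))

  p≮q⇒0⊔[q-p]≡0 : ∀ {p q} → ¬ (p < q) → 0ℚ ⊔ (q - p) ≡ 0ℚ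
  p≮q⇒0⊔[q-p]≡0 {p} {q} p≮q = ℚ.p≥q⇒p⊔q≡p (subst (q - p ≤_) (ℚ.+-inverseʳ p) (ℚ.+-monoˡ-≤ (- p) (ℚ.≮⇒≥ p≮q)))

  -- The three differences are nonnegative on the region, and off it, inside the
  -- cube, one of the outer two is nonpositive.
  integrand-⊔ : ∀ {k x y z} → 1 ℕ.≤ k → 0ℚ ≤ x → z ≤ 1ℚ →
    (if does (region? x y z) then (y - x) ^ k * (z - x) ^ k * (z - y) ^ k else 0ℚ)
      ≡ (0ℚ ⊔ (y - x)) ^ k * (0ℚ ⊔ (z - x)) ^ k * (0ℚ ⊔ (z - y)) ^ k
  integrand-⊔ {suc k} {x} {y} {z} 1≤k 0≤x z≤1 with x ℚ.<? y | y ℚ.<? z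
  ... | yes x<y | yes y<z rewrite dec-true (region? x y z) (0≤x , x<y , y<z , z≤1) =
    sym (cong₂ _*_ (cong₂ (λ p q → p ^ suc k * q ^ suc k) (p<q⇒0⊔[q-p]≡q-p x<y) (p<q⇒0⊔[q-p]≡q-p (ℚ.<-trans x<y y<z))) (cong (_^ suc k) (p<q⇒0⊔[q-p]≡q-p y<z)))
  ... | no x≮y | _ rewrite dec-false (region? x y z) (x≮y ∘ proj₁ ∘ proj₂) = sym (begin
    (0ℚ ⊔ (y - x)) * _ * _ * _    ≡⟨ cong (λ p → p * (0ℚ ⊔ (y - x)) ^ k * (0ℚ ⊔ (z - x)) ^ suc k * (0ℚ ⊔ (z - y)) ^ suc k) (p≮q⇒0⊔[q-p]≡0 x≮y) ⟩
    0ℚ * (0ℚ ⊔ (y - x)) ^ k * (0ℚ ⊔ (z - x)) ^ suc k * (0ℚ ⊔ (z - y)) ^ suc k  ≡⟨ lemma ((0ℚ ⊔ (y - x)) ^ k) ((0ℚ ⊔ (z - x)) ^ suc k) ((0ℚ ⊔ (z - y)) ^ suc k) ⟩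
    0ℚ                            ∎)
    where
    open ≡-Reasoning
    lemma : ∀ a b c → 0ℚ * a * b * c ≡ 0ℚ
    lemma = solve-∀ ℚ-ring
  ... | yes _ | no y≮z rewrite dec-false (region? x y z) (y≮z ∘ proj₁ ∘ proj₂ ∘ proj₂) = sym (begin
    (0ℚ ⊔ (y - x)) ^ suc k * (0ℚ ⊔ (z - x)) ^ suc k * ((0ℚ ⊔ (z - y)) * (0ℚ ⊔ (z - y)) ^ k)
      ≡⟨ cong (λ p → (0ℚ ⊔ (y - x)) ^ suc k * (0ℚ ⊔ (z - x)) ^ suc k * (p * (0ℚ ⊔ (z - y)) ^ k)) (p≮q⇒0⊔[q-p]≡0 y≮z) ⟩
    (0ℚ ⊔ (y - x)) ^ suc k * (0ℚ ⊔ (z - x)) ^ suc k * (0ℚ * (0ℚ ⊔ (z - y)) ^ k)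
      ≡⟨ lemma ((0ℚ ⊔ (y - x)) ^ suc k) ((0ℚ ⊔ (z - x)) ^ suc k) ((0ℚ ⊔ (z - y)) ^ k) ⟩
    0ℚ                            ∎)
    where
    open ≡-Reasoning
    lemma : ∀ a b c → a * b * (0ℚ * c) ≡ 0ℚ
    lemma = solve-∀ ℚ-ring

  -- Extending the integrand by 0 replaces differences by their positive parts; this shows that no
  -- closeness is lost thereby.
  ⊔-nonexpansive : ∀ {p q δ} → ∣ p - q ∣ ≤ δ → ∣ (0ℚ ⊔ p) - (0ℚ ⊔ q) ∣ ≤ δ
  ⊔-nonexpansive {p} {q} {δ} p≈q = ∣p∣≤q (half p q p≈q)
    (subst (_≤ δ) (swap (0ℚ ⊔ q) (0ℚ ⊔ p)) (half q p (subst (_≤ δ) (trans (sym (ℚ.∣-p∣≡∣p∣ (p - q))) (cong ∣_∣ (sym (swap q p)))) p≈q)))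
    where
    swap : ∀ p q → p - q ≡ - (q - p)
    swap = solve-∀ ℚ-ring
    cancel : ∀ p q → p ≡ q + (p - q)
    cancel = solve-∀ ℚ-ring
    cancel′ : ∀ p q → q + p - q ≡ p
    cancel′ = solve-∀ ℚ-ring
    p≤∣p∣ : ∀ p → p ≤ ∣ p ∣
    p≤∣p∣ p with ℚ.≤-total 0ℚ p
    ... | inj₁ 0≤p = ℚ.≤-reflexive (sym (ℚ.0≤p⇒∣p∣≡p 0≤p))
    ... | inj₂ p≤0 = ℚ.≤-trans p≤0 (ℚ.0≤∣p∣ p)
    half : ∀ p q → ∣ p - q ∣ ≤ δ → (0ℚ ⊔ p) - (0ℚ ⊔ q) ≤ δ
    half p q p≈q = subst ((0ℚ ⊔ p) - (0ℚ ⊔ q) ≤_) (cancel′ δ (0ℚ ⊔ q)) (ℚ.+-monoˡ-≤ (- (0ℚ ⊔ q)) (ℚ.⊔-lub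
      (+-nonneg (ℚ.p≤p⊔q 0ℚ q) (ℚ.≤-trans (ℚ.0≤∣p∣ (p - q)) p≈q))
      (subst (_≤ (0ℚ ⊔ q) + δ) (sym (cancel p q)) (ℚ.+-mono-≤ (ℚ.p≤q⊔p 0ℚ q) (ℚ.≤-trans (p≤∣p∣ (p - q)) p≈q)))))

  sum-Σ< : ∀ n {f : Fin n → ℚ} {g : ℕ → ℚ} {δ} → (∀ i → ∣ f i - g (toℕ i) ∣ ≤ δ) → ∣ sum f - Σ< n g ∣ ≤ ι n * δ
  sum-Σ< zero            {δ = δ} le = ℚ.≤-reflexive (sym (trans (cong (_* δ) ι-0) (ℚ.*-zeroˡ δ)))
  sum-Σ< (suc n) {f} {g} {δ} le = begin
    ∣ (f zero + sum (f ∘ suc)) - (g 0 + Σ< n (g ∘ suc)) ∣   ≡⟨ cong ∣_∣ (lemma (f zero) (sum (f ∘ suc)) (g 0) (Σ< n (g ∘ suc))) ⟩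
    ∣ (f zero - g 0) + (sum (f ∘ suc) - Σ< n (g ∘ suc)) ∣   ≤⟨ ℚ.∣p+q∣≤∣p∣+∣q∣ (f zero - g 0) _ ⟩
    ∣ f zero - g 0 ∣ + ∣ sum (f ∘ suc) - Σ< n (g ∘ suc) ∣   ≤⟨ ℚ.+-mono-≤ (le zero) (sum-Σ< n {f ∘ suc} {g ∘ suc} (le ∘ suc)) ⟩
    δ + ι n * δ                                             ≡⟨ lemma₂ δ (ι n) ⟩
    (ι n + 1ℚ) * δ                                          ≡⟨ cong (_* δ) (ι-suc n) ⟨
    ι (suc n) * δ                                           ∎
    where
    open ℚ.≤-Reasoning
    lemma : ∀ a b c d → (a + b) - (c + d) ≡ (a - c) + (b - d)
    lemma = solve-∀ ℚ-ring
    lemma₂ : ∀ d x → d + x * d ≡ (x + 1ℚ) * d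
    lemma₂ = solve-∀ ℚ-ring

  /-ι : ∀ m n .{{_ : ℕ.NonZero n}} → ℤ.+ m / n ≡ ι m * (ℤ.+ 1 / n)
  /-ι m n = begin
    q                     ≡⟨ ℚ.*-identityʳ q ⟨
    q * 1ℚ                ≡⟨ cong (q *_) (trans (/-*-ι 1 n) ι-1) ⟨
    q * (h * ι n)         ≡⟨ lemma q h (ι n) ⟩
    (q * ι n) * h         ≡⟨ cong (_* h) (/-*-ι m n) ⟩
    ι m * h               ∎
    where
    open ≡-Reasoning
    q = ℤ.+ m / n
    h = ℤ.+ 1 / n
    lemma : ∀ q h x → q * (h * x) ≡ (q * x) * h
    lemma = solve-∀ ℚ-ring

  -- For K = a/d and ε = b/e in lowest terms, N = a e works: K ≤ a, and e ε = b ≥ 1.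
  archimedean : ∀ K ε → 0ℚ ≤ K → 0ℚ < ε → ∃ λ N → K ≤ ι N * ε
  archimedean K@(mkℚ (ℤ.+ a) d-1 _) ε@(mkℚ ℤ.+[1+ b ] e-1 _) 0≤K 0<ε = a ℕ.* suc e-1 , (begin
    K                              ≡⟨ ℚ.*-identityʳ K ⟨
    K * 1ℚ                         ≤⟨ *-monoˡ-≤ 0≤K (subst (_≤ ι (suc d-1)) ι-1 (ι-mono-≤ (ℕ.s≤s ℕ.z≤n))) ⟩
    K * ι (suc d-1)                ≡⟨ cong (_* ι (suc d-1)) (sym (ℚ.↥p/↧p≡p K)) ⟩
    (ℤ.+ a / suc d-1) * ι (suc d-1) ≡⟨ /-*-ι a (suc d-1) ⟩
    ι a                            ≡⟨ ℚ.*-identityʳ (ι a) ⟨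
    ι a * 1ℚ                       ≤⟨ *-monoˡ-≤ (ι-nonneg a) (subst (_≤ ι (suc b)) ι-1 (ι-mono-≤ (ℕ.s≤s ℕ.z≤n))) ⟩
    ι a * ι (suc b)                ≡⟨ cong (ι a *_) (/-*-ι (suc b) (suc e-1)) ⟨
    ι a * ((ℤ.+ suc b / suc e-1) * ι (suc e-1)) ≡⟨ cong (λ x → ι a * (x * ι (suc e-1))) (ℚ.↥p/↧p≡p ε) ⟩
    ι a * (ε * ι (suc e-1))        ≡⟨ lemma (ι a) ε (ι (suc e-1)) ⟩
    ι a * ι (suc e-1) * ε          ≡⟨ cong (_* ε) (ι-* a (suc e-1)) ⟨
    ι (a ℕ.* suc e-1) * ε          ∎)
    where
    open ℚ.≤-Reasoning
    lemma : ∀ a e x → a * (e * x) ≡ a * x * e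
    lemma = solve-∀ ℚ-ring
  archimedean (mkℚ ℤ.-[1+ _ ] _ _) _ 0≤K _ with () ← nonNegative 0≤K
  archimedean _ (mkℚ (ℤ.+ 0) _ _) _ 0<ε with () ← positive 0<ε
  archimedean _ (mkℚ ℤ.-[1+ _ ] _ _) _ 0<ε with () ← positive 0<ε

  -- The mesh is a variable equal to 1/N rather than the fraction itself, so that it stays an atom
  -- in ring identities.
  module Cell (N : ℕ) .{{_ : ℕ.NonZero N}} {h : ℚ} (h≡ : h ≡ ℤ.+ 1 / N) where

    h*N≡1 : h * ι N ≡ 1ℚ
    h*N≡1 = trans (cong (_* ι N) h≡) (trans (/-*-ι 1 N) ι-1)

    0≤h : 0ℚ ≤ h
    0≤h = subst (0ℚ ≤_) (sym h≡) (ℚ.nonNegative⁻¹ (ℤ.+ 1 / N) {{ℚ.normalize-nonNeg 1 N}})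

    /≡ι*h : ∀ m → ℤ.+ m / N ≡ ι m * h
    /≡ι*h m = trans (/-ι m N) (cong (ι m *_) (sym h≡))

    module _ {q : ℚ} {i : Fin N} (q∈ : q ∈Cell i) where

      lower : ι (toℕ i) * h ≤ q
      lower = subst (_≤ q) (/≡ι*h (toℕ i)) (proj₁ q∈)

      upper : q ≤ ι (toℕ i) * h + h
      upper = subst (q ≤_) (trans (/≡ι*h (suc (toℕ i))) (trans (cong (_* h) (ι-suc (toℕ i))) (lemma (ι (toℕ i)) h))) (proj₂ q∈)
        where
        lemma : ∀ x h → (x + 1ℚ) * h ≡ x * h + h
        lemma = solve-∀ ℚ-ring

      q≥0 : 0ℚ ≤ q
      q≥0 = ℚ.≤-trans (*-nonneg (ι-nonneg (toℕ i)) 0≤h) lower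

      q≤1 : q ≤ 1ℚ
      q≤1 = ℚ.≤-trans (proj₂ q∈) (ℚ.≤-trans (ℚ.≤-reflexive (/≡ι*h (suc (toℕ i))))
        (ℚ.≤-trans (*-monoʳ-≤ 0≤h (ι-mono-≤ (Fin.toℕ<n i))) (ℚ.≤-reflexive (trans (ℚ.*-comm (ι N) h) h*N≡1))))

    -- Positive parts at grid points are scaled truncated differences, which is why `spread`
    -- describes the integrand extended by 0.
    ⊔-ι : ∀ i j → 0ℚ ⊔ (ι j * h - ι i * h) ≡ ι (j ℕ.∸ i) * h
    ⊔-ι i j with ℕ.≤-total i j
    ... | inj₁ i≤j = trans (cong (0ℚ ⊔_) eq) (ℚ.p≤q⇒p⊔q≡q (*-nonneg (ι-nonneg (j ℕ.∸ i)) 0≤h))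
      where
      lemma : ∀ x y h → y * h - x * h ≡ (y - x) * h
      lemma = solve-∀ ℚ-ring
      eq : ι j * h - ι i * h ≡ ι (j ℕ.∸ i) * h
      eq = trans (lemma (ι i) (ι j) h) (cong (_* h) (sym (ι-∸ i≤j)))
    ... | inj₂ j≤i = trans (ℚ.p≥q⇒p⊔q≡p (subst (ι j * h - ι i * h ≤_) (ℚ.+-inverseʳ (ι i * h)) (ℚ.+-monoˡ-≤ (- (ι i * h)) (*-monoʳ-≤ 0≤h (ι-mono-≤ j≤i)))))
      (sym (trans (cong (λ m → ι m * h) (ℕ.m≤n⇒m∸n≡0 j≤i)) (trans (cong (_* h) ι-0) (ℚ.*-zeroˡ h))))

    -- The error is h and not 2h: each tag exceeds its lower grid point by an amount in [0, h], and
    -- two such amounts differ by at most h.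
    difference : ∀ {p q : ℚ} {i j : Fin N} → p ∈Cell i → q ∈Cell j → Close h (0ℚ ⊔ (q - p)) (ι (toℕ j ℕ.∸ toℕ i) * h)
    difference {p} {q} {i} {j} p∈ q∈ = close
      (ℚ.p≤p⊔q 0ℚ (q - p)) (bound (q≥0 p∈) (q≤1 q∈))
      (*-nonneg (ι-nonneg (toℕ j ℕ.∸ toℕ i)) 0≤h)
      (subst (_≤ 1ℚ) (⊔-ι (toℕ i) (toℕ j)) (bound (*-nonneg (ι-nonneg (toℕ i)) 0≤h) (ℚ.≤-trans (lower q∈) (q≤1 q∈))))
      (subst (λ x → ∣ (0ℚ ⊔ (q - p)) - x ∣ ≤ h) (⊔-ι (toℕ i) (toℕ j)) (⊔-nonexpansive {q - p} {ι (toℕ j) * h - ι (toℕ i) * h} (∣p∣≤q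
        (subst₂ _≤_ (sym (split q (ι (toℕ j) * h) p (ι (toℕ i) * h))) (ℚ.+-identityʳ h)
          (ℚ.+-mono-≤ (gap q (ι (toℕ j) * h) (upper q∈)) (ℚ.neg-antimono-≤ (nonneg (lower p∈)))))
        (subst₂ _≤_ (sym (split′ q (ι (toℕ j) * h) p (ι (toℕ i) * h))) (ℚ.+-identityʳ h)
          (ℚ.+-mono-≤ (gap p (ι (toℕ i) * h) (upper p∈)) (ℚ.neg-antimono-≤ (nonneg (lower q∈))))))))
      where
      split : ∀ q q′ p p′ → (q - p) - (q′ - p′) ≡ (q - q′) + - (p - p′)
      split = solve-∀ ℚ-ring
      split′ : ∀ q q′ p p′ → - ((q - p) - (q′ - p′)) ≡ (p - p′) + - (q - q′)
      split′ = solve-∀ ℚ-ring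
      cancel : ∀ x h → x + h - x ≡ h
      cancel = solve-∀ ℚ-ring
      gap : ∀ q q′ → q ≤ q′ + h → q - q′ ≤ h
      gap q q′ q≤ = subst (q - q′ ≤_) (cancel q′ h) (ℚ.+-monoˡ-≤ (- q′) q≤)
      nonneg : ∀ {x y} → x ≤ y → 0ℚ ≤ y - x
      nonneg {x} {y} x≤y = subst (_≤ y - x) (ℚ.+-inverseʳ x) (ℚ.+-monoˡ-≤ (- x) x≤y)
      bound : ∀ {x y} → 0ℚ ≤ x → y ≤ 1ℚ → 0ℚ ⊔ (y - x) ≤ 1ℚ
      bound {x} {y} 0≤x y≤1 = ℚ.⊔-lub 0≤1 (subst (y - x ≤_) (ℚ.+-identityʳ 1ℚ) (ℚ.+-mono-≤ y≤1 (ℚ.neg-antimono-≤ 0≤x)))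

  Close-*ʳ : ∀ {δ p q w} → Close δ p q → 0ℚ ≤ w → ∣ p * w - q * w ∣ ≤ δ * w
  Close-*ʳ {δ} {p} {q} {w} c 0≤w = begin
    ∣ p * w - q * w ∣      ≡⟨ cong ∣_∣ (lemma p q w) ⟩
    ∣ (p - q) * w ∣        ≡⟨ ℚ.∣p*q∣≡∣p∣*∣q∣ (p - q) w ⟩
    ∣ p - q ∣ * ∣ w ∣      ≡⟨ cong (∣ p - q ∣ *_) (ℚ.0≤p⇒∣p∣≡p 0≤w) ⟩
    ∣ p - q ∣ * w          ≤⟨ *-monoʳ-≤ 0≤w (Close.p≈q c) ⟩
    δ * w                  ∎
    where
    open ℚ.≤-Reasoning
    lemma : ∀ p q w → p * w - q * w ≡ (p - q) * w
    lemma = solve-∀ ℚ-ring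

  ι^-scale : ∀ k l m n h → ι (l ℕ.* m ℕ.* n) ^ k * (h ^ k * (h ^ k * h ^ k)) ≡ (ι l * h) ^ k * (ι m * h) ^ k * (ι n * h) ^ k
  ι^-scale k l m n h = begin
    ι (l ℕ.* m ℕ.* n) ^ k * H            ≡⟨ cong (λ x → x ^ k * H) (trans (ι-* (l ℕ.* m) n) (cong (_* ι n) (ι-* l m))) ⟩
    (ι l * ι m * ι n) ^ k * H            ≡⟨ cong (_* H) (trans (^-distrib-* (ι l * ι m) (ι n) k) (cong (_* ι n ^ k) (^-distrib-* (ι l) (ι m) k))) ⟩
    ι l ^ k * ι m ^ k * ι n ^ k * H      ≡⟨ lemma (ι l ^ k) (ι m ^ k) (ι n ^ k) (h ^ k) ⟩
    (ι l ^ k * h ^ k) * (ι m ^ k * h ^ k) * (ι n ^ k * h ^ k)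
      ≡⟨ cong₂ _*_ (cong₂ _*_ (^-distrib-* (ι l) h k) (^-distrib-* (ι m) h k)) (^-distrib-* (ι n) h k) ⟨
    (ι l * h) ^ k * (ι m * h) ^ k * (ι n * h) ^ k  ∎
    where
    open ≡-Reasoning
    H = h ^ k * (h ^ k * h ^ k)
    lemma : ∀ u v w p → u * v * w * (p * (p * p)) ≡ (u * p) * (v * p) * (w * p)
    lemma = solve-∀ ℚ-ring

  ^-split : ∀ h k → h ^ (k ℕ.+ (k ℕ.+ k)) ≡ h ^ k * (h ^ k * h ^ k)
  ^-split h k = trans (^-homo-* h k (k ℕ.+ k)) (cong (h ^ k *_) (^-homo-* h k k))

  module _ (k : ℕ) (1≤k : 1 ℕ.≤ k) where

    private
      e : ℕ
      e = k ℕ.+ (k ℕ.+ k)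
      I : ℚ
      I = integralConst k
      open _∼[_]_ (tripleSum-∼ k 1≤k)

      K : ℚ
      -- Each of the three k-th powers moves by at most k h between a tag and its grid point; C
      -- bounds the distance of the grid sum from its limit.
      K = ι k + ι k + ι k + C

    module _ {F : ℚ → ℚ → ℚ → ℚ}
             (F≡ : ∀ {x y z} → 0ℚ ≤ x → z ≤ 1ℚ → F x y z ≡ (0ℚ ⊔ (y - x)) ^ k * (0ℚ ⊔ (z - x)) ^ k * (0ℚ ⊔ (z - y)) ^ k)
             (N : ℕ) .{{_ : ℕ.NonZero N}} {h : ℚ} (h≡ : h ≡ ℤ.+ 1 / N) (x y z : Fin N → Fin N → Fin N → ℚ)
             (tags : ∀ a b c → x a b c ∈Cell a × y a b c ∈Cell b × z a b c ∈Cell c) where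

      open Cell N h≡

      private
        -- The integrand at the lower corner of a cell times the volume `h ^ 3`; the scaling of the
        -- three k-th powers is collected in `h ^ e`.
        grid : ℕ → ℕ → ℕ → ℚ
        grid a b c = ι (spread a b c) ^ k * (h ^ e * h ^ 3)

        δ : ℚ
        δ = ι k * h + ι k * h + ι k * h

        S : ℚ
        S = tripleSum (λ m → ι m ^ k) N

        point : ∀ a b c → ∣ F (x a b c) (y a b c) (z a b c) * h ^ 3 - grid (toℕ a) (toℕ b) (toℕ c) ∣ ≤ δ * h ^ 3
        point a b c = subst₂ (λ p q → ∣ p * h ^ 3 - q ∣ ≤ δ * h ^ 3) (sym (F≡ (q≥0 x∈) (q≤1 z∈)))
          (trans (cong (_* h ^ 3) (sym (trans (cong (ι (spread a′ b′ c′) ^ k *_) (^-split h k))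
              (ι^-scale k (b′ ℕ.∸ a′) (c′ ℕ.∸ a′) (c′ ℕ.∸ b′) h))))
            (ℚ.*-assoc (ι (spread a′ b′ c′) ^ k) (h ^ e) (h ^ 3)))
          (Close-*ʳ (Close-* (Close-* (Close-^ k dxy) (Close-^ k dxz)) (Close-^ k dyz)) (^-nonneg 3 0≤h))
          where
          x∈ = proj₁ (tags a b c)
          y∈ = proj₁ (proj₂ (tags a b c))
          z∈ = proj₂ (proj₂ (tags a b c))
          a′ = toℕ a
          b′ = toℕ b
          c′ = toℕ c
          dxy : Close h (0ℚ ⊔ (y a b c - x a b c)) (ι (b′ ℕ.∸ a′) * h)
          dxy = difference x∈ y∈
          dxz : Close h (0ℚ ⊔ (z a b c - x a b c)) (ι (c′ ℕ.∸ a′) * h)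
          dxz = difference x∈ z∈
          dyz : Close h (0ℚ ⊔ (z a b c - y a b c)) (ι (c′ ℕ.∸ b′) * h)
          dyz = difference y∈ z∈
        gridSum : Σ< N (λ a → Σ< N λ b → Σ< N λ c → grid a b c) ≡ S * (h ^ e * h ^ 3)
        gridSum = trans (Σ<-cong N λ a _ → trans (Σ<-cong N λ b _ → Σ<-*ʳ N (h ^ e * h ^ 3) _) (Σ<-*ʳ N (h ^ e * h ^ 3) _))
          (Σ<-*ʳ N (h ^ e * h ^ 3) _)

        hN^ : ∀ d → h ^ d * ι N ^ d ≡ 1ℚ
        hN^ d = trans (sym (^-distrib-* h (ι N) d)) (trans (cong (_^ d) h*N≡1) (1^ d))
          where
          1^ : ∀ d → 1ℚ ^ d ≡ 1ℚ
          1^ zero    = refl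
          1^ (suc d) = trans (ℚ.*-identityˡ (1ℚ ^ d)) (1^ d)

        -- Multiplying `est N` by h^(3+e) turns N^(3+e) into 1 and the error C N^(2+e) into C h.
        grid≈I : ∣ S * (h ^ e * h ^ 3) - I ∣ ≤ C * h
        grid≈I = begin
          ∣ S * (h ^ e * h ^ 3) - I ∣                    ≡⟨ cong ∣_∣ (cong₂ _-_ (cong (S *_) (lemma₁ (h ^ e) h)) (trans (sym (ℚ.*-identityʳ I)) (cong (I *_) (sym (hN^ (3 ℕ.+ e)))))) ⟩
          ∣ S * H - I * (H * M) ∣                        ≡⟨ cong ∣_∣ (lemma₂ S H I M) ⟩
          ∣ (S - I * M) * H ∣                            ≡⟨ ℚ.∣p*q∣≡∣p∣*∣q∣ (S - I * M) H ⟩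
          ∣ S - I * M ∣ * ∣ H ∣                          ≡⟨ cong (∣ S - I * M ∣ *_) (ℚ.0≤p⇒∣p∣≡p 0≤H) ⟩
          ∣ S - I * M ∣ * H                              ≤⟨ *-monoʳ-≤ 0≤H (est N) ⟩
          C * ι N ^ (2 ℕ.+ e) * (h * h ^ (2 ℕ.+ e))      ≡⟨ lemma₃ C (ι N ^ (2 ℕ.+ e)) h (h ^ (2 ℕ.+ e)) ⟩
          C * h * (h ^ (2 ℕ.+ e) * ι N ^ (2 ℕ.+ e))      ≡⟨ cong (C * h *_) (hN^ (2 ℕ.+ e)) ⟩
          C * h * 1ℚ                                     ≡⟨ ℚ.*-identityʳ (C * h) ⟩
          C * h                                          ∎
          where
          open ℚ.≤-Reasoning
          H M : ℚ
          H = h ^ (3 ℕ.+ e)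
          M = ι N ^ (3 ℕ.+ e)
          0≤H : 0ℚ ≤ H
          0≤H = ^-nonneg (3 ℕ.+ e) 0≤h
          lemma₁ : ∀ p h → p * (h * (h * (h * 1ℚ))) ≡ h * (h * (h * p))
          lemma₁ = solve-∀ ℚ-ring
          lemma₂ : ∀ S H I M → S * H - I * (H * M) ≡ (S - I * M) * H
          lemma₂ = solve-∀ ℚ-ring
          lemma₃ : ∀ C m h p → C * m * (h * p) ≡ C * h * (p * m)
          lemma₃ = solve-∀ ℚ-ring

      riemannSum-error : ∣ sum (λ a → sum (λ b → sum (λ c → F (x a b c) (y a b c) (z a b c) * h ^ 3))) - I ∣ ≤ K * h
      riemannSum-error = begin
        ∣ R - I ∣                                 ≤⟨ ∣-∣-triangle R (S * (h ^ e * h ^ 3)) I ⟩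
        ∣ R - S * (h ^ e * h ^ 3) ∣ + ∣ S * (h ^ e * h ^ 3) - I ∣
          ≤⟨ ℚ.+-mono-≤ (subst (λ x → ∣ R - x ∣ ≤ ι N * (ι N * (ι N * (δ * h ^ 3)))) gridSum
               (sum-Σ< N λ a → sum-Σ< N λ b → sum-Σ< N λ c → point a b c)) grid≈I ⟩
        ι N * (ι N * (ι N * (δ * h ^ 3))) + C * h    ≡⟨ cong (_+ C * h) (lemma (ι N) δ h) ⟩
        δ * (h ^ 3 * ι N ^ 3) + C * h                ≡⟨ cong (λ x → δ * x + C * h) (hN^ 3) ⟩
        δ * 1ℚ + C * h                               ≡⟨ lemma₂ (ι k) h C ⟩
        K * h                                        ∎
        where
        open ℚ.≤-Reasoning
        R = sum (λ a → sum (λ b → sum (λ c → F (x a b c) (y a b c) (z a b c) * h ^ 3)))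
        lemma : ∀ n d h → n * (n * (n * (d * (h * (h * (h * 1ℚ)))))) ≡ d * (h * (h * (h * 1ℚ)) * (n * (n * (n * 1ℚ))))
        lemma = solve-∀ ℚ-ring
        lemma₂ : ∀ k h C → (k * h + k * h + k * h) * 1ℚ + C * h ≡ (k + k + k + C) * h
        lemma₂ = solve-∀ ℚ-ring

    isIntegral : IsIntegralOverRegion (λ x y z → (y - x) ^ k * (z - x) ^ k * (z - y) ^ k) I
    isIntegral ε 0<ε = proj₁ large , λ N N≥N₀ x y z tags →
      ℚ.≤-trans (riemannSum-error (λ {x} {y} {z} → integrand-⊔ {k} {x} {y} {z} 1≤k) N refl x y z tags) (error≤ε N N≥N₀)
      where
      large : ∃ λ N₀ → K ≤ ι N₀ * ε
      large = archimedean K ε (+-nonneg (+-nonneg (+-nonneg (ι-nonneg k) (ι-nonneg k)) (ι-nonneg k)) 0≤C) 0<ε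
      error≤ε : ∀ N .{{_ : ℕ.NonZero N}} → N ℕ.≥ proj₁ large → K * (ℤ.+ 1 / N) ≤ ε
      error≤ε N N≥N₀ = begin
        K * h              ≤⟨ *-monoʳ-≤ 0≤h (ℚ.≤-trans (proj₂ large) (*-monoʳ-≤ (ℚ.<⇒≤ 0<ε) (ι-mono-≤ N≥N₀))) ⟩
        ι N * ε * h        ≡⟨ lemma (ι N) ε h ⟩
        ε * (h * ι N)      ≡⟨ cong (ε *_) h*N≡1 ⟩
        ε * 1ℚ             ≡⟨ ℚ.*-identityʳ ε ⟩
        ε                  ∎
        where
        h : ℚ
        h = ℤ.+ 1 / N
        open Cell N {h} refl
        open ℚ.≤-Reasoning
        lemma : ∀ n e h → n * e * h ≡ e * (h * n)
        lemma = solve-∀ ℚ-ring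

  -- In this multiplied form the empty list is no exception, since both sides are then 0.
  mean-length : ∀ {A : Set} (as : List A) (f : A → ℚ) → mean as f * ι (length as) ≡ foldr _+_ 0ℚ (map f as)
  mean-length []       f = ℚ.*-zeroˡ (ι 0)
  mean-length (a ∷ as) f = begin
    s * h * ι (suc (length as))       ≡⟨ ℚ.*-assoc s h (ι (suc (length as))) ⟩
    s * (h * ι (suc (length as)))     ≡⟨ cong (s *_) (trans (/-*-ι 1 (suc (length as))) ι-1) ⟩
    s * 1ℚ                            ≡⟨ ℚ.*-identityʳ s ⟩
    s                                 ∎
    where
    open ≡-Reasoning
    s = foldr _+_ 0ℚ (map f (a ∷ as))
    h = ℤ.+ 1 / suc (length as)

  -- The error of the moments

  module _ (k : ℕ) (1≤k : 1 ℕ.≤ k) where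

    open _∼[_]_ (tripleSum-suc-∼ k 1≤k)

    private
      e : ℕ
      e = k ℕ.+ (k ℕ.+ k)
      I : ℚ
      I = integralConst k

    momentBound : ℚ
    -- 6 is the denominator in the count (n³ - n)/6, and 2 the price of replacing n³ - n by n³ from
    -- below. C is the error of the triple sum, and `∣ I ∣` the defect between n³ - n and n³ in its
    -- leading term.
    momentBound = ι 2 * (ι 6 * (C + ∣ I ∣))

    -- X stands for the mean and L for the number of permutations; the two equations are all that
    -- the combinatorics has to supply. The inequality is proved after multiplication by n³ · 2^k ·
    -- n^(3k).
    moment-error : ∀ n .{{_ : ℕ.NonZero n}} → 2 ℕ.≤ n → ∀ {X L} →
      ι 6 * L + ι n ≡ ι n ^ 3 → X * L * (ι 2 * ι n ^ 3) ^ k ≡ tripleSum (λ m → ι m ^ k) (suc n) →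
      ∣ X - _/_ (ℤ.+ 6) (2 ℕ.^ k) {{m^n≢0 2 k}} * I ∣
        ≤ momentBound * ∣ _/_ (ℤ.+ k) (2 ℕ.^ k ℕ.* n) {{m*n≢0 (2 ℕ.^ k) n {{m^n≢0 2 k}}}} ∣
    moment-error n 2≤n {X} {L} count total = ℚ.*-cancelʳ-≤-pos (x ^ 3 * (P * M)) {{positive 0<}} (begin
      ∣ X - c * I ∣ * (x ^ 3 * (P * M))
        ≤⟨ *-monoˡ-≤ (ℚ.0≤∣p∣ (X - c * I)) (*-monoʳ-≤ 0≤PM x³≤) ⟩
      ∣ X - c * I ∣ * (ι 2 * (x ^ 3 - x) * (P * M))     ≡⟨ lemma₁ ∣ X - c * I ∣ (ι 2) (x ^ 3 - x) (P * M) ⟩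
      ι 2 * (∣ X - c * I ∣ * ((x ^ 3 - x) * (P * M)))   ≡⟨ cong (λ q → ι 2 * (∣ X - c * I ∣ * q)) (ℚ.0≤p⇒∣p∣≡p 0≤Q) ⟨
      ι 2 * (∣ X - c * I ∣ * ∣ (x ^ 3 - x) * (P * M) ∣) ≡⟨ cong (ι 2 *_) (ℚ.∣p*q∣≡∣p∣*∣q∣ (X - c * I) ((x ^ 3 - x) * (P * M))) ⟨
      ι 2 * ∣ (X - c * I) * ((x ^ 3 - x) * (P * M)) ∣   ≡⟨ cong (λ q → ι 2 * ∣ q ∣) scaled ⟩
      ι 2 * ∣ ι 6 * ((S - I * x ^ (3 ℕ.+ e)) + I * (x * M)) ∣
        ≡⟨ cong (ι 2 *_) (trans (ℚ.∣p*q∣≡∣p∣*∣q∣ (ι 6) ((S - I * x ^ (3 ℕ.+ e)) + I * (x * M)))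
             (cong (_* ∣ (S - I * x ^ (3 ℕ.+ e)) + I * (x * M) ∣) (ℚ.0≤p⇒∣p∣≡p (ι-nonneg 6)))) ⟩
      ι 2 * (ι 6 * ∣ (S - I * x ^ (3 ℕ.+ e)) + I * (x * M) ∣)
        ≤⟨ *-monoˡ-≤ (ι-nonneg 2) (*-monoˡ-≤ (ι-nonneg 6) (ℚ.≤-trans (ℚ.∣p+q∣≤∣p∣+∣q∣ (S - I * x ^ (3 ℕ.+ e)) (I * (x * M)))
             (ℚ.+-mono-≤ (est n) tail≤))) ⟩
      ι 2 * (ι 6 * (C * x ^ (2 ℕ.+ e) + ∣ I ∣ * x ^ (2 ℕ.+ e)))
        ≡⟨ lemma₂ (ι 2) (ι 6) C ∣ I ∣ (x ^ (2 ℕ.+ e)) ⟩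
      momentBound * (1ℚ * x ^ (2 ℕ.+ e))
        ≤⟨ *-monoˡ-≤ 0≤momentBound (*-monoʳ-≤ (^-nonneg (2 ℕ.+ e) (ι-nonneg n)) 1≤kn) ⟩
      momentBound * (r * (P * x) * x ^ (2 ℕ.+ e))       ≡⟨ cong (λ q → momentBound * (r * (P * x) * (x * (x * q)))) M≡ ⟩
      momentBound * (r * (P * x) * (x * (x * M)))       ≡⟨ lemma₃ momentBound r P x M ⟩
      momentBound * r * (x ^ 3 * (P * M))               ≡⟨ cong (λ q → momentBound * q * (x ^ 3 * (P * M))) (ℚ.0≤p⇒∣p∣≡p 0≤r) ⟨
      momentBound * ∣ r ∣ * (x ^ 3 * (P * M))           ∎)
      where
      open ℚ.≤-Reasoning
      x = ι n
      P = ι 2 ^ k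
      M = (x ^ 3) ^ k
      S = tripleSum (λ m → ι m ^ k) (suc n)
      c = _/_ (ℤ.+ 6) (2 ℕ.^ k) {{m^n≢0 2 k}}
      r = _/_ (ℤ.+ k) (2 ℕ.^ k ℕ.* n) {{m*n≢0 (2 ℕ.^ k) n {{m^n≢0 2 k}}}}
      ι-pos : ∀ m .{{_ : ℕ.NonZero m}} → 0ℚ < ι m
      ι-pos (suc m) = ℚ.<-≤-trans (ℚ.positive⁻¹ 1ℚ) (subst (_≤ ι (suc m)) ι-1 (ι-mono-≤ (ℕ.s≤s ℕ.z≤n)))
      *-pos : ∀ {p q} → 0ℚ < p → 0ℚ < q → 0ℚ < p * q
      *-pos {p} {q} 0<p 0<q = subst (_< p * q) (ℚ.*-zeroʳ p) (ℚ.*-monoʳ-<-pos p {{positive 0<p}} 0<q)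
      ^-pos : ∀ {p} d → 0ℚ < p → 0ℚ < p ^ d
      ^-pos zero    0<p = ℚ.positive⁻¹ 1ℚ
      ^-pos (suc d) 0<p = *-pos 0<p (^-pos d 0<p)
      0<x : 0ℚ < x
      0<x = ι-pos n
      0< : 0ℚ < x ^ 3 * (P * M)
      0< = *-pos (^-pos 3 0<x) (*-pos (^-pos k (ι-pos 2)) (^-pos k (^-pos 3 0<x)))
      0≤P : 0ℚ ≤ P
      0≤P = ^-nonneg k (ι-nonneg 2)
      0≤PM : 0ℚ ≤ P * M
      0≤PM = *-nonneg 0≤P (^-nonneg k (^-nonneg 3 (ι-nonneg n)))
      0≤r : 0ℚ ≤ r
      0≤r = ℚ.nonNegative⁻¹ r {{ℚ.normalize-nonNeg k (2 ℕ.^ k ℕ.* n) {{m*n≢0 (2 ℕ.^ k) n {{m^n≢0 2 k}}}}}}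
      0≤momentBound : 0ℚ ≤ momentBound
      0≤momentBound = *-nonneg (ι-nonneg 2) (*-nonneg (ι-nonneg 6) (+-nonneg 0≤C (ℚ.0≤∣p∣ I)))
      -- Clearing denominators turns k / (2^k n) into k, and k ≥ 1 can only enlarge the target
      -- bound.
      1≤kn : 1ℚ ≤ r * (P * x)
      1≤kn = begin
        1ℚ                                  ≡⟨ ι-1 ⟨
        ι 1                                 ≤⟨ ι-mono-≤ 1≤k ⟩
        ι k                                 ≡⟨ /-*-ι k (2 ℕ.^ k ℕ.* n) {{m*n≢0 (2 ℕ.^ k) n {{m^n≢0 2 k}}}} ⟨
        r * ι (2 ℕ.^ k ℕ.* n)               ≡⟨ cong (r *_) (trans (ι-* (2 ℕ.^ k) n) (cong (_* x) (ι-^ 2 k))) ⟩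
        r * (P * x)                         ∎
      cP≡6 : c * P ≡ ι 6
      cP≡6 = trans (cong (c *_) (sym (ι-^ 2 k))) (/-*-ι 6 (2 ℕ.^ k) {{m^n≢0 2 k}})
      M≡ : x ^ e ≡ M
      M≡ = trans (trans (^-homo-* x k (k ℕ.+ k)) (cong (x ^ k *_) (^-homo-* x k k)))
        (sym (trans (^-distrib-* x (x * (x * 1ℚ)) k) (cong (x ^ k *_) (trans (^-distrib-* x (x * 1ℚ) k) (cong (λ q → x ^ k * q ^ k) (ℚ.*-identityʳ x))))))
      lemma₀ : ∀ y x → y + x - x ≡ y
      lemma₀ = solve-∀ ℚ-ring
      6L≡ : ι 6 * L ≡ x ^ 3 - x
      6L≡ = trans (sym (lemma₀ (ι 6 * L) x)) (cong (_- x) count)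
      lemma₅ : ∀ x t → t * (x * (x * (x * 1ℚ)) - x) ≡ x * (x * (x * 1ℚ)) + x * ((t - 1ℚ) * (x * x) - t)
      lemma₅ = solve-∀ ℚ-ring
      2x-2 : (ι 2 - 1ℚ) * (x * x) - ι 2 ≡ x * x - ι 2
      2x-2 = cong (_- ι 2) (trans (cong (λ q → (q - 1ℚ) * (x * x)) (trans (ι-suc 1) (cong (_+ 1ℚ) ι-1))) (ℚ.*-identityˡ (x * x)))
      2≤x*x : 0ℚ ≤ x * x - ι 2
      2≤x*x = subst (_≤ x * x - ι 2) (ℚ.+-inverseʳ (ι 2)) (ℚ.+-monoˡ-≤ (- ι 2)
        (subst (ι 2 ≤_) (ι-* n n) (ι-mono-≤ (ℕ.≤-trans 2≤n (ℕ.m≤m*n n n)))))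
      -- From n ≥ 2 follows x² ≥ 2, so dividing by x³ - x instead of x³ costs at most a factor 2.
      x³≤ : x ^ 3 ≤ ι 2 * (x ^ 3 - x)
      x³≤ = begin
        x ^ 3                                              ≡⟨ ℚ.+-identityʳ (x ^ 3) ⟨
        x ^ 3 + 0ℚ                                         ≤⟨ ℚ.+-monoʳ-≤ (x ^ 3) (*-nonneg (ι-nonneg n) 2≤x*x) ⟩
        x ^ 3 + x * (x * x - ι 2)                          ≡⟨ cong (λ q → x ^ 3 + x * q) 2x-2 ⟨
        x ^ 3 + x * ((ι 2 - 1ℚ) * (x * x) - ι 2)           ≡⟨ lemma₅ x (ι 2) ⟨
        ι 2 * (x ^ 3 - x)                                  ∎
      lemma₆ : ∀ x → x * (x * (x * 1ℚ)) - x ≡ x * (x * x - 1ℚ)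
      lemma₆ = solve-∀ ℚ-ring
      0≤Q : 0ℚ ≤ (x ^ 3 - x) * (P * M)
      0≤Q = *-nonneg (subst (0ℚ ≤_) (sym (lemma₆ x)) (*-nonneg (ι-nonneg n) (ℚ.≤-trans 2≤x*x
        (ℚ.+-monoʳ-≤ (x * x) (ℚ.neg-antimono-≤ (subst (_≤ ι 2) ι-1 (ι-mono-≤ (ℕ.s≤s (ℕ.z≤n {1}))))))))) 0≤PM
      lemma₁ : ∀ a t q m → a * (t * q * m) ≡ t * (a * (q * m))
      lemma₁ = solve-∀ ℚ-ring
      lemma₂ : ∀ t s C I y → t * (s * (C * y + I * y)) ≡ t * (s * (C + I)) * (1ℚ * y)
      lemma₂ = solve-∀ ℚ-ring
      lemma₃ : ∀ b r P x M → b * (r * (P * x) * (x * (x * M))) ≡ b * r * (x * (x * (x * 1ℚ)) * (P * M))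
      lemma₃ = solve-∀ ℚ-ring
      lemma₄ : ∀ X c I s L P M → (X - c * I) * (s * L * (P * M)) ≡ s * (X * L * (P * M)) - (c * P) * (I * ((s * L) * M))
      lemma₄ = solve-∀ ℚ-ring
      lemma₇ : ∀ s S I x M → s * S - s * (I * ((x * (x * (x * 1ℚ)) - x) * M)) ≡ s * ((S - I * (x * (x * (x * M)))) + I * (x * M))
      lemma₇ = solve-∀ ℚ-ring
      -- X L (2n³)^k is the triple sum, whose main term cancels against I n^(3k+3). What is left is
      -- its error and I n^(3k+1), the latter from the n in n³ - n.
      scaled : (X - c * I) * ((x ^ 3 - x) * (P * M)) ≡ ι 6 * ((S - I * x ^ (3 ℕ.+ e)) + I * (x * M))
      scaled = begin-equality
        (X - c * I) * ((x ^ 3 - x) * (P * M))                       ≡⟨ cong (λ q → (X - c * I) * (q * (P * M))) 6L≡ ⟨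
        (X - c * I) * (ι 6 * L * (P * M))                           ≡⟨ lemma₄ X c I (ι 6) L P M ⟩
        ι 6 * (X * L * (P * M)) - (c * P) * (I * ((ι 6 * L) * M))   ≡⟨ cong₂ (λ p q → ι 6 * (X * L * p) - q * (I * ((ι 6 * L) * M))) (sym (^-distrib-* (ι 2) (x ^ 3) k)) cP≡6 ⟩
        ι 6 * (X * L * (ι 2 * x ^ 3) ^ k) - ι 6 * (I * ((ι 6 * L) * M)) ≡⟨ cong₂ (λ p q → ι 6 * p - ι 6 * (I * (q * M))) total 6L≡ ⟩
        ι 6 * S - ι 6 * (I * ((x ^ 3 - x) * M))                     ≡⟨ lemma₇ (ι 6) S I x M ⟩
        ι 6 * ((S - I * (x * (x * (x * M)))) + I * (x * M))         ≡⟨ cong (λ q → ι 6 * ((S - I * (x * (x * (x * q)))) + I * (x * M))) M≡ ⟨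
        ι 6 * ((S - I * x ^ (3 ℕ.+ e)) + I * (x * M))               ∎
      tail≤ : ∣ I * (x * M) ∣ ≤ ∣ I ∣ * x ^ (2 ℕ.+ e)
      tail≤ = begin
        ∣ I * (x * M) ∣              ≡⟨ ℚ.∣p*q∣≡∣p∣*∣q∣ I (x * M) ⟩
        ∣ I ∣ * ∣ x * M ∣            ≡⟨ cong (∣ I ∣ *_) (ℚ.0≤p⇒∣p∣≡p (*-nonneg (ι-nonneg n) (^-nonneg k (^-nonneg 3 (ι-nonneg n))))) ⟩
        ∣ I ∣ * (x * M)              ≡⟨ cong (λ q → ∣ I ∣ * (x * q)) M≡ ⟨
        ∣ I ∣ * x ^ suc e            ≤⟨ *-monoˡ-≤ (ℚ.0≤∣p∣ I) (ι^-mono-suc {suc e} n (ℕ.s≤s ℕ.z≤n)) ⟩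
        ∣ I ∣ * x ^ (2 ℕ.+ e)        ∎

-- Bruhat order: invariants and the threshold criterion

module Bruhat where

  open import Defs
  open import Data.Bool.Base using (true; false; if_then_else_)
  open import Data.Fin.Base using (Fin; zero; suc; toℕ; fromℕ<; inject₁)
  import Data.Fin.Permutation.Components as PC
  open import Data.Fin.Permutation
    using (Permutation′; _⟨$⟩ʳ_; _⟨$⟩ˡ_; _≈_; _∘ₚ_; permutation; transpose; flip; inverseˡ; inverseʳ)
  import Data.Fin.Properties as Fin
  open import Data.List.Base using (List; []; _∷_; length; filter; allFin)
  open import Data.List.Membership.Propositional using (_∈_)
  open import Data.List.Membership.Propositional.Properties using (∈-filter⁺; ∈-filter⁻; ∈-allFin)
  open import Data.List.Relation.Unary.All using (_∷_)
  open import Data.List.Relation.Unary.AllPairs using (_∷_)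
  open import Data.List.Relation.Unary.Any using (here; there)
  import Data.List.Relation.Unary.Unique.Propositional.Properties as Unique
  open import Data.Nat.Base as ℕ using (ℕ; zero; suc; _+_; _∸_; _≤_; _<_; _<ᵇ_; z≤n; s≤s)
  import Data.Nat.Properties as ℕ
  open import Data.Nat.Induction using (<-wellFounded)
  open import Data.Nat.Tactic.RingSolver using (solve-∀)
  open import Data.Product.Base using (∃; ∃₂; _×_; _,_; proj₁; proj₂)
  open import Data.Sum.Base using (inj₁; inj₂)
  open import Function.Base using (_∘_)
  open import Induction.WellFounded using (Acc; acc)
  open import Relation.Binary.Definitions using (tri<; tri≈; tri>)
  open import Relation.Binary.PropositionalEquality
  open import Relation.Nullary using (¬_; Dec; yes; no; contradiction)
  open import Relation.Nullary.Decidable using (¬?; _×-dec_; decidable-stable)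
  open import Relation.Unary using (Decidable)
  open import Algebra.Definitions.RawSemiring ℕ.+-*-rawSemiring using () renaming (sum to ∑)

  private
    variable
      n : ℕ

  data TransposeView (i j : Fin n) : Fin n → Fin n → Set where
    atˡ       : TransposeView i j i j
    atʳ       : TransposeView i j j i
    elsewhere : ∀ {k} → k ≢ i → k ≢ j → TransposeView i j k k

  transposeView : ∀ (i j k : Fin n) → TransposeView i j k (PC.transpose i j k)
  transposeView i j k with k Fin.≟ i
  ... | yes refl = atˡ
  ... | no k≢i with k Fin.≟ j
  ...   | yes refl = atʳ
  ...   | no k≢j   = elsewhere k≢i k≢j

  module _ {f : ℕ → ℕ} (f-mono : ∀ {x y} → x ≤ y → f x ≤ f y) where

    -- The larger entry moves from i to the later position j, where the bound is weaker; the smaller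
    -- one moves to i, where even the larger one obeyed the bound.
    ≤ᴮ-upper : ∀ {π σ : Permutation′ n} → π ≤ᴮ σ →
               (∀ i → toℕ (σ ⟨$⟩ʳ i) ≤ f (toℕ i)) → ∀ i → toℕ (π ⟨$⟩ʳ i) ≤ f (toℕ i)
    ≤ᴮ-upper (done π≈σ) σ≤f i = subst (λ x → toℕ x ≤ f (toℕ i)) (sym (π≈σ i)) (σ≤f i)
    ≤ᴮ-upper {σ = σ} (reduce i j i<j σj<σi π≤) σ≤f = ≤ᴮ-upper π≤ λ k → step k (transposeView i j k)
      where
      step : ∀ k {l} → TransposeView i j k l → toℕ (σ ⟨$⟩ʳ l) ≤ f (toℕ k)
      step k atˡ             = ℕ.≤-trans (ℕ.<⇒≤ σj<σi) (σ≤f i)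
      step k atʳ             = ℕ.≤-trans (σ≤f i) (f-mono (ℕ.<⇒≤ i<j))
      step k (elsewhere _ _) = σ≤f k

    ≤ᴮ-lower : ∀ {π σ : Permutation′ n} → π ≤ᴮ σ →
               (∀ i → f (toℕ i) ≤ toℕ (σ ⟨$⟩ʳ i)) → ∀ i → f (toℕ i) ≤ toℕ (π ⟨$⟩ʳ i)
    ≤ᴮ-lower (done π≈σ) f≤σ i = subst (λ x → f (toℕ i) ≤ toℕ x) (sym (π≈σ i)) (f≤σ i)
    ≤ᴮ-lower {σ = σ} (reduce i j i<j σj<σi π≤) f≤σ = ≤ᴮ-lower π≤ λ k → step k (transposeView i j k)
      where
      step : ∀ k {l} → TransposeView i j k l → f (toℕ k) ≤ toℕ (σ ⟨$⟩ʳ l)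
      step k atˡ             = ℕ.≤-trans (f-mono (ℕ.<⇒≤ i<j)) (f≤σ j)
      step k atʳ             = ℕ.≤-trans (f≤σ j) (ℕ.<⇒≤ σj<σi)
      step k (elsewhere _ _) = f≤σ k

  ⟨$⟩ʳ-injective : ∀ (π : Permutation′ n) {i j} → π ⟨$⟩ʳ i ≡ π ⟨$⟩ʳ j → i ≡ j
  ⟨$⟩ʳ-injective π e = trans (sym (inverseˡ π)) (trans (cong (π ⟨$⟩ˡ_) e) (inverseˡ π))

  -- Induction on the entry π(i). If σ(i) < π(i), let j be the position with π(j) = σ(i). By
  -- induction σ(j) = π(j) = σ(i), so j = i and π(i) = σ(i) after all.
  pointwise-≤⇒≈ : ∀ {π σ : Permutation′ n} → (∀ i → toℕ (σ ⟨$⟩ʳ i) ≤ toℕ (π ⟨$⟩ʳ i)) → σ ≈ π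
  pointwise-≤⇒≈ {π = π} {σ} σ≤π i = go i (<-wellFounded _)
    where
    go : ∀ i → Acc _<_ (toℕ (π ⟨$⟩ʳ i)) → σ ⟨$⟩ʳ i ≡ π ⟨$⟩ʳ i
    go i (acc rec) with σ ⟨$⟩ʳ i Fin.≟ π ⟨$⟩ʳ i
    ... | yes e = e
    ... | no ne = contradiction (trans (sym πj≡σi) (cong (π ⟨$⟩ʳ_) j≡i)) ne
      where
      j = π ⟨$⟩ˡ (σ ⟨$⟩ʳ i)
      πj≡σi : π ⟨$⟩ʳ j ≡ σ ⟨$⟩ʳ i
      πj≡σi = inverseʳ π
      σi<πi : toℕ (σ ⟨$⟩ʳ i) < toℕ (π ⟨$⟩ʳ i)
      σi<πi = ℕ.≤∧≢⇒< (σ≤π i) (ne ∘ Fin.toℕ-injective)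
      j≡i : j ≡ i
      j≡i = ⟨$⟩ʳ-injective σ (trans (go j (rec (subst (λ x → toℕ x < toℕ (π ⟨$⟩ʳ i)) (sym πj≡σi) σi<πi))) πj≡σi)

  ∑-mono-≤ : ∀ {f g : Fin n → ℕ} → (∀ i → f i ≤ g i) → ∑ f ≤ ∑ g
  ∑-mono-≤ {zero}  f≤g = z≤n
  ∑-mono-≤ {suc n} f≤g = ℕ.+-mono-≤ (f≤g zero) (∑-mono-≤ (f≤g ∘ suc))

  ∑-mono-< : ∀ {f g : Fin n → ℕ} → (∀ i → f i ≤ g i) → ∀ i → f i < g i → ∑ f < ∑ g
  ∑-mono-< f≤g zero    lt = ℕ.+-mono-<-≤ lt (∑-mono-≤ (f≤g ∘ suc))
  ∑-mono-< f≤g (suc i) lt = ℕ.+-mono-≤-< (f≤g zero) (∑-mono-< (f≤g ∘ suc) i lt)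

  module _ {n : ℕ} (p : ℕ) (π : Permutation′ n) where

    record Threshold (σ : Permutation′ n) : Set where
      field
        below : ∀ i → toℕ i < p → toℕ (π ⟨$⟩ʳ i) ≤ toℕ (σ ⟨$⟩ʳ i)
        above : ∀ i → p ≤ toℕ i → toℕ (σ ⟨$⟩ʳ i) ≤ toℕ (π ⟨$⟩ʳ i)

    open Threshold

    -- Positions whose interchange is a reduction and preserves `Threshold`: the entry arriving at i
    -- is still at least π(i), the one arriving at j at most π(j).
    record Swap (σ : Permutation′ n) : Set where
      field
        {i j} : Fin n
        i<p   : toℕ i < p
        p≤j   : p ≤ toℕ j
        σj<σi : toℕ (σ ⟨$⟩ʳ j) < toℕ (σ ⟨$⟩ʳ i)
        πi≤σj : toℕ (π ⟨$⟩ʳ i) ≤ toℕ (σ ⟨$⟩ʳ j)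
        σi≤πj : toℕ (σ ⟨$⟩ʳ i) ≤ toℕ (π ⟨$⟩ʳ j)

    -- Follow the cycle k ↦ σ⁻¹ (π k) from i: it either ends at a position j to
    -- swap with i, or meets a position before p with an entry smaller than that
    -- at i, from which to start again.
    findSwap : ∀ {σ} → Threshold σ → ∀ i → toℕ i < p → toℕ (π ⟨$⟩ʳ i) < toℕ (σ ⟨$⟩ʳ i) → Swap σ
    findSwap {σ} th i i<p πi<σi = walk i i<p (<-wellFounded _) i ℕ.≤-refl πi<σi (ℕ.<⇒≢ πi<σi ∘ sym) (<-wellFounded _)
      where
      s t : Fin n → ℕ
      s k = toℕ (σ ⟨$⟩ʳ k)
      t k = toℕ (π ⟨$⟩ʳ k)
      -- Termination is lexicographic: a restart lowers `s i`, and every other move raises `t k`,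
      -- which stays below `s i`.
      walk : ∀ i → toℕ i < p → Acc _<_ (s i) →
             ∀ k → t i ≤ t k → t k < s i → s k ≢ t k → Acc _<_ (s i ∸ t k) → Swap σ
      walk i i<p si-acc k ti≤tk tk<si sk≢tk (acc rec′) = next si-acc (toℕ j ℕ.<? p)
        where
        j = σ ⟨$⟩ˡ (π ⟨$⟩ʳ k)
        sj≡tk : s j ≡ t k
        sj≡tk = cong toℕ (inverseʳ σ)
        sj≢tj : s j ≢ t j
        sj≢tj sj≡tj = sk≢tk (trans (cong s (sym j≡k)) sj≡tk)
          where
          j≡k : j ≡ k
          j≡k = ⟨$⟩ʳ-injective π (Fin.toℕ-injective (trans (sym sj≡tj) sj≡tk))
        sj<si : s j < s i
        sj<si = subst (_< s i) (sym sj≡tk) tk<si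
        next : Acc _<_ (s i) → Dec (toℕ j < p) → Swap σ
        next (acc rec) (yes j<p) = walk j j<p (rec sj<si) j ℕ.≤-refl (ℕ.≤∧≢⇒< (below th j j<p) (sj≢tj ∘ sym)) sj≢tj (<-wellFounded _)
        next si-acc (no j≮p) with s i ℕ.≤? t j
        ... | yes si≤tj = record
          { i<p = i<p; p≤j = ℕ.≮⇒≥ j≮p; σj<σi = sj<si; πi≤σj = subst (t i ≤_) (sym sj≡tk) ti≤tk; σi≤πj = si≤tj }
        ... | no si≰tj  = walk i i<p si-acc j (ℕ.≤-trans ti≤tk (ℕ.<⇒≤ tk<tj)) tj<si sj≢tj
          (rec′ (ℕ.∸-monoʳ-< tk<tj (ℕ.<⇒≤ tj<si)))
          where
          tj<si : t j < s i
          tj<si = ℕ.≰⇒> si≰tj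
          tk<tj : t k < t j
          tk<tj = subst (_< t j) sj≡tk (ℕ.≤∧≢⇒< (above th j (ℕ.≮⇒≥ j≮p)) sj≢tj)

    -- Induction on the total excess of σ over π. A swap lowers the excess at i and leaves none at
    -- j. Once there is none before p, σ lies below π everywhere, and two such permutations
    -- coincide.
    threshold⇒≤ᴮ : ∀ σ → Threshold σ → π ≤ᴮ σ
    threshold⇒≤ᴮ σ th = go σ th (<-wellFounded _)
      where
      excess : Permutation′ n → Fin n → ℕ
      excess σ k = toℕ (σ ⟨$⟩ʳ k) ∸ toℕ (π ⟨$⟩ʳ k)
      go : ∀ σ → Threshold σ → Acc _<_ (∑ (excess σ)) → π ≤ᴮ σ
      go σ th (acc rec) with Fin.any? (λ i → (toℕ i ℕ.<? p) ×-dec (toℕ (π ⟨$⟩ʳ i) ℕ.<? toℕ (σ ⟨$⟩ʳ i)))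
      ... | no none = done (λ i → sym (pointwise-≤⇒≈ {π = π} {σ} σ≤π i))
        where
        σ≤π : ∀ i → toℕ (σ ⟨$⟩ʳ i) ≤ toℕ (π ⟨$⟩ʳ i)
        σ≤π i with toℕ i ℕ.<? p
        ... | yes i<p = ℕ.≮⇒≥ (λ lt → none (i , i<p , lt))
        ... | no i≮p  = above th i (ℕ.≮⇒≥ i≮p)
      ... | yes (k , k<p , lt) = reduce i j (ℕ.<-≤-trans i<p p≤j) σj<σi (go σ′ th′ (rec smaller))
        where
        open Swap (findSwap th k k<p lt)
        σ′ = transpose i j ∘ₚ σ
        below′ : ∀ k {l} → TransposeView i j k l → toℕ k < p → toℕ (π ⟨$⟩ʳ k) ≤ toℕ (σ ⟨$⟩ʳ l)
        below′ k atˡ             k<p = πi≤σj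
        below′ k atʳ             j<p = contradiction j<p (ℕ.≤⇒≯ p≤j)
        below′ k (elsewhere _ _) k<p = below th k k<p
        above′ : ∀ k {l} → TransposeView i j k l → p ≤ toℕ k → toℕ (σ ⟨$⟩ʳ l) ≤ toℕ (π ⟨$⟩ʳ k)
        above′ k atˡ             p≤i = contradiction i<p (ℕ.≤⇒≯ p≤i)
        above′ k atʳ             _   = σi≤πj
        above′ k (elsewhere _ _) p≤k = above th k p≤k
        th′ : Threshold σ′
        th′ = record { below = λ k → below′ k (transposeView i j k) ; above = λ k → above′ k (transposeView i j k) }
        excess≤ : ∀ k {l} → TransposeView i j k l → toℕ (σ ⟨$⟩ʳ l) ∸ toℕ (π ⟨$⟩ʳ k) ≤ excess σ k
        excess≤ k atˡ             = ℕ.∸-monoˡ-≤ (toℕ (π ⟨$⟩ʳ k)) (ℕ.<⇒≤ σj<σi)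
        excess≤ k atʳ             = subst (_≤ excess σ k) (sym (ℕ.m≤n⇒m∸n≡0 σi≤πj)) z≤n
        excess≤ k (elsewhere _ _) = ℕ.≤-refl
        excess< : ∀ k {l} → TransposeView i j k l → k ≡ i → toℕ (σ ⟨$⟩ʳ l) ∸ toℕ (π ⟨$⟩ʳ k) < excess σ k
        excess< k atˡ               _   = ℕ.∸-monoˡ-< σj<σi πi≤σj
        excess< k atʳ               j≡i = contradiction (subst (λ k → toℕ k < p) (sym j≡i) i<p) (ℕ.≤⇒≯ p≤j)
        excess< k (elsewhere k≢i _) k≡i = contradiction k≡i k≢i
        smaller : ∑ (excess σ′) < ∑ (excess σ)
        smaller = ∑-mono-< (λ k → excess≤ k (transposeView i j k)) i (excess< i (transposeView i j i) refl)

  -- Block swaps as functions on ℕ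

  <ᵇ-true : ∀ {m n} → m < n → (m <ᵇ n) ≡ true
  <ᵇ-true {m} {n} m<n with m <ᵇ n | ℕ.<⇒<ᵇ m<n
  ... | true | _ = refl

  <ᵇ-false : ∀ {m n} → n ≤ m → (m <ᵇ n) ≡ false
  <ᵇ-false {m} {n} n≤m with m <ᵇ n | ℕ.<ᵇ⇒< m n
  ... | true  | lt = contradiction (lt _) (ℕ.≤⇒≯ n≤m)
  ... | false | _  = refl

  -- The block moved to the front has length t, so positions split at a + t but entries at a + s. An
  -- equation for the index as premise spares rewriting it at each use.
  record IsBlockSwap (a s t : ℕ) (f : ℕ → ℕ) : Set where
    field
      before : ∀ {i} → i < a → f i ≡ i
      left   : ∀ {i} j → i ≡ a + j → j < t → f i ≡ a + s + j
      right  : ∀ {i} j → i ≡ a + t + j → j < s → f i ≡ a + j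
      after  : ∀ {i} → a + t + s ≤ i → f i ≡ i

  data Position (a s t i : ℕ) : Set where
    before : i < a → Position a s t i
    left   : ∀ j → i ≡ a + j → j < t → Position a s t i
    right  : ∀ j → i ≡ a + t + j → j < s → Position a s t i
    after  : a + t + s ≤ i → Position a s t i

  offset : ∀ {m n} → m ≤ n → ∃ λ k → n ≡ m + k
  offset m≤n = _ , sym (ℕ.m+[n∸m]≡n m≤n)

  position : ∀ a s t i → Position a s t i
  position a s t i with i ℕ.<? a
  ... | yes i<a = before i<a
  ... | no i≮a with i ℕ.<? a + t
  ...   | yes i<a+t = let j , i≡a+j = offset (ℕ.≮⇒≥ i≮a) in
    left j i≡a+j (ℕ.+-cancelˡ-< a j t (subst (_< a + t) i≡a+j i<a+t))
  ...   | no i≮a+t with i ℕ.<? a + t + s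
  ...     | yes i<c = let j , i≡ = offset (ℕ.≮⇒≥ i≮a+t) in
    right j i≡ (ℕ.+-cancelˡ-< (a + t) j s (subst (_< a + t + s) i≡ i<c))
  ...     | no i≮c = after (ℕ.≮⇒≥ i≮c)

  -- The one-line notation 1⋯a (b+1)⋯c (a+1)⋯b (c+1)⋯n, with entries and
  -- positions counted from 0, s = b − a and t = c − b.
  abstract
    blockSwap : (a s t : ℕ) → ℕ → ℕ
    blockSwap a s t i =
      if i <ᵇ a then i else if i <ᵇ a + t then s + i else if i <ᵇ a + t + s then i ∸ t else i

    isBlockSwap : ∀ a s t → IsBlockSwap a s t (blockSwap a s t)
    isBlockSwap a s t = record { before = before′ ; left = left′ ; right = right′ ; after = after′ }
      where
      before′ : ∀ {i} → i < a → blockSwap a s t i ≡ i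
      before′ i<a rewrite <ᵇ-true i<a = refl
      left′ : ∀ {i} j → i ≡ a + j → j < t → blockSwap a s t i ≡ a + s + j
      left′ j refl j<t rewrite <ᵇ-false (ℕ.m≤m+n a j) | <ᵇ-true (ℕ.+-monoʳ-< a j<t) = lemma a s j
        where
        lemma : ∀ a s j → s + (a + j) ≡ a + s + j
        lemma = solve-∀
      right′ : ∀ {i} j → i ≡ a + t + j → j < s → blockSwap a s t i ≡ a + j
      right′ j refl j<s rewrite <ᵇ-false (ℕ.≤-trans (ℕ.m≤m+n a t) (ℕ.m≤m+n (a + t) j)) | <ᵇ-false (ℕ.m≤m+n (a + t) j)
        | <ᵇ-true (ℕ.+-monoʳ-< (a + t) j<s) = trans (cong (_∸ t) (lemma a t j)) (ℕ.m+n∸n≡m (a + j) t)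
        where
        lemma : ∀ a t j → a + t + j ≡ a + j + t
        lemma = solve-∀
      after′ : ∀ {i} → a + t + s ≤ i → blockSwap a s t i ≡ i
      after′ c≤i rewrite <ᵇ-false (ℕ.≤-trans (ℕ.≤-trans (ℕ.m≤m+n a t) (ℕ.m≤m+n (a + t) s)) c≤i)
        | <ᵇ-false (ℕ.≤-trans (ℕ.m≤m+n (a + t) s) c≤i) | <ᵇ-false c≤i = refl

  module BlockSwap (a s t : ℕ) = IsBlockSwap (isBlockSwap a s t)

  isBlockSwap-unique : ∀ {a s t f g} → IsBlockSwap a s t f → IsBlockSwap a s t g → ∀ i → f i ≡ g i
  isBlockSwap-unique {a} {s} {t} F G i with position a s t i
  ... | before i<a      = trans (IsBlockSwap.before F i<a) (sym (IsBlockSwap.before G i<a))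
  ... | left j i≡ j<t   = trans (IsBlockSwap.left F j i≡ j<t) (sym (IsBlockSwap.left G j i≡ j<t))
  ... | right j i≡ j<s  = trans (IsBlockSwap.right F j i≡ j<s) (sym (IsBlockSwap.right G j i≡ j<s))
  ... | after c≤i       = trans (IsBlockSwap.after F c≤i) (sym (IsBlockSwap.after G c≤i))

  swap-ends : ∀ a s t → a + t + s ≡ a + s + t
  swap-ends = solve-∀

  blockSwap-inverse : ∀ a s t i → blockSwap a s t (blockSwap a t s i) ≡ i
  blockSwap-inverse a s t i with position a t s i
  ... | before i<a     = trans (cong (blockSwap a s t) (BlockSwap.before a t s i<a)) (BlockSwap.before a s t i<a)
  ... | left j i≡ j<s  = trans (BlockSwap.right a s t j (BlockSwap.left a t s j i≡ j<s) j<s) (sym i≡)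
  ... | right j i≡ j<t = trans (BlockSwap.left a s t j (BlockSwap.right a t s j i≡ j<t) j<t) (sym i≡)
  ... | after c≤i      = trans (cong (blockSwap a s t) (BlockSwap.after a t s c≤i))
    (BlockSwap.after a s t (subst (_≤ i) (swap-ends a t s) c≤i))

  blockSwap-bounded : ∀ {a s t n i} → a + t + s ≤ n → i < n → blockSwap a s t i < n
  blockSwap-bounded {a} {s} {t} {n} {i} c≤n i<n with position a s t i
  ... | before i<a     = subst (_< n) (sym (BlockSwap.before a s t i<a)) i<n
  ... | left j i≡ j<t  = subst (_< n) (sym (BlockSwap.left a s t j i≡ j<t))
    (ℕ.<-≤-trans (ℕ.+-monoʳ-< (a + s) j<t) (subst (_≤ n) (swap-ends a s t) c≤n))
  ... | right j i≡ j<s = subst (_< n) (sym (BlockSwap.right a s t j i≡ j<s))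
    (ℕ.<-≤-trans (ℕ.+-monoʳ-< a j<s) (ℕ.≤-trans (ℕ.+-monoˡ-≤ s (ℕ.m≤m+n a t)) c≤n))
  ... | after c≤i      = subst (_< n) (sym (BlockSwap.after a s t c≤i)) i<n

  record UniqueDescent (f : ℕ → ℕ) (d : ℕ) : Set where
    field
      descent : f (suc d) < f d
      ascent  : ∀ m → m ≢ d → f m < f (suc m)

  -- The only drop is from the last entry of the front block, at position a + t - 1, to the entry a
  -- that opens the second one.
  blockSwap-uniqueDescent : ∀ {a s t d} → 0 < s → 0 < t → suc d ≡ a + t → UniqueDescent (blockSwap a s t) d
  blockSwap-uniqueDescent {a} {s} {t} {d} 0<s 0<t 1+d≡a+t = record { descent = descent′ ; ascent = ascent′ }
    where
    module B = BlockSwap a s t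
    f = blockSwap a s t
    f[a+t]≡a : ∀ {i} → i ≡ a + t → f i ≡ a
    f[a+t]≡a i≡ = trans (B.right 0 (trans i≡ (sym (ℕ.+-identityʳ (a + t)))) 0<s) (ℕ.+-identityʳ a)
    descent′ : f (suc d) < f d
    descent′ with offset (ℕ.≤-pred (subst (a <_) (sym 1+d≡a+t) (subst (_< a + t) (ℕ.+-identityʳ a) (ℕ.+-monoʳ-< a 0<t))))
    ... | j , d≡a+j = subst₂ _<_ (sym (f[a+t]≡a 1+d≡a+t)) (sym (B.left j d≡a+j j<t))
      (ℕ.<-≤-trans (subst (_< a + s) (ℕ.+-identityʳ a) (ℕ.+-monoʳ-< a 0<s)) (ℕ.m≤m+n (a + s) j))
      where
      j<t : j < t
      j<t = ℕ.+-cancelˡ-< a j t (subst₂ _<_ d≡a+j 1+d≡a+t (ℕ.n<1+n d))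
    ascent′ : ∀ m → m ≢ d → f m < f (suc m)
    ascent′ m m≢d with position a s t m
    ... | before m<a with ℕ.m≤n⇒m<n∨m≡n m<a
    ...   | inj₁ 1+m<a = subst₂ _<_ (sym (B.before m<a)) (sym (B.before 1+m<a)) (ℕ.n<1+n m)
    ...   | inj₂ 1+m≡a = subst₂ _<_ (sym (B.before m<a)) (sym (B.left 0 (trans 1+m≡a (sym (ℕ.+-identityʳ a))) 0<t))
      (ℕ.<-≤-trans m<a (ℕ.≤-trans (ℕ.m≤m+n a s) (ℕ.m≤m+n (a + s) 0)))
    ascent′ m m≢d | left j m≡ j<t with ℕ.m≤n⇒m<n∨m≡n j<t
    ...   | inj₁ 1+j<t = subst₂ _<_ (sym (B.left j m≡ j<t)) (sym (B.left (suc j) (trans (cong suc m≡) (sym (ℕ.+-suc a j))) 1+j<t))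
      (ℕ.+-monoʳ-< (a + s) (ℕ.n<1+n j))
    ...   | inj₂ 1+j≡t = contradiction (ℕ.suc-injective (begin
      suc m        ≡⟨ cong suc m≡ ⟩
      suc (a + j)  ≡⟨ ℕ.+-suc a j ⟨
      a + suc j    ≡⟨ cong (a +_) 1+j≡t ⟩
      a + t        ≡⟨ 1+d≡a+t ⟨
      suc d        ∎)) m≢d
      where open ≡-Reasoning
    ascent′ m m≢d | right j m≡ j<s with ℕ.m≤n⇒m<n∨m≡n j<s
    ...   | inj₁ 1+j<s = subst₂ _<_ (sym (B.right j m≡ j<s)) (sym (B.right (suc j) (trans (cong suc m≡) (sym (ℕ.+-suc (a + t) j))) 1+j<s))
      (ℕ.+-monoʳ-< a (ℕ.n<1+n j))
    ...   | inj₂ 1+j≡s = subst₂ _<_ (sym (B.right j m≡ j<s)) (sym (B.after (ℕ.≤-reflexive (sym 1+m≡c))))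
      (s≤s (subst (a + j ≤_) (sym m≡) (ℕ.+-monoˡ-≤ j (ℕ.m≤m+n a t))))
      where
      1+m≡c : suc m ≡ a + t + s
      1+m≡c = trans (cong suc m≡) (trans (sym (ℕ.+-suc (a + t) j)) (cong (a + t +_) 1+j≡s))
    ascent′ m m≢d | after c≤m = subst₂ _<_ (sym (B.after c≤m)) (sym (B.after (ℕ.m≤n⇒m≤1+n c≤m))) (ℕ.n<1+n m)

  -- Classification of bigrassmannian permutations

  least : ∀ {P : ℕ → Set} → (∀ n → Dec (P n)) → ∀ n → P n → ∃ λ a → P a × (∀ i → i < a → ¬ P i)
  least P? zero    p = 0 , p , λ _ ()
  least P? (suc n) p with P? 0
  ... | yes p₀ = 0 , p₀ , λ _ ()
  ... | no ¬p₀ with least (P? ∘ suc) n p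
  ...   | a , pa , minimal = suc a , pa , λ { zero _ → ¬p₀ ; (suc i) (s≤s i<a) → minimal i i<a }

  -- Entries are integers, so every ascent gains at least 1.
  climb : ∀ (f : ℕ → ℕ) x j → (∀ m → x ≤ m → m < x + j → f m < f (suc m)) → f x + j ≤ f (x + j)
  climb f x zero    up = ℕ.≤-reflexive (trans (ℕ.+-identityʳ (f x)) (cong f (sym (ℕ.+-identityʳ x))))
  climb f x (suc j) up = begin
    f x + suc j        ≡⟨ ℕ.+-suc (f x) j ⟩
    suc (f x + j)      ≤⟨ s≤s (climb f x j (λ m x≤m m< → up m x≤m (ℕ.<-trans m< (ℕ.+-monoʳ-< x (ℕ.n<1+n j))))) ⟩
    suc (f (x + j))    ≤⟨ up (x + j) (ℕ.m≤m+n x j) (ℕ.+-monoʳ-< x (ℕ.n<1+n j)) ⟩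
    f (suc (x + j))    ≡⟨ cong f (ℕ.+-suc x j) ⟨
    f (x + suc j)      ∎
    where open ℕ.≤-Reasoning

  climb-< : ∀ (f : ℕ → ℕ) {x y} → x < y → (∀ m → x ≤ m → m < y → f m < f (suc m)) → f x < f y
  climb-< f {x} x<y up with offset x<y
  ... | j , refl = ℕ.<-≤-trans (ℕ.m<m+n (f x) {suc j} (s≤s z≤n)) (subst (λ y → f x + suc j ≤ f y) (ℕ.+-suc x j)
    (climb f x (suc j) (λ m x≤m m< → up m x≤m (subst (m <_) (ℕ.+-suc x j) m<))))

  record Inverses (f g : ℕ → ℕ) : Set where
    field
      f∘g : ∀ i → f (g i) ≡ i
      g∘f : ∀ i → g (f i) ≡ i

    f-injective : ∀ {i j} → f i ≡ f j → i ≡ j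
    f-injective e = trans (sym (g∘f _)) (trans (cong g e) (g∘f _))

  inverses-flip : ∀ {f g} → Inverses f g → Inverses g f
  inverses-flip inv = record { f∘g = Inverses.g∘f inv ; g∘f = Inverses.f∘g inv }

  record FirstMoved (f : ℕ → ℕ) (a : ℕ) : Set where
    field
      fixed : ∀ i → i < a → f i ≡ i
      moved : f a ≢ a

  module _ {f g : ℕ → ℕ} (inv : Inverses f g) {a : ℕ} (first : FirstMoved f a) where

    open Inverses inv
    open FirstMoved first

    -- A value below a is already taken by a fixed point, so f(a) can only be larger.
    moved-up : a < f a
    moved-up with ℕ.<-cmp a (f a)
    ... | tri< a<fa _ _ = a<fa
    ... | tri≈ _ a≡fa _ = contradiction (sym a≡fa) moved
    ... | tri> _ _ fa<a = contradiction (f-injective (fixed (f a) fa<a)) moved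

    firstMoved-flip : FirstMoved g a
    firstMoved-flip = record
      { fixed = λ i i<a → trans (cong g (sym (fixed i i<a))) (g∘f i)
      ; moved = λ ga≡a → moved (trans (cong f (sym ga≡a)) (f∘g a))
      }

  module _ {f g : ℕ → ℕ} (inv : Inverses f g) {a d : ℕ} (first : FirstMoved f a) (ud : UniqueDescent f d) where

    open Inverses inv
    open FirstMoved first
    open UniqueDescent ud

    private
      p = g a

      fa≮fp : ¬ (f a < f p)
      fa≮fp fa<fp = ℕ.<-asym (moved-up inv first) (subst (f a <_) (f∘g a) fa<fp)

      a<p : a < p
      a<p = moved-up (inverses-flip inv) (firstMoved-flip inv first)

      d<p : d < p
      d<p with p ℕ.≤? d
      ... | yes p≤d = contradiction (climb-< f a<p (λ m _ m<p → ascent m (ℕ.<⇒≢ (ℕ.<-≤-trans m<p p≤d)))) fa≮fp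
      ... | no p≰d  = ℕ.≰⇒> p≰d

      a≤d : a ≤ d
      a≤d with d ℕ.<? a
      ... | yes d<a = contradiction (climb-< f a<p (λ m a≤m _ → ascent m (ℕ.<⇒≢ (ℕ.<-≤-trans d<a a≤m) ∘ sym))) fa≮fp
      ... | no d≮a  = ℕ.≮⇒≥ d≮a

    firstMoved<descent : a < suc d
    firstMoved<descent = s≤s a≤d

    -- With p = g(a), both a < p and f(p) = a < f(a), so the descent falls between them: a ≤ d < p.
    -- Were d + 1 < p, then f would climb from d + 1 to p, and f(d + 1) < a would be a value that a
    -- fixed point already takes.
    descent≡firstMoved : g a ≡ suc d
    descent≡firstMoved with ℕ.m≤n⇒m<n∨m≡n d<p
    ... | inj₂ 1+d≡p = sym 1+d≡p
    ... | inj₁ 1+d<p = contradiction (ℕ.<⇒≤ (subst (_< a) (f-injective (fixed (f (suc d)) f[1+d]<a)) f[1+d]<a)) (ℕ.<⇒≱ firstMoved<descent)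
      where
      f[1+d]<a : f (suc d) < a
      f[1+d]<a = subst (f (suc d) <_) (f∘g a) (climb-< f 1+d<p (λ m d<m _ → ascent m (ℕ.<⇒≢ d<m ∘ sym)))

  module _ {f g : ℕ → ℕ} (inv : Inverses f g) {a d e s t : ℕ}
           (ud-f : UniqueDescent f d) (ud-g : UniqueDescent g e)
           (1+d≡a+t : suc d ≡ a + t) (1+e≡a+s : suc e ≡ a + s) (ga≡a+t : g a ≡ a + t) where

    open Inverses inv

    private
      ascent-after : ∀ m → a + t ≤ m → f m < f (suc m)
      ascent-after m a+t≤m = UniqueDescent.ascent ud-f m (ℕ.<⇒≢ (subst (_≤ m) (sym 1+d≡a+t) a+t≤m) ∘ sym)

      f[a+t]≡a : f (a + t) ≡ a
      f[a+t]≡a = trans (cong f (sym ga≡a+t)) (f∘g a)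

    climb-after : ∀ x j → a + t ≤ x → f x + j ≤ f (x + j)
    climb-after x j a+t≤x = climb f x j (λ m x≤m _ → ascent-after m (ℕ.≤-trans a+t≤x x≤m))

    -- Up to entry a + s the inverse g climbs from g(a) = a + t, so a + j sits at position a + t + j
    -- or later. Past a + t, f climbs from the value a, so the entry at a + t + j is at least a + j.
    -- A later position for a + j would force a smaller entry there.
    second-block : ∀ j → j < s → f (a + t + j) ≡ a + j
    second-block j j<s with ℕ.m≤n⇒m<n∨m≡n g[a+j]≥
      where
      g[a+j]≥ : a + t + j ≤ g (a + j)
      g[a+j]≥ = subst (λ x → x + j ≤ g (a + j)) ga≡a+t (climb g a j (λ m _ m<a+j → UniqueDescent.ascent ud-g m
        (λ m≡e → ℕ.<⇒≱ m<a+j (ℕ.≤-pred (subst (a + j <_) (trans (sym 1+e≡a+s) (cong suc (sym m≡e))) (ℕ.+-monoʳ-< a j<s))))))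
    ... | inj₂ e≡ = trans (cong f e≡) (f∘g (a + j))
    ... | inj₁ lt = contradiction (subst (f (a + t + j) <_) (f∘g (a + j)) (climb-< f lt (λ m x≤m _ → ascent-after m (ℕ.≤-trans (ℕ.m≤m+n (a + t) j) x≤m))))
      (ℕ.≤⇒≯ (subst (λ x → x + j ≤ f (a + t + j)) f[a+t]≡a (climb-after (a + t) j ℕ.≤-refl)))

  module _ {f g : ℕ → ℕ} (inv : Inverses f g) {a d e s t : ℕ}
           (ud-f : UniqueDescent f d) (ud-g : UniqueDescent g e)
           (1+d≡a+t : suc d ≡ a + t) (1+e≡a+s : suc e ≡ a + s) (ga≡a+t : g a ≡ a + t) (fa≡a+s : f a ≡ a + s) (0<s : 0 < s) where

    open Inverses inv

    first-block : ∀ j → j < t → f (a + j) ≡ a + s + j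
    first-block j j<t = trans (cong f (sym (second-block (inverses-flip inv) ud-g ud-f 1+e≡a+s 1+d≡a+t fa≡a+s j j<t))) (f∘g (a + s + j))

    -- The second block ends with the entry a + s - 1, so the next one is at least a + s. The values
    -- from a + s to c - 1 are used up by the first block, hence f(c) ≥ c, and f climbs from there
    -- on.
    tail-≥ : ∀ i → a + t + s ≤ i → i ≤ f i
    tail-≥ i c≤i with offset c≤i
    ... | j , refl = ℕ.≤-trans (ℕ.+-monoˡ-≤ j fc≥c) (climb-after inv ud-f ud-g 1+d≡a+t 1+e≡a+s ga≡a+t c j (ℕ.m≤m+n (a + t) s))
      where
      c = a + t + s
      fc≥a+s : a + s ≤ f c
      fc≥a+s = subst₂ _≤_
        (trans (cong (_+ 1) (second-block inv ud-f ud-g 1+d≡a+t 1+e≡a+s ga≡a+t k (subst (k <_) (sym s≡1+k) (ℕ.n<1+n k)))) (plus-one a))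
        (cong f (plus-one (a + t)))
        (climb-after inv ud-f ud-g 1+d≡a+t 1+e≡a+s ga≡a+t (a + t + k) 1 (ℕ.m≤m+n (a + t) k))
        where
        k = proj₁ (offset 0<s)
        s≡1+k = proj₂ (offset 0<s)
        plus-one : ∀ x → x + k + 1 ≡ x + s
        plus-one x = trans (ℕ.+-assoc x k 1) (cong (x +_) (trans (ℕ.+-comm k 1) (sym s≡1+k)))
      fc≥c : c ≤ f c
      fc≥c with c ℕ.≤? f c
      ... | yes c≤fc = c≤fc
      ... | no c≰fc with offset fc≥a+s
      ...   | j , fc≡ = contradiction (f-injective (trans fc≡ (sym (first-block j j<t))))
        (λ c≡ → ℕ.<⇒≱ (ℕ.+-monoʳ-< a j<t) (subst (a + t ≤_) c≡ (ℕ.m≤m+n (a + t) s)))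
        where
        j<t : j < t
        j<t = ℕ.+-cancelˡ-< (a + s) j t (subst₂ _<_ fc≡ (swap-ends a s t) (ℕ.≰⇒> c≰fc))

  -- All parameters are read off: a is the first moved point, and a + t and a + s are the positions
  -- right after the descents of f and of g.
  classification : ∀ {f g : ℕ → ℕ} → Inverses f g → ∀ {d e} → UniqueDescent f d → UniqueDescent g e →
    ∃ λ a → ∃₂ λ s t → 0 < s × 0 < t × IsBlockSwap a s t f
  classification {f} {g} inv {d} {e} ud-f ud-g = a , s , t , 0<s , 0<t , record
    { before = FirstMoved.fixed first _
    ; left   = λ j i≡ j<t → trans (cong f i≡) (first-block inv ud-f ud-g 1+d≡a+t 1+e≡a+s ga≡a+t fa≡a+s 0<s j j<t)
    ; right  = λ j i≡ j<s → trans (cong f i≡) (second-block inv ud-f ud-g 1+d≡a+t 1+e≡a+s ga≡a+t j j<s)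
    -- The reverse inequality is `tail-≥` for g at the point f(i).
    ; after  = λ {i} c≤i → let i≤fi = tail-≥ inv ud-f ud-g 1+d≡a+t 1+e≡a+s ga≡a+t fa≡a+s 0<s i c≤i in
        ℕ.≤-antisym
          (subst (f i ≤_) (Inverses.g∘f inv i) (tail-≥ (inverses-flip inv) ud-g ud-f 1+e≡a+s 1+d≡a+t fa≡a+s ga≡a+t 0<t (f i)
            (subst (_≤ f i) (swap-ends a s t) (ℕ.≤-trans c≤i i≤fi))))
          i≤fi
    }
    where
    -- The search for a needs some moved point: if d and d + 1 were both fixed, there would be no
    -- descent at d.
    moves : ∃ λ n → f n ≢ n
    moves with f d ℕ.≟ d | f (suc d) ℕ.≟ suc d
    ... | no ne | _     = d , ne
    ... | yes _ | no ne = suc d , ne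
    ... | yes p | yes q = contradiction (subst₂ _<_ q p (UniqueDescent.descent ud-f)) (ℕ.<-asym (ℕ.n<1+n d))
    search = least (λ n → ¬? (f n ℕ.≟ n)) (proj₁ moves) (proj₂ moves)
    a = proj₁ search
    first : FirstMoved f a
    first = record
      { fixed = λ i i<a → decidable-stable (f i ℕ.≟ i) (proj₂ (proj₂ search) i i<a)
      ; moved = proj₁ (proj₂ search)
      }
    first-g = firstMoved-flip inv first
    t = suc d ∸ a
    s = suc e ∸ a
    a<1+d = firstMoved<descent inv first ud-f
    a<1+e = firstMoved<descent (inverses-flip inv) first-g ud-g
    1+d≡a+t : suc d ≡ a + t
    1+d≡a+t = sym (ℕ.m+[n∸m]≡n (ℕ.<⇒≤ a<1+d))
    1+e≡a+s : suc e ≡ a + s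
    1+e≡a+s = sym (ℕ.m+[n∸m]≡n (ℕ.<⇒≤ a<1+e))
    0<t = ℕ.m<n⇒0<n∸m a<1+d
    0<s = ℕ.m<n⇒0<n∸m a<1+e
    ga≡a+t = trans (descent≡firstMoved inv first ud-f) 1+d≡a+t
    fa≡a+s = trans (descent≡firstMoved (inverses-flip inv) first-g ud-g) 1+e≡a+s

  -- Permutations extended to ℕ

  extend : Permutation′ n → ℕ → ℕ
  extend {n} ω i with i ℕ.<? n
  ... | yes i<n = toℕ (ω ⟨$⟩ʳ fromℕ< i<n)
  ... | no _    = i

  extend-toℕ : ∀ (ω : Permutation′ n) i → extend ω (toℕ i) ≡ toℕ (ω ⟨$⟩ʳ i)
  extend-toℕ {n} ω i with toℕ i ℕ.<? n
  ... | yes i<n = cong (λ j → toℕ (ω ⟨$⟩ʳ j)) (Fin.fromℕ<-toℕ i i<n)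
  ... | no i≮n  = contradiction (Fin.toℕ<n i) i≮n

  extend-≥ : ∀ (ω : Permutation′ n) {i} → n ≤ i → extend ω i ≡ i
  extend-≥ {n} ω {i} n≤i with i ℕ.<? n
  ... | yes i<n = contradiction i<n (ℕ.≤⇒≯ n≤i)
  ... | no _    = refl

  extend-≡ : ∀ (ω : Permutation′ n) {f : ℕ → ℕ} → (∀ i → toℕ (ω ⟨$⟩ʳ i) ≡ f (toℕ i)) → (∀ {i} → n ≤ i → f i ≡ i) →
             ∀ i → extend ω i ≡ f i
  extend-≡ {n} ω {f} small large i with i ℕ.<? n
  ... | yes i<n = trans (small (fromℕ< i<n)) (cong f (Fin.toℕ-fromℕ< i<n))
  ... | no i≮n  = sym (large (ℕ.≮⇒≥ i≮n))

  extend-inverseʳ : ∀ (ω : Permutation′ n) i → extend ω (extend (flip ω) i) ≡ i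
  extend-inverseʳ {n} ω i with i ℕ.<? n
  ... | yes i<n = trans (extend-toℕ ω _) (trans (cong toℕ (inverseʳ ω)) (Fin.toℕ-fromℕ< i<n))
  ... | no i≮n  = extend-≥ ω (ℕ.≮⇒≥ i≮n)

  extend-inverses : ∀ (ω : Permutation′ n) → Inverses (extend ω) (extend (flip ω))
  extend-inverses ω = record { f∘g = extend-inverseʳ ω ; g∘f = extend-inverseʳ (flip ω) }

  -- The extension creates no descent at or beyond the end, so the descents counted on [n] are all
  -- descents on ℕ.
  extend-<-suc : ∀ (ω : Permutation′ n) {i} → n ≤ suc i → extend ω i < extend ω (suc i)
  extend-<-suc {n} ω {i} n≤1+i = subst (extend ω i <_) (sym (extend-≥ ω n≤1+i)) bound
    where
    bound : extend ω i < suc i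
    bound with i ℕ.<? n
    ... | yes i<n = ℕ.<-≤-trans (Fin.toℕ<n (ω ⟨$⟩ʳ fromℕ< i<n)) n≤1+i
    ... | no _    = ℕ.n<1+n i

  module _ {m : ℕ} {P : Fin m → Set} (P? : Decidable P) where

    filter-allFin-unique⁻ : length (filter P? (allFin m)) ≡ 1 → ∃ λ d → P d × (∀ i → P i → i ≡ d)
    filter-allFin-unique⁻ len with filter P? (allFin m) | (λ i → ∈-filter⁻ P? {v = i} {allFin m}) | (λ {i} → ∈-filter⁺ P? (∈-allFin i))
    ... | d ∷ [] | sound | complete = d , proj₂ (sound d (here refl)) , λ i Pi → single (complete Pi)
      where
      single : ∀ {i} → i ∈ d ∷ [] → i ≡ d
      single (here i≡d) = i≡d

    filter-allFin-unique⁺ : ∀ {d} → P d → (∀ i → P i → i ≡ d) → length (filter P? (allFin m)) ≡ 1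
    filter-allFin-unique⁺ {d} Pd uniq with filter P? (allFin m) | (λ i → ∈-filter⁻ P? {v = i} {allFin m})
      | ∈-filter⁺ P? (∈-allFin d) Pd | Unique.filter⁺ P? (Unique.allFin⁺ m)
    ... | x ∷ []     | _     | _ | _ = refl
    ... | x ∷ y ∷ zs | sound | _ | (x≢y ∷ _) ∷ _ = contradiction
      (trans (uniq x (proj₂ (sound x (here refl)))) (sym (uniq y (proj₂ (sound y (there (here refl))))))) x≢y

  extend-suc : ∀ {m} (ω : Permutation′ (suc m)) i → extend ω (suc (toℕ i)) ≡ toℕ (ω ⟨$⟩ʳ suc i)
  extend-suc ω i = extend-toℕ ω (suc i)

  extend-inject₁ : ∀ {m} (ω : Permutation′ (suc m)) i → extend ω (toℕ i) ≡ toℕ (ω ⟨$⟩ʳ inject₁ i)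
  extend-inject₁ ω i = trans (cong (extend ω) (sym (Fin.toℕ-inject₁ i))) (extend-toℕ ω (inject₁ i))

  descents≡1⇒uniqueDescent : ∀ (ω : Permutation′ n) → descents ω ≡ 1 → ∃ (UniqueDescent (extend ω))
  descents≡1⇒uniqueDescent {suc m} ω des with filter-allFin-unique⁻ _ des
  ... | d , descent , unique = toℕ d , record
    { descent = subst₂ _<_ (sym (extend-suc ω d)) (sym (extend-inject₁ ω d)) descent
    ; ascent  = ascent
    }
    where
    ascent : ∀ i → i ≢ toℕ d → extend ω i < extend ω (suc i)
    ascent i i≢d with i ℕ.<? m
    ... | no i≮m  = extend-<-suc ω (s≤s (ℕ.≮⇒≥ i≮m))
    ... | yes i<m = subst (λ i → extend ω i < extend ω (suc i)) (Fin.toℕ-fromℕ< i<m)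
      (subst₂ _<_ (sym (extend-inject₁ ω j)) (sym (extend-suc ω j)) (ℕ.≤∧≢⇒< (ℕ.≮⇒≥ (j≢d ∘ unique j)) distinct))
      where
      j = fromℕ< i<m
      j≢d : j ≢ d
      j≢d j≡d = i≢d (trans (sym (Fin.toℕ-fromℕ< i<m)) (cong toℕ j≡d))
      distinct : toℕ (ω ⟨$⟩ʳ inject₁ j) ≢ toℕ (ω ⟨$⟩ʳ suc j)
      distinct e = ℕ.1+n≢n (sym (trans (sym (Fin.toℕ-inject₁ j)) (cong toℕ (⟨$⟩ʳ-injective ω (Fin.toℕ-injective e)))))

  uniqueDescent⇒descents≡1 : ∀ (ω : Permutation′ n) {d} → UniqueDescent (extend ω) d → descents ω ≡ 1
  uniqueDescent⇒descents≡1 {zero}  ω ud = contradiction (UniqueDescent.descent ud) (ℕ.<-asym (extend-<-suc ω z≤n))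
  uniqueDescent⇒descents≡1 {suc m} ω {d} ud = filter-allFin-unique⁺ _ {fromℕ< d<m}
    (subst₂ _<_ (trans (cong (extend ω ∘ suc) (sym d≡)) (extend-suc ω _)) (trans (cong (extend ω) (sym d≡)) (extend-inject₁ ω _)) descent)
    unique
    where
    open UniqueDescent ud
    d<m : d < m
    d<m = ℕ.≰⇒> (λ m≤d → ℕ.<-asym descent (extend-<-suc ω (s≤s m≤d)))
    d≡ = Fin.toℕ-fromℕ< d<m
    unique : ∀ i → toℕ (ω ⟨$⟩ʳ suc i) < toℕ (ω ⟨$⟩ʳ inject₁ i) → i ≡ fromℕ< d<m
    unique i lt with toℕ i ℕ.≟ d
    ... | yes i≡d = Fin.toℕ-injective (trans i≡d (sym d≡))
    ... | no i≢d  = contradiction lt (ℕ.<-asym (subst₂ _<_ (extend-inject₁ ω i) (extend-suc ω i) (ascent (toℕ i) i≢d)))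

  UniqueDescent-resp : ∀ {f g d} → (∀ i → f i ≡ g i) → UniqueDescent f d → UniqueDescent g d
  UniqueDescent-resp f≗g ud = record
    { descent = subst₂ _<_ (f≗g _) (f≗g _) (UniqueDescent.descent ud)
    ; ascent  = λ m m≢d → subst₂ _<_ (f≗g _) (f≗g _) (UniqueDescent.ascent ud m m≢d)
    }

  record IsBlockPermutation (ω : Permutation′ n) (a s t : ℕ) : Set where
    field
      0<s : 0 < s
      0<t : 0 < t
      extend≡ : ∀ i → extend ω i ≡ blockSwap a s t i

    value : ∀ i → toℕ (ω ⟨$⟩ʳ i) ≡ blockSwap a s t (toℕ i)
    value i = trans (sym (extend-toℕ ω i)) (extend≡ (toℕ i))

    -- The last position of the second block is moved, whereas `extend` fixes everything from n on.
    bound : a + t + s ≤ n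
    bound with a + t + s ℕ.≤? n | offset 0<s | offset 0<t
    ... | yes c≤n | _       | _       = c≤n
    ... | no c≰n  | k , s≡1+k | l , t≡1+l = contradiction (trans (sym (extend-≥ ω n≤i)) (trans (extend≡ (a + t + k))
      (BlockSwap.right a s t k refl (subst (k <_) (sym s≡1+k) (ℕ.n<1+n k)))))
      (ℕ.<⇒≢ (ℕ.+-monoˡ-< k (subst (_< a + t) (ℕ.+-identityʳ a) (ℕ.+-monoʳ-< a 0<t))) ∘ sym)
      where
      n≤i : n ≤ a + t + k
      n≤i = ℕ.≤-pred (subst (n <_) (trans (cong (a + t +_) s≡1+k) (ℕ.+-suc (a + t) k)) (ℕ.≰⇒> c≰n))

  open IsBlockPermutation

  isBlockPermutation-flip : ∀ {ω : Permutation′ n} {a s t} → IsBlockPermutation ω a s t → IsBlockPermutation (flip ω) a t s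
  isBlockPermutation-flip {ω = ω} {a} {s} {t} ib = record
    { 0<s = ib .0<t
    ; 0<t = ib .0<s
    ; extend≡ = λ i → begin
        extend (flip ω) i                                        ≡⟨ cong (extend (flip ω)) (blockSwap-inverse a s t i) ⟨
        extend (flip ω) (blockSwap a s t (blockSwap a t s i))    ≡⟨ cong (extend (flip ω)) (extend≡ ib (blockSwap a t s i)) ⟨
        extend (flip ω) (extend ω (blockSwap a t s i))           ≡⟨ extend-inverseʳ (flip ω) _ ⟩
        blockSwap a t s i                                        ∎
    }
    where open ≡-Reasoning

  blockPermutation : ∀ {a s t} → a + t + s ≤ n → Permutation′ n
  blockPermutation {n} {a} {s} {t} c≤n = permutation (to s t c≤n) (to t s c≤n′) (inverse s t c≤n c≤n′) (inverse t s c≤n′ c≤n)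
    where
    c≤n′ = subst (_≤ n) (swap-ends a s t) c≤n
    to : ∀ s t → a + t + s ≤ n → Fin n → Fin n
    to s t c≤n i = fromℕ< (blockSwap-bounded {a} {s} {t} c≤n (Fin.toℕ<n i))
    inverse : ∀ s t c≤n c≤n′ i → to s t c≤n (to t s c≤n′ i) ≡ i
    inverse s t c≤n c≤n′ i = Fin.toℕ-injective (trans (Fin.toℕ-fromℕ< _)
      (trans (cong (blockSwap a s t) (Fin.toℕ-fromℕ< _)) (blockSwap-inverse a s t (toℕ i))))

  blockPermutation-isBlockPermutation : ∀ {a s t} → 0 < s → 0 < t → (c≤n : a + t + s ≤ n) →
    IsBlockPermutation (blockPermutation {n} {a} {s} {t} c≤n) a s t
  blockPermutation-isBlockPermutation {n} {a} {s} {t} 0<s 0<t c≤n = record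
    { 0<s = 0<s
    ; 0<t = 0<t
    ; extend≡ = extend-≡ (blockPermutation c≤n) (λ i → Fin.toℕ-fromℕ< _) (λ n≤i → BlockSwap.after a s t (ℕ.≤-trans c≤n n≤i))
    }

  isBlockPermutation-resp-≈ : ∀ {π σ : Permutation′ n} {a s t} → π ≈ σ → IsBlockPermutation π a s t → IsBlockPermutation σ a s t
  isBlockPermutation-resp-≈ {n} {π} {σ} {a} {s} {t} π≈σ ib = record
    { 0<s = 0<s ib
    ; 0<t = 0<t ib
    ; extend≡ = extend-≡ σ (λ i → trans (cong toℕ (sym (π≈σ i))) (value ib i)) (λ n≤i → BlockSwap.after a s t (ℕ.≤-trans (bound ib) n≤i))
    }

  isBlockPermutation⇒≈ : ∀ {π σ : Permutation′ n} {a s t} → IsBlockPermutation π a s t → IsBlockPermutation σ a s t → π ≈ σ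
  isBlockPermutation⇒≈ ib ib′ i = Fin.toℕ-injective (trans (value ib i) (sym (value ib′ i)))

  isBlockPermutation⇒descents≡1 : ∀ (ω : Permutation′ n) {a s t} → IsBlockPermutation ω a s t → descents ω ≡ 1
  isBlockPermutation⇒descents≡1 ω {a} {s} {t} ib with offset (0<t ib)
  ... | k , t≡1+k = uniqueDescent⇒descents≡1 ω {a + k} (UniqueDescent-resp (λ i → sym (extend≡ ib i))
    (blockSwap-uniqueDescent (0<s ib) (0<t ib) (trans (sym (ℕ.+-suc a k)) (cong (a +_) (sym t≡1+k)))))

  isBlockPermutation⇒bigrassmannian : ∀ {ω : Permutation′ n} {a s t} → IsBlockPermutation ω a s t → Bigrassmannian ω
  isBlockPermutation⇒bigrassmannian {ω = ω} ib =
    isBlockPermutation⇒descents≡1 ω ib , isBlockPermutation⇒descents≡1 (flip ω) (isBlockPermutation-flip ib)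

  isBlockSwap⇒isBlockPermutation : ∀ {ω : Permutation′ n} →
    (∃ λ a → ∃₂ λ s t → 0 < s × 0 < t × IsBlockSwap a s t (extend ω)) → ∃ λ a → ∃₂ (IsBlockPermutation ω a)
  isBlockSwap⇒isBlockPermutation (a , s , t , 0<s , 0<t , ib) = a , s , t , record
    { 0<s = 0<s ; 0<t = 0<t ; extend≡ = isBlockSwap-unique ib (isBlockSwap a s t) }

  bigrassmannian⇒isBlockPermutation : ∀ {ω : Permutation′ n} → Bigrassmannian ω → ∃ λ a → ∃₂ (IsBlockPermutation ω a)
  bigrassmannian⇒isBlockPermutation {ω = ω} (des , des⁻¹) = isBlockSwap⇒isBlockPermutation (classification (extend-inverses ω)
    (proj₂ (descents≡1⇒uniqueDescent ω des)) (proj₂ (descents≡1⇒uniqueDescent (flip ω) des⁻¹)))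

  -- Bruhat order on bigrassmannian permutations

  abstract
    -- Monotone envelopes of a block swap, as the invariance of bounds requires. The upper one is
    -- attained up to the end of the front block, the lower one, with c = a + t + s, from there on.
    shiftUp shiftDown : ℕ → ℕ → ℕ → ℕ
    shiftUp   a s i = if i <ᵇ a then i else s + i
    shiftDown c t i = if i <ᵇ c then i ∸ t else i

    shiftUp-< : ∀ {a s i} → i < a → shiftUp a s i ≡ i
    shiftUp-< i<a rewrite <ᵇ-true i<a = refl

    shiftUp-≥ : ∀ {a s i} → a ≤ i → shiftUp a s i ≡ s + i
    shiftUp-≥ a≤i rewrite <ᵇ-false a≤i = refl

    shiftDown-< : ∀ {c t i} → i < c → shiftDown c t i ≡ i ∸ t
    shiftDown-< i<c rewrite <ᵇ-true i<c = refl

    shiftDown-≥ : ∀ {c t i} → c ≤ i → shiftDown c t i ≡ i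
    shiftDown-≥ c≤i rewrite <ᵇ-false c≤i = refl

  shiftUp-mono : ∀ a s {i j} → i ≤ j → shiftUp a s i ≤ shiftUp a s j
  shiftUp-mono a s {i} {j} i≤j with i ℕ.<? a | j ℕ.<? a
  ... | yes i<a | yes j<a = subst₂ _≤_ (sym (shiftUp-< i<a)) (sym (shiftUp-< j<a)) i≤j
  ... | yes i<a | no j≮a  = subst₂ _≤_ (sym (shiftUp-< i<a)) (sym (shiftUp-≥ (ℕ.≮⇒≥ j≮a))) (ℕ.≤-trans i≤j (ℕ.m≤n+m j s))
  ... | no i≮a  | yes j<a = contradiction (ℕ.≤-<-trans i≤j j<a) i≮a
  ... | no i≮a  | no j≮a  = subst₂ _≤_ (sym (shiftUp-≥ (ℕ.≮⇒≥ i≮a))) (sym (shiftUp-≥ (ℕ.≮⇒≥ j≮a))) (ℕ.+-monoʳ-≤ s i≤j)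

  shiftDown-mono : ∀ c t {i j} → i ≤ j → shiftDown c t i ≤ shiftDown c t j
  shiftDown-mono c t {i} {j} i≤j with i ℕ.<? c | j ℕ.<? c
  ... | yes i<c | yes j<c = subst₂ _≤_ (sym (shiftDown-< i<c)) (sym (shiftDown-< j<c)) (ℕ.∸-monoˡ-≤ t i≤j)
  ... | yes i<c | no j≮c  = subst₂ _≤_ (sym (shiftDown-< i<c)) (sym (shiftDown-≥ (ℕ.≮⇒≥ j≮c))) (ℕ.≤-trans (ℕ.m∸n≤m i t) i≤j)
  ... | no i≮c  | yes j<c = contradiction (ℕ.≤-<-trans i≤j j<c) i≮c
  ... | no i≮c  | no j≮c  = subst₂ _≤_ (sym (shiftDown-≥ (ℕ.≮⇒≥ i≮c))) (sym (shiftDown-≥ (ℕ.≮⇒≥ j≮c))) i≤j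

  a+s+j≡s+[a+j] : ∀ a s j → a + s + j ≡ s + (a + j)
  a+s+j≡s+[a+j] = solve-∀

  blockSwap≤shiftUp : ∀ a s t i → blockSwap a s t i ≤ shiftUp a s i
  blockSwap≤shiftUp a s t i with position a s t i
  ... | before i<a     = ℕ.≤-reflexive (trans (BlockSwap.before a s t i<a) (sym (shiftUp-< i<a)))
  ... | left j i≡ j<t  = ℕ.≤-reflexive (begin
    blockSwap a s t i   ≡⟨ BlockSwap.left a s t j i≡ j<t ⟩
    a + s + j           ≡⟨ a+s+j≡s+[a+j] a s j ⟩
    s + (a + j)         ≡⟨ cong (s +_) i≡ ⟨
    s + i               ≡⟨ shiftUp-≥ (subst (a ≤_) (sym i≡) (ℕ.m≤m+n a j)) ⟨
    shiftUp a s i       ∎)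
    where open ≡-Reasoning
  ... | right j i≡ j<s = subst₂ _≤_ (sym (BlockSwap.right a s t j i≡ j<s))
    (trans (cong (s +_) (sym i≡)) (sym (shiftUp-≥ (subst (a ≤_) (sym i≡) (ℕ.≤-trans (ℕ.m≤m+n a t) (ℕ.m≤m+n (a + t) j))))))
    (ℕ.≤-trans (ℕ.+-monoˡ-≤ j (ℕ.m≤m+n a t)) (ℕ.m≤n+m (a + t + j) s))
  ... | after c≤i      = subst₂ _≤_ (sym (BlockSwap.after a s t c≤i))
    (sym (shiftUp-≥ (ℕ.≤-trans (ℕ.≤-trans (ℕ.m≤m+n a t) (ℕ.m≤m+n (a + t) s)) c≤i))) (ℕ.m≤n+m i s)

  shiftDown≤blockSwap : ∀ a s t i → shiftDown (a + t + s) t i ≤ blockSwap a s t i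
  shiftDown≤blockSwap a s t i with position a s t i
  ... | before i<a     = subst₂ _≤_ (sym (shiftDown-< (ℕ.<-≤-trans i<a (ℕ.≤-trans (ℕ.m≤m+n a t) (ℕ.m≤m+n (a + t) s)))))
    (sym (BlockSwap.before a s t i<a)) (ℕ.m∸n≤m i t)
  ... | left j i≡ j<t  = subst₂ _≤_ (sym (shiftDown-< (subst (_< a + t + s) (sym i≡) (ℕ.<-≤-trans (ℕ.+-monoʳ-< a j<t) (ℕ.m≤m+n (a + t) s)))))
    (sym (BlockSwap.left a s t j i≡ j<t)) (ℕ.≤-trans (ℕ.m∸n≤m i t) (subst (_≤ a + s + j) (sym i≡) (ℕ.+-monoˡ-≤ j (ℕ.m≤m+n a s))))
  ... | right j i≡ j<s = ℕ.≤-reflexive (begin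
    shiftDown (a + t + s) t i  ≡⟨ shiftDown-< (subst (_< a + t + s) (sym i≡) (ℕ.+-monoʳ-< (a + t) j<s)) ⟩
    i ∸ t                      ≡⟨ cong (_∸ t) (trans i≡ (a+s+j≡s+[a+j] a t j)) ⟩
    t + (a + j) ∸ t            ≡⟨ ℕ.m+n∸m≡n t (a + j) ⟩
    a + j                      ≡⟨ BlockSwap.right a s t j i≡ j<s ⟨
    blockSwap a s t i          ∎)
    where open ≡-Reasoning
  ... | after c≤i      = ℕ.≤-reflexive (trans (shiftDown-≥ c≤i) (sym (BlockSwap.after a s t c≤i)))

  record Dominates (a s t a′ s′ t′ : ℕ) : Set where
    field
      a≤a′ : a ≤ a′
      s′≤s : s′ ≤ s
      t′≤t : t′ ≤ t
      c′≤c : a′ + t′ + s′ ≤ a + t + s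

  module _ {π σ : Permutation′ n} {a s t a′ s′ t′} (block-π : IsBlockPermutation π a′ s′ t′) (block-σ : IsBlockPermutation σ a s t) where

    -- Two positions of π suffice. Its front block opens at a′ with the entry a′ + s′, and the upper
    -- envelope there gives a ≤ a′ and s′ ≤ s. Its second block closes at c′ - 1 with the entry a′ +
    -- s′ - 1, and the lower envelope there gives c′ ≤ c and t′ ≤ t.
    ≤ᴮ⇒dominates : π ≤ᴮ σ → Dominates a s t a′ s′ t′
    ≤ᴮ⇒dominates π≤σ = record { a≤a′ = a≤a′ ; s′≤s = s′≤s ; t′≤t = t′≤t ; c′≤c = c′≤c }
      where
      c = a + t + s
      upper : ∀ i → i < n → blockSwap a′ s′ t′ i ≤ shiftUp a s i
      upper i i<n = subst₂ _≤_ (trans (value block-π (fromℕ< i<n)) (cong (blockSwap a′ s′ t′) (Fin.toℕ-fromℕ< i<n))) (cong (shiftUp a s) (Fin.toℕ-fromℕ< i<n))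
        (≤ᴮ-upper (shiftUp-mono a s) π≤σ (λ i → subst (_≤ shiftUp a s (toℕ i)) (sym (value block-σ i)) (blockSwap≤shiftUp a s t (toℕ i))) (fromℕ< i<n))
      lower : ∀ i → i < n → shiftDown c t i ≤ blockSwap a′ s′ t′ i
      lower i i<n = subst₂ _≤_ (cong (shiftDown c t) (Fin.toℕ-fromℕ< i<n)) (trans (value block-π (fromℕ< i<n)) (cong (blockSwap a′ s′ t′) (Fin.toℕ-fromℕ< i<n)))
        (≤ᴮ-lower (shiftDown-mono c t) π≤σ (λ i → subst (shiftDown c t (toℕ i) ≤_) (sym (value block-σ i)) (shiftDown≤blockSwap a s t (toℕ i))) (fromℕ< i<n))
      first≤ : s′ + a′ ≤ shiftUp a s a′
      first≤ = subst (_≤ shiftUp a s a′) (trans (BlockSwap.left a′ s′ t′ 0 (sym (ℕ.+-identityʳ a′)) (0<t block-π)) (trans (ℕ.+-identityʳ (a′ + s′)) (ℕ.+-comm a′ s′)))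
        (upper a′ (ℕ.<-≤-trans (ℕ.m<m+n a′ (0<t block-π)) (ℕ.≤-trans (ℕ.m≤m+n (a′ + t′) s′) (bound block-π))))
      a≤a′ : a ≤ a′
      a≤a′ = ℕ.≮⇒≥ (λ a′<a → ℕ.<⇒≱ (ℕ.m<n+m a′ (0<s block-π)) (subst (s′ + a′ ≤_) (shiftUp-< a′<a) first≤))
      s′≤s : s′ ≤ s
      s′≤s = ℕ.+-cancelʳ-≤ a′ s′ s (subst (s′ + a′ ≤_) (shiftUp-≥ a≤a′) first≤)
      k = proj₁ (offset (0<s block-π))
      s′≡1+k = proj₂ (offset (0<s block-π))
      i = a′ + t′ + k
      1+i≡c′ : suc i ≡ a′ + t′ + s′
      1+i≡c′ = trans (sym (ℕ.+-suc (a′ + t′) k)) (cong (a′ + t′ +_) (sym s′≡1+k))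
      last≤ : shiftDown c t i ≤ a′ + k
      last≤ = subst (shiftDown c t i ≤_) (BlockSwap.right a′ s′ t′ k refl (subst (k <_) (sym s′≡1+k) (ℕ.n<1+n k)))
        (lower i (ℕ.≤-trans (ℕ.≤-reflexive 1+i≡c′) (bound block-π)))
      i<c : i < c
      i<c = ℕ.≰⇒> (λ c≤i → ℕ.<⇒≱ (ℕ.+-monoˡ-< k (ℕ.m<m+n a′ (0<t block-π))) (subst (_≤ a′ + k) (shiftDown-≥ c≤i) last≤))
      c′≤c : a′ + t′ + s′ ≤ c
      c′≤c = subst (_≤ c) 1+i≡c′ i<c
      t′≤t : t′ ≤ t
      t′≤t = ℕ.+-cancelʳ-≤ (a′ + k) t′ t (subst (_≤ t + (a′ + k)) (a+s+j≡s+[a+j] a′ t′ k)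
        (ℕ.≤-trans (ℕ.m≤n+m∸n i t) (ℕ.+-monoʳ-≤ t (subst (_≤ a′ + k) (shiftDown-< i<c) last≤))))

    -- The threshold is the end a + t of the front block of σ: before it σ equals its upper
    -- envelope, from there on its lower one, and π lies within its own, tighter envelopes.
    dominates⇒≤ᴮ : Dominates a s t a′ s′ t′ → π ≤ᴮ σ
    dominates⇒≤ᴮ dom = threshold⇒≤ᴮ (a + t) π σ (record
      { below = λ i i<p → subst₂ _≤_ (sym (value block-π i)) (sym (value block-σ i)) (below (toℕ i) i<p)
      ; above = λ i p≤i → subst₂ _≤_ (sym (value block-σ i)) (sym (value block-π i)) (above (toℕ i) p≤i)
      })
      where
      open Dominates dom
      below : ∀ i → i < a + t → blockSwap a′ s′ t′ i ≤ blockSwap a s t i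
      below i i<p with position a s t i
      ... | before i<a     = ℕ.≤-reflexive (trans (BlockSwap.before a′ s′ t′ (ℕ.<-≤-trans i<a a≤a′)) (sym (BlockSwap.before a s t i<a)))
      ... | left j i≡ j<t  = ℕ.≤-trans (blockSwap≤shiftUp a′ s′ t′ i) (ℕ.≤-trans shiftUp≤ (ℕ.≤-trans (ℕ.+-monoˡ-≤ i s′≤s)
        (ℕ.≤-reflexive (trans (cong (s +_) i≡) (trans (sym (a+s+j≡s+[a+j] a s j)) (sym (BlockSwap.left a s t j i≡ j<t)))))))
        where
        shiftUp≤ : shiftUp a′ s′ i ≤ s′ + i
        shiftUp≤ with i ℕ.<? a′
        ... | yes i<a′ = subst (_≤ s′ + i) (sym (shiftUp-< i<a′)) (ℕ.m≤n+m i s′)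
        ... | no i≮a′  = ℕ.≤-reflexive (shiftUp-≥ (ℕ.≮⇒≥ i≮a′))
      ... | right j i≡ _   = contradiction i<p (ℕ.≤⇒≯ (subst (a + t ≤_) (sym i≡) (ℕ.m≤m+n (a + t) j)))
      ... | after c≤i      = contradiction i<p (ℕ.≤⇒≯ (ℕ.≤-trans (ℕ.m≤m+n (a + t) s) c≤i))
      above : ∀ i → a + t ≤ i → blockSwap a s t i ≤ blockSwap a′ s′ t′ i
      above i p≤i with position a s t i
      ... | before i<a     = contradiction (ℕ.≤-trans (ℕ.m≤m+n a t) p≤i) (ℕ.<⇒≱ i<a)
      ... | left j i≡ j<t  = contradiction p≤i (ℕ.<⇒≱ (subst (_< a + t) (sym i≡) (ℕ.+-monoʳ-< a j<t)))
      ... | right j i≡ j<s = ℕ.≤-trans (ℕ.≤-reflexive (trans (BlockSwap.right a s t j i≡ j<s)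
          (sym (trans (cong (_∸ t) (trans i≡ (a+s+j≡s+[a+j] a t j))) (ℕ.m+n∸m≡n t (a + j))))))
        (ℕ.≤-trans (ℕ.∸-monoʳ-≤ i t′≤t) (ℕ.≤-trans ≤shiftDown (shiftDown≤blockSwap a′ s′ t′ i)))
        where
        ≤shiftDown : i ∸ t′ ≤ shiftDown (a′ + t′ + s′) t′ i
        ≤shiftDown with i ℕ.<? a′ + t′ + s′
        ... | yes i<c′ = ℕ.≤-reflexive (sym (shiftDown-< i<c′))
        ... | no i≮c′  = subst (i ∸ t′ ≤_) (sym (shiftDown-≥ (ℕ.≮⇒≥ i≮c′))) (ℕ.m∸n≤m i t′)
      ... | after c≤i      = ℕ.≤-reflexive (trans (BlockSwap.after a s t c≤i) (sym (BlockSwap.after a′ s′ t′ (ℕ.≤-trans c′≤c c≤i))))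

  -- Reflexivity of the Bruhat order gives domination both ways, and domination is antisymmetric.
  isBlockPermutation-unique : ∀ {π : Permutation′ n} {a s t a′ s′ t′} → IsBlockPermutation π a s t → IsBlockPermutation π a′ s′ t′ →
                              a ≡ a′ × s ≡ s′ × t ≡ t′
  isBlockPermutation-unique {π = π} ib ib′ = let
      d  = ≤ᴮ⇒dominates ib′ ib (done (λ _ → refl))
      d′ = ≤ᴮ⇒dominates ib ib′ (done (λ _ → refl))
      open Dominates
    in ℕ.≤-antisym (a≤a′ d) (a≤a′ d′) , ℕ.≤-antisym (s′≤s d′) (s′≤s d) , ℕ.≤-antisym (t′≤t d′) (t′≤t d)

module Enumeration where

  open import Defs
  open import Data.Bool.Base using (true; false; if_then_else_)
  open import Data.Fin.Permutation using (Permutation′; _≈_)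
  open import Data.List.Base using (List; []; _∷_; _++_; length; filter; map; foldr; cartesianProduct; upTo; applyUpTo)
  open import Data.List.Membership.Propositional using (_∈_; find)
  open import Data.List.Membership.Propositional.Properties
    using (∈-filter⁺; ∈-filter⁻; ∈-upTo⁺; ∈-upTo⁻; ∈-cartesianProduct⁺; ∈-cartesianProduct⁻; ∈-∃++; ∈-++⁺ˡ; ∈-++⁺ʳ; ∈-++⁻)
  open import Data.List.Relation.Unary.All as All using (_∷_)
  import Data.List.Relation.Unary.All.Properties as All
  open import Data.List.Relation.Unary.AllPairs as AllPairs using (AllPairs; []; _∷_)
  import Data.List.Relation.Unary.AllPairs.Properties as AllPairs
  open import Data.List.Relation.Unary.Any using (here; there)
  open import Data.List.Relation.Unary.Unique.Propositional using (Unique)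
  import Data.List.Relation.Unary.Unique.Propositional.Properties as Unique
  open import Data.Nat.Base as ℕ using (ℕ; zero; suc; _+_; _*_; _∸_; _≤_; _<_; s≤s)
  import Data.Nat.Properties as ℕ
  import Data.Nat.Tactic.RingSolver as ℕ
  open import Data.Product.Base using (∃; _×_; _,_; proj₁; proj₂)
  open import Data.Rational.Base as ℚ using (ℚ; 0ℚ; 1ℚ)
  import Data.Rational.Properties as ℚ
  open import Data.Sum.Base using (inj₁; inj₂)
  open import Function.Base using (_∘_; id)
  open import Relation.Binary.PropositionalEquality
  open import Relation.Nullary using (¬_; Dec; yes; no; does; contradiction)
  open import Relation.Nullary.Decidable using (_×-dec_; dec-true; dec-false)
  open import Relation.Unary using (Decidable)
  open import Tactic.RingSolver using (solve-∀)
  open Asymptotics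
  open Bruhat

  private
    variable
      n : ℕ
      A B : Set

  -- Sums over lists

  listSum : (A → ℚ) → List A → ℚ
  listSum f xs = foldr ℚ._+_ 0ℚ (map f xs)

  listSum-cong : ∀ {f g : A → ℚ} → (∀ x → f x ≡ g x) → ∀ xs → listSum f xs ≡ listSum g xs
  listSum-cong eq []       = refl
  listSum-cong eq (x ∷ xs) = cong₂ ℚ._+_ (eq x) (listSum-cong eq xs)

  listSum-1 : ∀ (xs : List A) → listSum (λ _ → 1ℚ) xs ≡ ι (length xs)
  listSum-1 []       = sym ι-0
  listSum-1 (x ∷ xs) = trans (cong (1ℚ ℚ.+_) (listSum-1 xs)) (trans (ℚ.+-comm 1ℚ (ι (length xs))) (sym (ι-suc (length xs))))

  listSum-++ : ∀ (f : A → ℚ) xs ys → listSum f (xs ++ ys) ≡ listSum f xs ℚ.+ listSum f ys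
  listSum-++ f []       ys = sym (ℚ.+-identityˡ (listSum f ys))
  listSum-++ f (x ∷ xs) ys = trans (cong (f x ℚ.+_) (listSum-++ f xs ys)) (sym (ℚ.+-assoc (f x) (listSum f xs) (listSum f ys)))

  listSum-map : ∀ (f : B → ℚ) (g : A → B) xs → listSum f (map g xs) ≡ listSum (f ∘ g) xs
  listSum-map f g []       = refl
  listSum-map f g (x ∷ xs) = cong (f (g x) ℚ.+_) (listSum-map f g xs)

  listSum-filter : ∀ {P : A → Set} (P? : Decidable P) (f : A → ℚ) xs →
                   listSum f (filter P? xs) ≡ listSum (λ x → if does (P? x) then f x else 0ℚ) xs
  listSum-filter P? f []       = refl
  listSum-filter P? f (x ∷ xs) with does (P? x)
  ... | true  = cong (f x ℚ.+_) (listSum-filter P? f xs)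
  ... | false = trans (listSum-filter P? f xs) (sym (ℚ.+-identityˡ _))

  listSum-product : ∀ (f : A × B → ℚ) xs ys →
                    listSum f (cartesianProduct xs ys) ≡ listSum (λ x → listSum (λ y → f (x , y)) ys) xs
  listSum-product f []       ys = refl
  listSum-product f (x ∷ xs) ys = trans (listSum-++ f (map (x ,_) ys) (cartesianProduct xs ys))
    (cong₂ ℚ._+_ (listSum-map f (x ,_) ys) (listSum-product f xs ys))

  listSum-applyUpTo : ∀ (f : A → ℚ) g n → listSum f (applyUpTo g n) ≡ Σ< n (f ∘ g)
  listSum-applyUpTo f g zero    = refl
  listSum-applyUpTo f g (suc n) = cong (f (g 0) ℚ.+_) (listSum-applyUpTo f (g ∘ suc) n)

  listSum-cube : ∀ (f : ℕ × ℕ × ℕ → ℚ) l m n →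
    listSum f (cartesianProduct (upTo l) (cartesianProduct (upTo m) (upTo n)))
      ≡ Σ< l (λ a → Σ< m λ b → Σ< n λ c → f (a , b , c))
  listSum-cube f l m n = begin
    listSum f (cartesianProduct (upTo l) (cartesianProduct (upTo m) (upTo n)))
      ≡⟨ listSum-product f (upTo l) (cartesianProduct (upTo m) (upTo n)) ⟩
    listSum (λ a → listSum (λ y → f (a , y)) (cartesianProduct (upTo m) (upTo n))) (upTo l)
      ≡⟨ listSum-applyUpTo _ id l ⟩
    Σ< l (λ a → listSum (λ y → f (a , y)) (cartesianProduct (upTo m) (upTo n)))
      ≡⟨ Σ<-cong l (λ a _ → trans (listSum-product (λ y → f (a , y)) (upTo m) (upTo n))
           (trans (listSum-applyUpTo _ id m) (Σ<-cong m λ b _ → listSum-applyUpTo _ id n))) ⟩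
    Σ< l (λ a → Σ< m λ b → Σ< n λ c → f (a , b , c)) ∎
    where open ≡-Reasoning

  unique-middle : ∀ as {y : A} {bs} → Unique (as ++ y ∷ bs) → Unique (y ∷ as ++ bs)
  unique-middle []       u = u
  unique-middle (a ∷ as) (a≢ ∷ u) with unique-middle as u | All.++⁻ as a≢
  ... | y≢ ∷ u′ | a≢as , a≢y ∷ a≢bs = ((a≢y ∘ sym) ∷ y≢) ∷ (All.++⁺ a≢as a≢bs ∷ u′)

  -- A relation takes the place of a bijection because permutations are distinct only up to `≈`. The
  -- induction removes the partner of the head from the other list.
  listSum-matching : ∀ {R : A → B → Set} → (∀ {x y y′} → R x y → R x y′ → y ≡ y′) →
    ∀ xs ys → AllPairs (λ x x′ → ∀ {y} → R x y → ¬ R x′ y) xs → Unique ys →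
    (∀ {x} → x ∈ xs → ∃ λ y → y ∈ ys × R x y) → (∀ {y} → y ∈ ys → ∃ λ x → x ∈ xs × R x y) →
    ∀ {f g} → (∀ {x y} → x ∈ xs → R x y → f x ≡ g y) → listSum f xs ≡ listSum g ys
  listSum-matching functional []       []       _ _ _ _ _ = refl
  listSum-matching functional []       (y ∷ ys) _ _ _ from _ with () ← proj₁ (proj₂ (from (here refl)))
  listSum-matching {R = R} functional (x ∷ xs) ys (x# ∷ xs#) u to from {f} {g} eq with to (here refl)
  ... | y , y∈ys , Rxy with ∈-∃++ y∈ys
  ...   | as , bs , refl with unique-middle as u
  ...     | y≢ ∷ u′ = begin
    f x ℚ.+ listSum f xs                        ≡⟨ cong₂ ℚ._+_ (eq (here refl) Rxy) (listSum-matching functional xs (as ++ bs) xs# u′ to′ from′ (eq ∘ there)) ⟩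
    g y ℚ.+ listSum g (as ++ bs)                ≡⟨ cong (g y ℚ.+_) (listSum-++ g as bs) ⟩
    g y ℚ.+ (listSum g as ℚ.+ listSum g bs)     ≡⟨ lemma (g y) (listSum g as) (listSum g bs) ⟩
    listSum g as ℚ.+ (g y ℚ.+ listSum g bs)     ≡⟨ listSum-++ g as (y ∷ bs) ⟨
    listSum g (as ++ y ∷ bs)                    ∎
    where
    open ≡-Reasoning
    lemma : ∀ a b c → a ℚ.+ (b ℚ.+ c) ≡ b ℚ.+ (a ℚ.+ c)
    lemma = solve-∀ ℚ-ring
    drop-middle : ∀ {y′} → y′ ≢ y → y′ ∈ as ++ y ∷ bs → y′ ∈ as ++ bs
    drop-middle y′≢y y′∈ with ∈-++⁻ as y′∈
    ... | inj₁ ∈as             = ∈-++⁺ˡ ∈as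
    ... | inj₂ (here y′≡y)     = contradiction y′≡y y′≢y
    ... | inj₂ (there ∈bs)     = ∈-++⁺ʳ as ∈bs
    add-middle : ∀ {y′} → y′ ∈ as ++ bs → y′ ∈ as ++ y ∷ bs
    add-middle y′∈ with ∈-++⁻ as y′∈
    ... | inj₁ ∈as = ∈-++⁺ˡ ∈as
    ... | inj₂ ∈bs = ∈-++⁺ʳ as (there ∈bs)
    to′ : ∀ {x′} → x′ ∈ xs → ∃ λ y′ → y′ ∈ as ++ bs × R x′ y′
    to′ x′∈ with to (there x′∈)
    ... | y′ , y′∈ , Rx′y′ = y′ , drop-middle (λ { refl → All.lookup x# x′∈ Rxy Rx′y′ }) y′∈ , Rx′y′
    from′ : ∀ {y′} → y′ ∈ as ++ bs → ∃ λ x′ → x′ ∈ xs × R x′ y′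
    from′ y′∈ with from (add-middle y′∈)
    ... | x′ , there x′∈ , Rx′y′ = x′ , x′∈ , Rx′y′
    ... | _ , here refl , Rxy′   = contradiction (functional Rxy Rxy′) (All.lookup y≢ y′∈)

  -- Enumerating bigrassmannian permutations

  -- All that the counts need to know about the list `𝔅 n`; a variable list can then replace it.
  record Enumerates (L : List (Permutation′ n)) : Set where
    field
      sound    : ∀ {ω} → ω ∈ L → Bigrassmannian ω
      complete : ∀ {a s t} → 0 < s → 0 < t → a + t + s ≤ n → ∃ λ ω → ω ∈ L × IsBlockPermutation ω a s t
      unique   : AllPairs (λ π σ → ¬ π ≈ σ) L

  𝔅-enumerates : ∀ n → Enumerates (𝔅 n)
  𝔅-enumerates n = record
    { sound    = λ ω∈ → proj₂ (∈-filter⁻ bigrassmannian? {xs = permutations n} ω∈)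
    ; complete = complete
    ; unique   = AllPairs.filter⁺ bigrassmannian? (permutations-unique n)
    }
    where
    complete : ∀ {a s t} → 0 < s → 0 < t → a + t + s ≤ n → ∃ λ ω → ω ∈ 𝔅 n × IsBlockPermutation ω a s t
    complete 0<s 0<t c≤n = let
        ω , ω∈ , π≈ω = find (permutations-complete (blockPermutation c≤n))
        block = isBlockPermutation-resp-≈ {π = blockPermutation c≤n} {ω} π≈ω (blockPermutation-isBlockPermutation 0<s 0<t c≤n)
      in ω , ∈-filter⁺ bigrassmannian? ω∈ (isBlockPermutation⇒bigrassmannian block) , block

  module _ {L : List (Permutation′ n)} (enum : Enumerates L) {ω : Permutation′ n} (≤ω? : Decidable (_≤ᴮ ω))
           {a s t : ℕ} (block : IsBlockPermutation ω a s t) where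

    open Enumerates enum

    private
      c : ℕ
      c = a + t + s

      -- (i , j , x) stands for the parameters a + x, s ∸ i, t ∸ j.
      Below : ℕ × ℕ × ℕ → Set
      Below (i , j , x) = x < suc (i + j)

      below? : Decidable Below
      below? (i , j , x) = x ℕ.<? suc (i + j)

      box indices : List (ℕ × ℕ × ℕ)
      -- From i < s and j < t follows i + j < s + t, so the third side is long enough for every x ≤
      -- i + j.
      box     = cartesianProduct (upTo s) (cartesianProduct (upTo t) (upTo (s + t)))
      indices = filter below? box

      R : Permutation′ n → ℕ × ℕ × ℕ → Set
      R π (i , j , x) = i < s × j < t × IsBlockPermutation π (a + x) (s ∸ i) (t ∸ j)

      R-functional : ∀ {π y y′} → R π y → R π y′ → y ≡ y′
      R-functional {y = i , j , x} {i′ , j′ , x′} (i<s , j<t , ib) (i′<s , j′<t , ib′) =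
        let a≡ , s≡ , t≡ = isBlockPermutation-unique ib ib′
        in cong₂ _,_ (ℕ.∸-cancelˡ-≡ (ℕ.<⇒≤ i<s) (ℕ.<⇒≤ i′<s) s≡)
             (cong₂ _,_ (ℕ.∸-cancelˡ-≡ (ℕ.<⇒≤ j<t) (ℕ.<⇒≤ j′<t) t≡) (ℕ.+-cancelˡ-≡ a x x′ a≡))

      R-separates : ∀ {π σ} → ¬ π ≈ σ → ∀ {y} → R π y → ¬ R σ y
      R-separates {π} {σ} π≉σ (_ , _ , ib) (_ , _ , ib′) = π≉σ (isBlockPermutation⇒≈ {π = π} {σ} ib ib′)

      rearrange : ∀ x t′ s′ i j → a + x + t′ + s′ + (i + j) ≡ a + (j + t′) + (i + s′) + x
      rearrange x t′ s′ i j = lemma a x t′ s′ i j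
        where
        lemma : ∀ a x t′ s′ i j → a + x + t′ + s′ + (i + j) ≡ a + (j + t′) + (i + s′) + x
        lemma = ℕ.solve-∀

      -- The new right end c′ satisfies c′ + i + j = c + x, so c′ ≤ c amounts to x ≤ i + j.
      ends : ∀ {i j x} → i ≤ s → j ≤ t → a + x + (t ∸ j) + (s ∸ i) + (i + j) ≡ c + x
      ends {i} {j} {x} i≤s j≤t = trans (rearrange x (t ∸ j) (s ∸ i) i j)
        (cong₂ (λ t s → a + t + s + x) (ℕ.m+[n∸m]≡n j≤t) (ℕ.m+[n∸m]≡n i≤s))

      index : ∀ {π a′ s′ t′} → IsBlockPermutation π a′ s′ t′ → π ≤ᴮ ω → ∃ λ y → y ∈ indices × R π y
      index {π} {a′} {s′} {t′} ib π≤ω = (i , j , x) ,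
        ∈-filter⁺ below? (∈-cartesianProduct⁺ (∈-upTo⁺ i<s) (∈-cartesianProduct⁺ (∈-upTo⁺ j<t)
          (∈-upTo⁺ (ℕ.≤-<-trans x≤i+j (ℕ.+-mono-< i<s j<t))))) (s≤s x≤i+j) ,
        i<s , j<t , subst₂ (λ a s → IsBlockPermutation π a s (t ∸ j)) a+x≡a′ s∸i≡s′ (subst (IsBlockPermutation π a′ s′) t∸j≡t′ ib)
        where
        open Dominates (≤ᴮ⇒dominates ib block π≤ω)
        i = s ∸ s′
        j = t ∸ t′
        x = a′ ∸ a
        i<s : i < s
        i<s = ℕ.∸-monoʳ-< (IsBlockPermutation.0<s ib) s′≤s
        j<t : j < t
        j<t = ℕ.∸-monoʳ-< (IsBlockPermutation.0<t ib) t′≤t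
        a+x≡a′ : a′ ≡ a + x
        a+x≡a′ = sym (ℕ.m+[n∸m]≡n a≤a′)
        s∸i≡s′ : s′ ≡ s ∸ i
        s∸i≡s′ = sym (ℕ.m∸[m∸n]≡n s′≤s)
        t∸j≡t′ : t′ ≡ t ∸ j
        t∸j≡t′ = sym (ℕ.m∸[m∸n]≡n t′≤t)
        x≤i+j : x ≤ i + j
        x≤i+j = ℕ.+-cancelˡ-≤ c x (i + j) (begin
          c + x                                       ≡⟨ ends (ℕ.<⇒≤ i<s) (ℕ.<⇒≤ j<t) ⟨
          a + x + (t ∸ j) + (s ∸ i) + (i + j)         ≡⟨ cong₂ (λ p q → p + (t ∸ j) + q + (i + j)) a+x≡a′ s∸i≡s′ ⟨
          a′ + (t ∸ j) + s′ + (i + j)                 ≡⟨ cong (λ p → a′ + p + s′ + (i + j)) t∸j≡t′ ⟨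
          a′ + t′ + s′ + (i + j)                      ≤⟨ ℕ.+-monoˡ-≤ (i + j) c′≤c ⟩
          c + (i + j)                                 ∎)
          where open ℕ.≤-Reasoning

      permutationAt : ∀ {i j x} → i < s → j < t → x ≤ i + j → ∃ λ π → π ∈ L × π ≤ᴮ ω × R π (i , j , x)
      permutationAt {i} {j} {x} i<s j<t x≤i+j = π , π∈ , dominates⇒≤ᴮ ib block dominated , i<s , j<t , ib
        where
        c′≤c : a + x + (t ∸ j) + (s ∸ i) ≤ c
        c′≤c = ℕ.+-cancelʳ-≤ (i + j) (a + x + (t ∸ j) + (s ∸ i)) c
          (subst (_≤ c + (i + j)) (sym (ends (ℕ.<⇒≤ i<s) (ℕ.<⇒≤ j<t))) (ℕ.+-monoʳ-≤ c x≤i+j))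
        dominated : Dominates a s t (a + x) (s ∸ i) (t ∸ j)
        dominated = record { a≤a′ = ℕ.m≤m+n a x ; s′≤s = ℕ.m∸n≤m s i ; t′≤t = ℕ.m∸n≤m t j ; c′≤c = c′≤c }
        found = complete (ℕ.m<n⇒0<n∸m i<s) (ℕ.m<n⇒0<n∸m j<t) (ℕ.≤-trans c′≤c (IsBlockPermutation.bound block))
        π = proj₁ found
        π∈ = proj₁ (proj₂ found)
        ib = proj₂ (proj₂ found)

      to : ∀ {π} → π ∈ filter ≤ω? L → ∃ λ y → y ∈ indices × R π y
      to π∈ = let π∈𝔅 , π≤ω = ∈-filter⁻ ≤ω? {xs = L} π∈
                  _ , _ , _ , ib = bigrassmannian⇒isBlockPermutation (sound π∈𝔅)
              in index ib π≤ω

      from : ∀ {y} → y ∈ indices → ∃ λ π → π ∈ filter ≤ω? L × R π y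
      from {i , j , x} y∈ =
        let y∈cube , x<1+i+j = ∈-filter⁻ below? {xs = box} y∈
            i∈ , jx∈ = ∈-cartesianProduct⁻ (upTo s) (cartesianProduct (upTo t) (upTo (s + t))) y∈cube
            j∈ , _   = ∈-cartesianProduct⁻ (upTo t) (upTo (s + t)) jx∈
            π , π∈ , π≤ω , Rπ = permutationAt (∈-upTo⁻ i∈) (∈-upTo⁻ j∈) (ℕ.≤-pred x<1+i+j)
        in π , ∈-filter⁺ ≤ω? π∈ π≤ω , Rπ

      indices-unique : Unique indices
      indices-unique = Unique.filter⁺ below? (Unique.cartesianProduct⁺ (Unique.upTo⁺ s) (Unique.cartesianProduct⁺ (Unique.upTo⁺ t) (Unique.upTo⁺ (s + t))))

    -- Shortening the blocks by i and j leaves i + j + 1 places for the left end, namely x = 0, ...,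
    -- i + j.
    ι-filter : ι (length (filter ≤ω? L)) ≡ Σ< s (λ i → Σ< t λ j → ι (suc (i + j)))
    ι-filter = begin
      ι (length (filter ≤ω? L))                             ≡⟨ listSum-1 (filter ≤ω? L) ⟨
      listSum (λ _ → 1ℚ) (filter ≤ω? L)            ≡⟨ listSum-matching {R = R} R-functional (filter ≤ω? L) indices
        (AllPairs.filter⁺ ≤ω? (AllPairs.map R-separates unique))
        indices-unique to from (λ _ _ → refl) ⟩
      listSum (λ _ → 1ℚ) indices                            ≡⟨ listSum-filter below? (λ _ → 1ℚ) box ⟩
      listSum (λ y → if does (below? y) then 1ℚ else 0ℚ) box  ≡⟨ listSum-cube _ s t (s + t) ⟩
      Σ< s (λ i → Σ< t λ j → Σ< (s + t) λ x → if does (below? (i , j , x)) then 1ℚ else 0ℚ)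
        ≡⟨ Σ<-cong s (λ i i<s → Σ<-cong t (λ j j<t → inner i j (ℕ.+-mono-≤ i<s (ℕ.<⇒≤ j<t)))) ⟩
      Σ< s (λ i → Σ< t λ j → ι (suc (i + j)))               ∎
      where
      open ≡-Reasoning
      inner : ∀ i j → suc (i + j) ≤ s + t → Σ< (s + t) (λ x → if does (below? (i , j , x)) then 1ℚ else 0ℚ) ≡ ι (suc (i + j))
      inner i j ≤s+t = begin
        Σ< (s + t) (λ x → if does (below? (i , j , x)) then 1ℚ else 0ℚ)
          ≡⟨ Σ<-truncate _ ≤s+t (λ x x≥ → cong (if_then 1ℚ else 0ℚ) (dec-false (below? (i , j , x)) (ℕ.≤⇒≯ x≥))) ⟩
        Σ< (suc (i + j)) (λ x → if does (below? (i , j , x)) then 1ℚ else 0ℚ)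
          ≡⟨ Σ<-cong (suc (i + j)) (λ x x< → cong (if_then 1ℚ else 0ℚ) (dec-true (below? (i , j , x)) x<)) ⟩
        Σ< (suc (i + j)) (λ _ → 1ℚ)     ≡⟨ Σ<-const (suc (i + j)) 1ℚ ⟩
        ι (suc (i + j)) ℚ.* 1ℚ          ≡⟨ ℚ.*-identityʳ (ι (suc (i + j))) ⟩
        ι (suc (i + j))                 ∎

  -- The closed form of β

  2*Σ<-arithmetic : ∀ c t → ι 2 ℚ.* Σ< t (λ j → ι (c + j)) ℚ.+ ι t ≡ ι (t * (2 * c + t))
  2*Σ<-arithmetic c zero    = trans (cong₂ ℚ._+_ (ℚ.*-zeroʳ (ι 2)) ι-0) (sym ι-0)
  2*Σ<-arithmetic c (suc t) = begin
    ι 2 ℚ.* (ι (c + 0) ℚ.+ Σ< t (λ j → ι (c + suc j))) ℚ.+ ι (suc t)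
      ≡⟨ cong₂ (λ p q → ι 2 ℚ.* (ι (c + 0) ℚ.+ p) ℚ.+ q) (Σ<-cong t (λ j _ → cong ι (ℕ.+-suc c j))) (ι-suc t) ⟩
    ι 2 ℚ.* (ι (c + 0) ℚ.+ Σ< t (λ j → ι (suc c + j))) ℚ.+ (ι t ℚ.+ 1ℚ)
      ≡⟨ lemma (ι 2) (ι (c + 0)) (Σ< t (λ j → ι (suc c + j))) (ι t) ⟩
    ι 2 ℚ.* ι (c + 0) ℚ.+ 1ℚ ℚ.+ (ι 2 ℚ.* Σ< t (λ j → ι (suc c + j)) ℚ.+ ι t)
      ≡⟨ cong₂ (λ p q → p ℚ.+ q) (trans (cong (ℚ._+ 1ℚ) (sym (ι-* 2 (c + 0)))) (sym (ι-suc (2 * (c + 0))))) (2*Σ<-arithmetic (suc c) t) ⟩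
    ι (suc (2 * (c + 0))) ℚ.+ ι (t * (2 * suc c + t))
      ≡⟨ ι-+ (suc (2 * (c + 0))) (t * (2 * suc c + t)) ⟨
    ι (suc (2 * (c + 0)) + t * (2 * suc c + t))
      ≡⟨ cong ι (lemma₂ c t) ⟩
    ι (suc t * (2 * c + suc t)) ∎
    where
    open ≡-Reasoning
    lemma : ∀ w p q r → w ℚ.* (p ℚ.+ q) ℚ.+ (r ℚ.+ 1ℚ) ≡ w ℚ.* p ℚ.+ 1ℚ ℚ.+ (w ℚ.* q ℚ.+ r)
    lemma = solve-∀ ℚ-ring
    lemma₂ : ∀ c t → suc (2 * (c + 0)) + t * (2 * suc c + t) ≡ suc t * (2 * c + suc t)
    lemma₂ = ℕ.solve-∀

  -- The offset c varies in the induction because `Σ<` removes the first term. The added 2st avoids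
  -- subtraction; at c = 1 it leaves st(s + t).
  2*ΣΣ<-arithmetic : ∀ c s t → ι 2 ℚ.* Σ< s (λ i → Σ< t λ j → ι (c + i + j)) ℚ.+ ι (2 * (s * t)) ≡ ι (s * t * (2 * c + s + t))
  2*ΣΣ<-arithmetic c zero    t = trans (cong₂ ℚ._+_ (ℚ.*-zeroʳ (ι 2)) ι-0) (sym ι-0)
  2*ΣΣ<-arithmetic c (suc s) t = begin
    ι 2 ℚ.* (Σ< t (λ j → ι (c + 0 + j)) ℚ.+ Σ< s (λ i → Σ< t λ j → ι (c + suc i + j))) ℚ.+ ι (2 * (suc s * t))
      ≡⟨ cong₂ (λ p q → ι 2 ℚ.* (Σ< t (λ j → ι (c + 0 + j)) ℚ.+ p) ℚ.+ q)
           (Σ<-cong s (λ i _ → Σ<-cong t (λ j _ → cong (λ k → ι (k + j)) (ℕ.+-suc c i))))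
           (trans (cong ι (lemma₂ s t)) (trans (ι-+ (t + t) (2 * (s * t))) (cong (ℚ._+ ι (2 * (s * t))) (ι-+ t t)))) ⟩
    ι 2 ℚ.* (Σ< t (λ j → ι (c + 0 + j)) ℚ.+ Σ< s (λ i → Σ< t λ j → ι (suc c + i + j))) ℚ.+ (ι t ℚ.+ ι t ℚ.+ ι (2 * (s * t)))
      ≡⟨ lemma (ι 2) (Σ< t (λ j → ι (c + 0 + j))) (Σ< s (λ i → Σ< t λ j → ι (suc c + i + j))) (ι t) (ι (2 * (s * t))) ⟩
    (ι 2 ℚ.* Σ< t (λ j → ι (c + 0 + j)) ℚ.+ ι t) ℚ.+ ι t ℚ.+ (ι 2 ℚ.* Σ< s (λ i → Σ< t λ j → ι (suc c + i + j)) ℚ.+ ι (2 * (s * t)))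
      ≡⟨ cong₂ (λ p q → p ℚ.+ ι t ℚ.+ q) (2*Σ<-arithmetic (c + 0) t) (2*ΣΣ<-arithmetic (suc c) s t) ⟩
    ι (t * (2 * (c + 0) + t)) ℚ.+ ι t ℚ.+ ι (s * t * (2 * suc c + s + t))
      ≡⟨ trans (ι-+ (t * (2 * (c + 0) + t) + t) (s * t * (2 * suc c + s + t))) (cong (ℚ._+ ι (s * t * (2 * suc c + s + t))) (ι-+ (t * (2 * (c + 0) + t)) t)) ⟨
    ι (t * (2 * (c + 0) + t) + t + s * t * (2 * suc c + s + t))
      ≡⟨ cong ι (lemma₃ c s t) ⟩
    ι (suc s * t * (2 * c + suc s + t)) ∎
    where
    open ≡-Reasoning
    lemma : ∀ w p q r u → w ℚ.* (p ℚ.+ q) ℚ.+ (r ℚ.+ r ℚ.+ u) ≡ (w ℚ.* p ℚ.+ r) ℚ.+ r ℚ.+ (w ℚ.* q ℚ.+ u)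
    lemma = solve-∀ ℚ-ring
    lemma₂ : ∀ s t → 2 * (suc s * t) ≡ t + t + 2 * (s * t)
    lemma₂ = ℕ.solve-∀
    lemma₃ : ∀ c s t → t * (2 * (c + 0) + t) + t + s * t * (2 * suc c + s + t) ≡ suc s * t * (2 * c + suc s + t)
    lemma₃ = ℕ.solve-∀

  2*β : ∀ {ω : Permutation′ n} {a s t} → IsBlockPermutation ω a s t → 2 * β ω ≡ s * (s + t) * t
  2*β {ω = ω} {a} {s} {t} block = ℕ.+-cancelʳ-≡ (2 * (s * t)) (2 * β ω) (s * (s + t) * t) (ι-injective (begin
    ι (2 * β ω + 2 * (s * t))               ≡⟨ trans (ι-+ (2 * β ω) (2 * (s * t))) (cong (ℚ._+ ι (2 * (s * t))) (ι-* 2 (β ω))) ⟩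
    ι 2 ℚ.* ι (β ω) ℚ.+ ι (2 * (s * t))     ≡⟨ cong (λ x → ι 2 ℚ.* x ℚ.+ ι (2 * (s * t))) (ι-filter (𝔅-enumerates _) (_≤ᴮ? ω) block) ⟩
    ι 2 ℚ.* Σ< s (λ i → Σ< t λ j → ι (1 + i + j)) ℚ.+ ι (2 * (s * t)) ≡⟨ 2*ΣΣ<-arithmetic 1 s t ⟩
    ι (s * t * (2 * 1 + s + t))             ≡⟨ cong ι (lemma s t) ⟩
    ι (s * (s + t) * t + 2 * (s * t))       ∎))
    where
    open ≡-Reasoning
    lemma : ∀ s t → s * t * (2 * 1 + s + t) ≡ s * (s + t) * t + 2 * (s * t)
    lemma = ℕ.solve-∀

  -- Sums over bigrassmannian permutations as sums over triples

  module _ {n : ℕ} {L : List (Permutation′ n)} (enum : Enumerates L) where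

    open Enumerates enum

    private
      Increasing : ℕ × ℕ × ℕ → Set
      Increasing (a , b , c) = a < b × b < c

      increasing? : Decidable Increasing
      increasing? (a , b , c) = (a ℕ.<? b) ×-dec (b ℕ.<? c)

      cube triples : List (ℕ × ℕ × ℕ)
      cube    = cartesianProduct (upTo (suc n)) (cartesianProduct (upTo (suc n)) (upTo (suc n)))
      triples = filter increasing? cube

      R : Permutation′ n → ℕ × ℕ × ℕ → Set
      R ω (a , b , c) = a ≤ b × b ≤ c × IsBlockPermutation ω a (b ∸ a) (c ∸ b)

      R-functional : ∀ {ω y y′} → R ω y → R ω y′ → y ≡ y′
      R-functional {y = a , b , c} {a′ , b′ , c′} (a≤b , b≤c , ib) (a′≤b′ , b′≤c′ , ib′) =
        let a≡a′ , s≡ , t≡ = isBlockPermutation-unique ib ib′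
            b≡b′ = trans (sym (ℕ.m+[n∸m]≡n a≤b)) (trans (cong₂ _+_ a≡a′ s≡) (ℕ.m+[n∸m]≡n a′≤b′))
            c≡c′ = trans (sym (ℕ.m+[n∸m]≡n b≤c)) (trans (cong₂ _+_ b≡b′ t≡) (ℕ.m+[n∸m]≡n b′≤c′))
        in cong₂ _,_ a≡a′ (cong₂ _,_ b≡b′ c≡c′)

      R-separates : ∀ {π σ} → ¬ π ≈ σ → ∀ {y} → R π y → ¬ R σ y
      R-separates {π} {σ} π≉σ (_ , _ , ib) (_ , _ , ib′) = π≉σ (isBlockPermutation⇒≈ {π = π} {σ} ib ib′)

      triple : ∀ {ω a s t} → IsBlockPermutation ω a s t → ∃ λ y → y ∈ triples × R ω y
      triple {ω} {a} {s} {t} ib = (a , a + s , a + s + t) ,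
        ∈-filter⁺ increasing? (∈-cartesianProduct⁺ (∈-upTo⁺ (s≤s (ℕ.≤-trans (ℕ.m≤m+n a s) b≤n)))
          (∈-cartesianProduct⁺ (∈-upTo⁺ (s≤s b≤n)) (∈-upTo⁺ (s≤s c≤n))))
          (ℕ.m<m+n a (IsBlockPermutation.0<s ib) , ℕ.m<m+n (a + s) (IsBlockPermutation.0<t ib)) ,
        ℕ.m≤m+n a s , ℕ.m≤m+n (a + s) t ,
        subst₂ (IsBlockPermutation ω a) (sym (ℕ.m+n∸m≡n a s)) (sym (ℕ.m+n∸m≡n (a + s) t)) ib
        where
        c≤n : a + s + t ≤ n
        c≤n = subst (_≤ n) (swap-ends a s t) (IsBlockPermutation.bound ib)
        b≤n : a + s ≤ n
        b≤n = ℕ.≤-trans (ℕ.m≤m+n (a + s) t) c≤n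

      to : ∀ {ω} → ω ∈ L → ∃ λ y → y ∈ triples × R ω y
      to ω∈ = let _ , _ , _ , ib = bigrassmannian⇒isBlockPermutation (sound ω∈) in triple ib

      from : ∀ {y} → y ∈ triples → ∃ λ ω → ω ∈ L × R ω y
      from {a , b , c} y∈ =
        let y∈cube , a<b , b<c = ∈-filter⁻ increasing? {xs = cube} y∈
            _ , bc∈ = ∈-cartesianProduct⁻ (upTo (suc n)) (cartesianProduct (upTo (suc n)) (upTo (suc n))) y∈cube
            _ , c∈  = ∈-cartesianProduct⁻ (upTo (suc n)) (upTo (suc n)) bc∈
            ω , ω∈ , ib = complete {a} (ℕ.m<n⇒0<n∸m a<b) (ℕ.m<n⇒0<n∸m b<c)
              (subst (_≤ n) (sym (ends (ℕ.<⇒≤ a<b) (ℕ.<⇒≤ b<c))) (ℕ.≤-pred (∈-upTo⁻ c∈)))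
        in ω , ω∈ , ℕ.<⇒≤ a<b , ℕ.<⇒≤ b<c , ib
        where
        ends : a ≤ b → b ≤ c → a + (c ∸ b) + (b ∸ a) ≡ c
        ends a≤b b≤c = begin
          a + (c ∸ b) + (b ∸ a)     ≡⟨ swap-ends a (b ∸ a) (c ∸ b) ⟩
          a + (b ∸ a) + (c ∸ b)     ≡⟨ cong (_+ (c ∸ b)) (ℕ.m+[n∸m]≡n a≤b) ⟩
          b + (c ∸ b)               ≡⟨ ℕ.m+[n∸m]≡n b≤c ⟩
          c                         ∎
          where open ≡-Reasoning

      triples-unique : Unique triples
      triples-unique = Unique.filter⁺ increasing? (Unique.cartesianProduct⁺ (Unique.upTo⁺ (suc n)) (Unique.cartesianProduct⁺ (Unique.upTo⁺ (suc n)) (Unique.upTo⁺ (suc n))))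

    -- Permutations in the list correspond to triples a < b < c ≤ n with s = b - a and t = c - b.
    -- All other triples of the cube have `spread` 0, where φ vanishes.
    listSum-tripleSum : ∀ (φ : ℕ → ℚ) → φ 0 ≡ 0ℚ → {f : Permutation′ n → ℚ} →
      (∀ {ω a s t} → IsBlockPermutation ω a s t → f ω ≡ φ (s * (s + t) * t)) → listSum f L ≡ tripleSum φ (suc n)
    listSum-tripleSum φ φ0≡0 {f} f≡ = begin
      listSum f L                                             ≡⟨ listSum-matching {R = R} R-functional L triples
        (AllPairs.map R-separates unique)
        triples-unique to from (λ _ → value) ⟩
      listSum g triples                                           ≡⟨ listSum-filter increasing? g cube ⟩
      listSum (λ y → if does (increasing? y) then g y else 0ℚ) cube ≡⟨ listSum-cong (λ y → support (increasing? y)) cube ⟩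
      listSum g cube                                              ≡⟨ listSum-cube g (suc n) (suc n) (suc n) ⟩
      tripleSum φ (suc n)                                         ∎
      where
      open ≡-Reasoning
      g : ℕ × ℕ × ℕ → ℚ
      g (a , b , c) = φ (spread a b c)
      value : ∀ {ω y} → R ω y → f ω ≡ g y
      value {y = a , b , c} (a≤b , b≤c , ib) = trans (f≡ ib) (cong (λ w → φ ((b ∸ a) * w * (c ∸ b))) (begin
        (b ∸ a) + (c ∸ b)             ≡⟨ ℕ.m+n∸m≡n a ((b ∸ a) + (c ∸ b)) ⟨
        a + ((b ∸ a) + (c ∸ b)) ∸ a   ≡⟨ cong (_∸ a) (ℕ.+-assoc a (b ∸ a) (c ∸ b)) ⟨
        a + (b ∸ a) + (c ∸ b) ∸ a     ≡⟨ cong (λ k → k + (c ∸ b) ∸ a) (ℕ.m+[n∸m]≡n a≤b) ⟩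
        b + (c ∸ b) ∸ a               ≡⟨ cong (_∸ a) (ℕ.m+[n∸m]≡n b≤c) ⟩
        c ∸ a                         ∎))
      vanish : ∀ {m} → m ≡ 0 → φ m ≡ 0ℚ
      vanish refl = φ0≡0
      degenerate : ∀ a b c → ¬ Increasing (a , b , c) → g (a , b , c) ≡ 0ℚ
      degenerate a b c ¬inc with a ℕ.<? b
      ... | no a≮b  = vanish (cong (λ k → k * (c ∸ a) * (c ∸ b)) (ℕ.m≤n⇒m∸n≡0 (ℕ.≮⇒≥ a≮b)))
      ... | yes a<b = vanish (trans (cong ((b ∸ a) * (c ∸ a) *_) (ℕ.m≤n⇒m∸n≡0 (ℕ.≮⇒≥ (λ b<c → ¬inc (a<b , b<c)))))
        (ℕ.*-zeroʳ ((b ∸ a) * (c ∸ a))))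
      support : ∀ {y} (inc? : Dec (Increasing y)) → (if does inc? then g y else 0ℚ) ≡ g y
      support             (yes _)   = refl
      support {a , b , c} (no ¬inc) = sym (degenerate a b c ¬inc)

  𝔅-sum-β : ∀ n (φ : ℕ → ℚ) → φ 0 ≡ 0ℚ → listSum (λ ω → φ (2 * β ω)) (𝔅 n) ≡ tripleSum φ (suc n)
  𝔅-sum-β n φ φ0≡0 = listSum-tripleSum (𝔅-enumerates n) φ φ0≡0 (λ ib → cong φ (2*β ib))

  -- Since s(s + t)t is positive, `indicator` takes the value 1 on every bigrassmannian permutation.
  𝔅-length : ∀ n → ι (length (𝔅 n)) ≡ tripleSum indicator (suc n)
  𝔅-length n = trans (sym (listSum-1 (𝔅 n))) (listSum-tripleSum (𝔅-enumerates n) indicator refl (λ ib → sym (indicator-suc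
    (ℕ.*-mono-< {0} {_} {0} (ℕ.*-mono-< {0} {_} {0} (0<s ib) (ℕ.<-≤-trans (0<s ib) (ℕ.m≤m+n _ _))) (0<t ib)))))
    where open IsBlockPermutation

-- The moments of β

module Moments where

  open import Defs
  open import Data.Fin.Permutation using (Permutation′)
  import Data.Integer.Base as ℤ
  open import Data.List.Base using (List; []; _∷_; length)
  open import Data.Nat.Base as ℕ using (ℕ)
  open import Data.Nat.Properties using (m^n≢0; m*n≢0)
  open import Data.Product.Base using (_,_)
  open import Data.Rational.Base using (ℚ; _/_; _+_; _-_; _*_)
  import Data.Rational.Properties as ℚ
  open import Relation.Binary.PropositionalEquality
  open import Tactic.RingSolver using (solve-∀)
  open import Algebra.Bundles using (CommutativeRing)
  open import Algebra.Properties.CommutativeSemiring.Exp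
    (CommutativeRing.commutativeSemiring ℚ.+-*-commutativeRing) using (^-distrib-*)
  open Asymptotics
  open Enumeration

  listSum-*ʳ : ∀ {A : Set} {f g : A → ℚ} {c} → (∀ a → f a * c ≡ g a) → ∀ as → listSum f as * c ≡ listSum g as
  listSum-*ʳ {c = c} eq []       = ℚ.*-zeroˡ c
  listSum-*ʳ {f = f} {c = c} eq (a ∷ as) = trans (ℚ.*-distribʳ-+ c (f a) (listSum f as)) (cong₂ _+_ (eq a) (listSum-*ʳ eq as))

  module _ (k : ℕ) (1≤k : 1 ℕ.≤ k) where

    moment : ∀ n .{{_ : ℕ.NonZero n}} → Permutation′ n → ℚ
    moment n ω = (_/_ (ℤ.+ β ω) (n ℕ.^ 3) {{m^n≢0 n 3}}) ^ k

    -- The factor 2 n³ clears both the normalisation and the half in the formula for β.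
    moment-scaled : ∀ n .{{_ : ℕ.NonZero n}} ω → moment n ω * (ι 2 * ι n ^ 3) ^ k ≡ ι (2 ℕ.* β ω) ^ k
    moment-scaled n ω = begin
      q ^ k * (ι 2 * ι n ^ 3) ^ k      ≡⟨ ^-distrib-* q (ι 2 * ι n ^ 3) k ⟨
      (q * (ι 2 * ι n ^ 3)) ^ k        ≡⟨ cong (_^ k) (lemma q (ι 2) (ι n ^ 3)) ⟩
      (ι 2 * (q * ι n ^ 3)) ^ k        ≡⟨ cong (λ x → (ι 2 * (q * x)) ^ k) (ι-^ n 3) ⟨
      (ι 2 * (q * ι (n ℕ.^ 3))) ^ k    ≡⟨ cong (λ x → (ι 2 * x) ^ k) (/-*-ι (β ω) (n ℕ.^ 3) {{m^n≢0 n 3}}) ⟩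
      (ι 2 * ι (β ω)) ^ k              ≡⟨ cong (_^ k) (ι-* 2 (β ω)) ⟨
      ι (2 ℕ.* β ω) ^ k                ∎
      where
      open ≡-Reasoning
      q = _/_ (ℤ.+ β ω) (n ℕ.^ 3) {{m^n≢0 n 3}}
      lemma : ∀ q t x → q * (t * x) ≡ t * (q * x)
      lemma = solve-∀ ℚ-ring

    mean-moment : (λ n → mean (𝔅 n) (moment n) - (_/_ (ℤ.+ 6) (2 ℕ.^ k) {{m^n≢0 2 k}}) * integralConst k)
      =O (λ n → _/_ (ℤ.+ k) (2 ℕ.^ k ℕ.* n) {{m*n≢0 (2 ℕ.^ k) n {{m^n≢0 2 k}}}})
    -- From n = 2 on, n³ - n is positive, so that `𝔅 n` is nonempty.
    mean-moment = momentBound k 1≤k , 2 , λ n 2≤n → moment-error k 1≤k n 2≤n {mean (𝔅 n) (moment n)}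
      (trans (cong (λ q → ι 6 * q + ι n) (𝔅-length n)) (6*tripleSum-indicator n))
      (begin
        mean (𝔅 n) (moment n) * ι (length (𝔅 n)) * (ι 2 * ι n ^ 3) ^ k
          ≡⟨ cong (_* (ι 2 * ι n ^ 3) ^ k) (mean-length (𝔅 n) (moment n)) ⟩
        listSum (moment n) (𝔅 n) * (ι 2 * ι n ^ 3) ^ k
          ≡⟨ listSum-*ʳ {f = moment n} (moment-scaled n) (𝔅 n) ⟩
        listSum (λ ω → ι (2 ℕ.* β ω) ^ k) (𝔅 n)
          ≡⟨ 𝔅-sum-β n (λ m → ι m ^ k) (0^ k 1≤k) ⟩
        tripleSum (λ m → ι m ^ k) (ℕ.suc n) ∎)
      where open ≡-Reasoning

open import Defs
open import Data.Integer.Base using (+_)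
open import Data.Nat.Base as ℕ using (ℕ)
open import Data.Nat.Properties using (m^n≢0; m*n≢0)
open import Data.Product.Base using (∃; _×_; _,_)
open import Data.Rational.Base using (ℚ; _/_; _-_; _*_)

theorem4p8 : ∀ (k : ℕ) → k ℕ.≥ 1 →
    let instance 2^k≢0 = m^n≢0 2 k in
    ∃ λ (∫ : ℚ) →
    IsIntegralOverRegion (λ x y z → (y - x) ^ k * (z - x) ^ k * (z - y) ^ k) ∫
    × (λ n → mean (𝔅 n) (λ ω → (_/_ (+ β ω) (n ℕ.^ 3) {{m^n≢0 n 3}}) ^ k)
    - (+ 6 / 2 ℕ.^ k) * ∫)
    =O (λ n → _/_ (+ k) (2 ℕ.^ k ℕ.* n) {{m*n≢0 (2 ℕ.^ k) n}})
theorem4p8 k 1≤k = Asymptotics.integralConst k , Asymptotics.isIntegral k 1≤k , Moments.mean-moment k 1≤k
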